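{- The series $\Gamma$ defined in the context is the unique formal power series solution of \[ (C''+u^2J'')\Gamma=\frac{\partial\Gamma}{\partial v} \] satisfying $\Gamma|_{v=0}=B$, where \[ C''=\sum_{R}\Big(\sum_{2\le i\le\ell(R)} w^{\delta_{R_i,\bullet}}\,g_{R_1R_i\cdots R_{\ell(R)}}\,f_{(R_2\cdots R_i)}+w\,g_{R_1}f_{(R)}\Big)\frac{\partial}{\partial g_R}, \] \[ J''=\sum_{R}\sum_{(S)}\Big(\sum_{S_1S_2\cdots S_{\ell(S)}\in(S)} w^{\delta_{S_1,\bullet}}\,g_{R_1S_1\cdots S_{\ell(S)}S_1R_2\cdots R_{\ell(R)}}\Big)\frac{\partial^2}{\partial g_R\,\partial f_{(S)}}, \] with $R=R_1\cdots R_{\ell(R)}$ ranging over nonempty words over $\{\bullet,\circ\}$, $(S)$ over cyclic binary strings, the inner sum of $J''$ over the multiset of cyclic shifts of $S$ (with multiplicity), and $\delta$ the Kronecker delta.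
   Context: A rooted dipole is a 2-cell embedding, in a closed orientable surface, of a connected loopless graph with exactly two vertices (multiple edges allowed), together with a distinguished edge (root edge) and one of its endpoints (root vertex); the other vertex is the non-root vertex. For a dipole $D$, $n(D)$ is its number of edges, $m(D)$ its number of faces and $g(D)=\tfrac12(n(D)-m(D))$ its genus. The root corner is the corner at the root vertex first met when circulating counterclockwise around the root vertex starting at the root edge; the root face is the face containing it. $\widehat{\mathcal D}$ is the set of rooted dipoles equipped with a secondary edge different from the root edge; other edges are ordinary. Around the root vertex, Region 1 (resp. Region 2) consists of the corners and edge-ends met rotating counterclockwise from the root edge to the secondary edge (resp. from the secondary edge to the root edge); around the non-root vertex, Region 3 (resp. Region 4) consists of those met rotating counterclockwise from the root edge to the secondary edge (resp. from the secondary edge to the root edge). An ordinary edge is an $a$-edge if its ends lie in Regions 2 and 3, a $b$-edge if in Regions 1 and 3, a $c$-edge if in Regions 2 and 4, a $d$-edge if in Regions 1 and 4; $\alpha(D),\beta(D),\gamma(D),\delta(D)$ count them. Each corner at the root vertex in Region 1 is labelled $\bullet$, each in Region 2 is labelled $\circ$. $R(D)$ is the word of labels of root-vertex corners met on a counterclockwise boundary walk of the root face starting at the root corner. For a word $S$, $(S)$ is the multiset of its $\ell(S)$ cyclic shifts (a cyclic binary string); each non-root face determines, via a counterclockwise boundary walk, a cyclic binary string, and $\Lambda(D)$ is the multiset of these. Indeterminates: $g_S$ for words $S$, $f_{(S)}$ for cyclic binary strings; $f_{\Lambda(D)}=\prod_{(S)\in\Lambda(D)}f_{(S)}$; also $x,y,v,w,u$.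 Define \[ \Gamma=\sum_{D\in\widehat{\mathcal D}}\frac{x^{\alpha(D)+1}}{(\alpha(D)+1)!}\frac{y^{\beta(D)}}{\beta(D)!}\frac{v^{\gamma(D)+\delta(D)}}{(\gamma(D)+\delta(D))!}w^{\delta(D)}u^{2g(D)}g_{R(D)}f_{\Lambda(D)}, \] \[ B=\sum_{D\in\widehat{\mathcal D},\ \gamma(D)=\delta(D)=0}\frac{x^{\alpha(D)+1}}{(\alpha(D)+1)!}\frac{y^{\beta(D)}}{\beta(D)!}u^{2g(D)}g_{R(D)}f_{\Lambda(D)}. \] -}

module Defs where

open import Data.Bool.Base using (Bool; true; false; if_then_else_; _∧_; _∨_; not)
open import Data.Nat.Base as ℕ using (ℕ; zero; suc; _∸_; _≡ᵇ_; _<ᵇ_; _!)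
open import Data.Nat.Properties using (_!≢0)
open import Data.List.Base
  using (List; []; _∷_; _++_; map; foldr; concatMap; length; upTo; take; drop; filterᵇ; [_])
open import Data.Maybe.Base using (Maybe; just; nothing; _>>=_)
open import Data.Product.Base using (_×_; _,_)
open import Data.Integer.Base using (+_)
open import Data.Rational.Base as ℚ using (ℚ; 0ℚ; _/_)
open import Data.List.Relation.Unary.All using (All)
open import Relation.Binary.PropositionalEquality using (_≡_)

data Lab : Set where
  ● ○ : Lab

Word : Set
Word = List Lab

_==L_ : Lab → Lab → Bool
● ==L ● = true
○ ==L ○ = true
_ ==L _ = false

δ● : Lab → ℕ
δ● ● = 1
δ● ○ = 0

_==W_ : Word → Word → Bool
[] ==W [] = true
(a ∷ as) ==W (b ∷ bs) = (a ==L b) ∧ (as ==W bs)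
_ ==W _ = false

_==Ws_ : List Word → List Word → Bool
[] ==Ws [] = true
(a ∷ as) ==Ws (b ∷ bs) = (a ==W b) ∧ (as ==Ws bs)
_ ==Ws _ = false

-- lexicographic order on words (● < ○); used only to fix canonical forms
leqW : Word → Word → Bool
leqW [] _ = true
leqW (_ ∷ _) [] = false
leqW (● ∷ as) (○ ∷ bs) = true
leqW (○ ∷ as) (● ∷ bs) = false
leqW (_ ∷ as) (_ ∷ bs) = leqW as bs

ins : Word → List Word → List Word
ins w [] = w ∷ []
ins w (v ∷ vs) = if leqW w v then w ∷ v ∷ vs else v ∷ ins w vs

sortW : List Word → List Word
sortW = foldr ins []

del : Word → List Word → Maybe (List Word)
del w [] = nothing
del w (v ∷ vs) = if w ==W v then just vs else (del w vs >>= λ r → just (v ∷ r))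

cnt : Word → List Word → ℕ
cnt w [] = 0
cnt w (v ∷ vs) = if w ==W v then suc (cnt w vs) else cnt w vs

rotations : Word → List Word
rotations w = map (λ k → drop k w ++ take k w) (upTo (length w))

-- canonical representative of the cyclic string (S): least cyclic shift
cyc : Word → Word
cyc w = foldr (λ v m → if leqW v m then v else m) w (rotations w)

wordsOfLen : ℕ → List Word
wordsOfLen zero = [] ∷ []
wordsOfLen (suc k) = concatMap (λ w → (● ∷ w) ∷ (○ ∷ w) ∷ []) (wordsOfLen k)

wordsUpTo : ℕ → List Word
wordsUpTo L = concatMap wordsOfLen (upTo (suc L))

neWordsUpTo : ℕ → List Word
neWordsUpTo L = concatMap (λ k → wordsOfLen (suc k)) (upTo L)

-- Monomials  x^ex y^ey v^ev w^ew u^eu ∏ g_R ∏ f_(S)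
-- gs : the multiset of g-indices (sorted list), fs : the multiset of
-- cyclic strings, each given by its canonical representative (sorted).

record Mono : Set where
  constructor mono
  field
    ex ey ev ew eu : ℕ
    gs fs : List Word
open Mono public

Canonical : Mono → Set
Canonical M = (sortW (gs M) ≡ gs M) × (sortW (fs M) ≡ fs M)
              × All (λ S → cyc S ≡ S) (fs M)

_==M_ : Mono → Mono → Bool
mono a b c d e g f ==M mono a' b' c' d' e' g' f' =
  (a ≡ᵇ a') ∧ (b ≡ᵇ b') ∧ (c ≡ᵇ c') ∧ (d ≡ᵇ d') ∧ (e ≡ᵇ e')
  ∧ (g ==Ws g') ∧ (f ==Ws f')

-- formal power series over ℚ: coefficient of each (canonical) monomial
Series : Set
Series = Mono → ℚ

sumℚ : List ℚ → ℚ
sumℚ = foldr ℚ._+_ 0ℚ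

ℕtoℚ : ℕ → ℚ
ℕtoℚ n = (+ n) / 1

inv! : ℕ → ℚ
inv! k = _/_ (+ 1) (k !) {{k !≢0}}

size : Mono → ℕ
size M = foldr (λ w n → length w ℕ.+ n) 0 (gs M ++ fs M)

addG : Word → Mono → Mono
addG R M = record M { gs = ins R (gs M) }

addF : Word → Mono → Mono
addF S M = record M { fs = ins (cyc S) (fs M) }

∂v : Series → Series
∂v F M = ℕtoℚ (suc (ev M)) ℚ.* F (record M { ev = suc (ev M) })

∂g : Word → Series → Series
∂g R F M = ℕtoℚ (suc (cnt R (gs M))) ℚ.* F (addG R M)

∂f : Word → Series → Series
∂f S F M = ℕtoℚ (suc (cnt (cyc S) (fs M))) ℚ.* F (addF S M)

atV0 : Series → Series
atV0 F M = if ev M ≡ᵇ 0 then F M else 0ℚ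

delFs : List Word → List Word → Maybe (List Word)
delFs [] fs = just fs
delFs (T ∷ Ts) fs = del (cyc T) fs >>= delFs Ts

divide : ℕ → ℕ → Word → List Word → Mono → Maybe Mono
divide j k Q Ts M =
  if (j ℕ.≤ᵇ ew M) ∧ (k ℕ.≤ᵇ eu M)
  then (del Q (gs M) >>= λ gs' → delFs Ts (fs M) >>= λ fs' →
        just (record M { ew = ew M ∸ j ; eu = eu M ∸ k ; gs = gs' ; fs = fs' }))
  else nothing

mulTerm : ℕ → ℕ → Word → List Word → Series → Series
mulTerm j k Q Ts H M with divide j k Q Ts M
... | just M' = H M'
... | nothing = 0ℚ

-- The operators C'' and u²J''.
-- The sums over R (nonempty words) and (S) (cyclic strings) are infinite,
-- but at a monomial M only terms with ℓ(R), ℓ(S) ≤ size M can contribute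
-- (the factor g_{...} f_{...} must divide M), so the coefficient of M is
-- the finite sum below.

Cterm : Word → Series → Series
Cterm [] H M = 0ℚ
Cterm (R₁ ∷ Rs) H M =
  -- the index i, 2 ≤ i ≤ ℓ(R), is i = t + 2 with t < ℓ(R) - 1
  sumℚ (map (λ t → Cpart (drop t Rs) (take (suc t) Rs))
         (upTo (length Rs)))
  ℚ.+ mulTerm 1 0 (R₁ ∷ []) (cyc (R₁ ∷ Rs) ∷ []) H M
  where
  -- Ri∷ = R_i ⋯ R_ℓ ,  mid = R₂ ⋯ R_i
  Cpart : Word → Word → ℚ
  Cpart [] mid = 0ℚ
  Cpart (Ri ∷ rest) mid = mulTerm (δ● Ri) 0 (R₁ ∷ Ri ∷ rest) (mid ∷ []) H M

C'' : Series → Series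
C'' F M = sumℚ (map (λ R → Cterm R (∂g R F) M) (neWordsUpTo (size M)))

cycStringsUpTo : ℕ → List Word
cycStringsUpTo L = filterᵇ (λ S → cyc S ==W S) (neWordsUpTo L)

Jterm : Word → Word → Series → Series
Jterm [] S H M = 0ℚ
Jterm (R₁ ∷ Rs) S H M = sumℚ (map shift (rotations S))
  where
  shift : Word → ℚ
  shift [] = 0ℚ
  shift (S₁ ∷ St) =
    mulTerm (δ● S₁) 2 (R₁ ∷ (S₁ ∷ St) ++ S₁ ∷ Rs) [] H M

u²J'' : Series → Series
u²J'' F M =
  sumℚ (map (λ R → sumℚ (map (λ S → Jterm R S (∂g R (∂f S F)) M)
                               (cycStringsUpTo (size M))))
            (neWordsUpTo (size M)))

-- Rooted dipoles with a secondary edge.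
-- Encoding: the n edges are numbered 0,…,n-1 in counterclockwise order
-- around the root vertex starting at the root edge 0.  The rotation at
-- the non-root vertex is the list rot (a permutation of 0,…,n-1 with
-- head 0) listing the edges counterclockwise starting at the root edge.
-- s ∈ {1,…,n-1} is the secondary edge.  This is a bijective encoding of
-- the isomorphism classes of elements of D̂ with n edges.

record Dip : Set where
  constructor dip
  field
    n : ℕ
    rot : List ℕ
    s : ℕ
open Dip public

insertAll : ℕ → List ℕ → List (List ℕ)
insertAll x [] = (x ∷ []) ∷ []
insertAll x (y ∷ ys) = (x ∷ y ∷ ys) ∷ map (y ∷_) (insertAll x ys)

perms : List ℕ → List (List ℕ)
perms [] = [] ∷ []
perms (x ∷ xs) = concatMap (insertAll x) (perms xs)

oneTo : ℕ → List ℕ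
oneTo n = map suc (upTo (n ∸ 1))

dipoles : ℕ → List Dip
dipoles n = concatMap (λ p → map (λ s → dip n (0 ∷ p) s) (oneTo n))
                      (perms (oneTo n))

nth : List ℕ → ℕ → ℕ
nth [] _ = 0
nth (x ∷ xs) zero = x
nth (x ∷ xs) (suc k) = nth xs k

indexOf : ℕ → List ℕ → ℕ
indexOf e [] = 0
indexOf e (x ∷ xs) = if e ≡ᵇ x then 0 else suc (indexOf e xs)

module _ (D : Dip) where
  pos : ℕ → ℕ
  pos e = indexOf e (rot D)

  predMod : ℕ → ℕ
  predMod k = if k ≡ᵇ 0 then n D ∸ 1 else k ∸ 1

  -- darts: d < n is the end of edge d at the root vertex,
  -- n + e is the end of edge e at the non-root vertex.
  -- The corner "of" dart d is the corner following d counterclockwise.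
  -- Counterclockwise face walk: φ = ρ⁻¹ ∘ α  (α: other end of the edge,
  -- ρ: counterclockwise successor around the vertex).
  φ : ℕ → ℕ
  φ d = if d <ᵇ n D
        then n D ℕ.+ nth (rot D) (predMod (pos d))
        else predMod (d ∸ n D)

  orbit : ℕ → List ℕ
  orbit d = d ∷ go (2 ℕ.* n D) (φ d)
    where
    go : ℕ → ℕ → List ℕ
    go zero _ = []
    go (suc k) e = if e ≡ᵇ d then [] else e ∷ go k (φ e)

  -- labels of root-vertex corners: Region 1 (●) are the corners following
  -- the edges 0,…,s-1, Region 2 (○) those following s,…,n-1
  labels : List ℕ → Word
  labels [] = []
  labels (d ∷ ds) =
    if d <ᵇ n D then (if d <ᵇ s D then ● else ○) ∷ labels ds else labels ds

  allDarts : List ℕ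
  allDarts = upTo (2 ℕ.* n D)

  isRep : ℕ → Bool
  isRep d = foldr (λ e b → (d ℕ.≤ᵇ e) ∧ b) true (orbit d)

  inList : ℕ → List ℕ → Bool
  inList d = foldr (λ e b → (d ≡ᵇ e) ∨ b) false

  m : ℕ
  m = length (filterᵇ isRep allDarts)

  -- the root corner is the corner of dart 0
  Rword : Word
  Rword = labels (orbit 0)

  Λ : List Word
  Λ = map (λ d → cyc (labels (orbit d)))
          (filterᵇ (λ d → isRep d ∧ not (inList 0 (orbit d))) allDarts)

  ordinary : List ℕ
  ordinary = filterᵇ (λ e → not (e ≡ᵇ s D)) (oneTo (n D))

  inR1 inR3 : ℕ → Bool
  inR1 e = e <ᵇ s D
  inR3 e = pos e <ᵇ pos (s D)

  countE : (ℕ → Bool) → ℕ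
  countE p = length (filterᵇ p ordinary)

  αD βD γD δD : ℕ
  αD = countE (λ e → not (inR1 e) ∧ inR3 e)
  βD = countE (λ e → inR1 e ∧ inR3 e)
  γD = countE (λ e → not (inR1 e) ∧ not (inR3 e))
  δD = countE (λ e → inR1 e ∧ not (inR3 e))

  -- the monomial x^{α+1} y^β v^{γ+δ} w^δ u^{2g} g_{R(D)} f_{Λ(D)}, 2g = n - m
  monoD : Mono
  monoD = mono (suc αD) βD (γD ℕ.+ δD) δD (n D ∸ m) (Rword ∷ []) (sortW Λ)

  coeffD : ℚ
  coeffD = inv! (suc αD) ℚ.* inv! βD ℚ.* inv! (γD ℕ.+ δD)

dipolesUpTo : ℕ → List Dip
dipolesUpTo N = concatMap dipoles (upTo (suc N))

-- coefficient of M in Γ: a dipole D with monomial M has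
-- n(D) = α+β+γ+δ+2 = ex M + ey M + ev M + 1 edges.
Γ : Series
Γ M = sumℚ (map (λ D → if monoD D ==M M then coeffD D else 0ℚ)
                (dipolesUpTo (ex M ℕ.+ ey M ℕ.+ ev M ℕ.+ 1)))

B : Series
B M = sumℚ (map (λ D → if (γD D ℕ.+ δD D ≡ᵇ 0) ∧ (monoD D ==M M)
                       then coeffD D else 0ℚ)
                (dipolesUpTo (ex M ℕ.+ ey M ℕ.+ ev M ℕ.+ 1)))

SolvesPDE : Series → Set
SolvesPDE F = ∀ M → Canonical M → ∂v F M ≡ C'' F M ℚ.+ u²J'' F M

InitialB : Series → Set
InitialB F = ∀ M → Canonical M → atV0 F M ≡ B M

{-# OPTIONS --safe #-}
module Submission where

-- A dipole with γ + δ ≥ 1 arises exactly once from a smaller dipole by attaching a new edge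
-- to the corner just before the root edge at the non-root vertex and to an arbitrary corner at
-- the root vertex: the last edge around the non-root vertex is then the new one, it lies in
-- Region 4, and it is a d-edge precisely when the chosen root-vertex corner is labelled ●.
-- The corner before the root edge at the non-root vertex lies on the root face.  Hence the new
-- edge splits the root face if the chosen corner is on it (this is C''), and otherwise joins the
-- root face to the face of the chosen corner, raising the genus by one (this is u²J'').
-- Differentiating v^(γ+δ)/(γ+δ)! matches the coefficients of the two dipoles.
-- Uniqueness: the operators keep the exponents of x, y and v, so the equation determines
-- the coefficients with v-exponent k + 1 from those with v-exponent k.

open import Defs
open import Data.Bool.Base using (Bool; true; false; if_then_else_; _∧_; not; T)
open import Data.Bool.Properties as Boolₚ using (T-≡; T?)
open import Data.Empty using (⊥; ⊥-elim)
open import Data.Integer.Base as ℤ using (+_)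
import Data.Integer.Properties as ℤₚ
open import Data.List.Base
  using (List; []; _∷_; _++_; _∷ʳ_; map; foldr; concat; concatMap; length; upTo; take; drop;
         filterᵇ; cartesianProductWith; initLast; _∷ʳ′_)
import Data.List.Properties as Listₚ
open import Data.List.Membership.Propositional using (_∈_; _∉_; find; lose)
open import Data.List.Membership.Propositional.Properties
  using (∈-map⁻; ∈-map⁺; ∈-upTo⁻; ∈-upTo⁺; ∈-++⁺ˡ; ∈-++⁺ʳ; ∈-++⁻; ∈-concat⁺′; ∈-concat⁻′; ∈-∃++;
         ∈-concatMap⁺; ∈-concatMap⁻; ∈-filter⁻; ∈-cartesianProductWith⁺; ∈-cartesianProductWith⁻)
open import Data.List.Relation.Binary.Permutation.Propositional as Perm
  using (_↭_; ↭-refl; ↭-sym; ↭-trans; ↭-reflexive)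
import Data.List.Relation.Binary.Permutation.Propositional.Properties as Permₚ
import Data.List.Relation.Binary.Permutation.Setoid.Properties as Permₛₚ
open import Data.List.Relation.Unary.All as All using (All; []; _∷_)
open import Data.List.Relation.Unary.AllPairs using ([]; _∷_)
open import Data.List.Relation.Unary.Any using (here; there)
open import Data.List.Relation.Unary.Unique.Propositional using (Unique)
import Data.List.Relation.Unary.Unique.Propositional.Properties as Uniqueₚ
open import Data.Maybe.Base using (just; nothing; maybe)
open import Data.Maybe.Properties using (just-injective)
open import Data.Nat.Base as ℕ
  using (ℕ; zero; suc; _∸_; _≡ᵇ_; _<ᵇ_; _≤ᵇ_; _!; _≤_; _<_; z≤n; s≤s)
import Data.Nat.Properties as ℕₚ
open import Data.List.Membership.DecPropositional ℕₚ._≟_ using (_∈?_)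
open import Data.Product.Base using (∃; ∃₂; _×_; _,_; proj₁; proj₂)
open import Data.Rational.Base as ℚ using (ℚ; 0ℚ; 1ℚ)
import Data.Rational.Properties as ℚₚ
open import Data.Rational.Unnormalised.Base as ℚᵘ using (mkℚᵘ; *≡*)
import Data.Rational.Unnormalised.Properties as ℚᵘₚ
open import Data.Sum.Base using (_⊎_; inj₁; inj₂)
open import Function.Base using (_∘_; id; _⟨_⟩_)
open import Function.Bundles using (Equivalence)
open import Relation.Nullary using (yes; no)
open import Relation.Binary.PropositionalEquality

⟦_⟧ : Bool → ℚ
⟦ b ⟧ = if b then 1ℚ else 0ℚ

cong₃ : ∀ {A B C D : Set} (f : A → B → C → D) {a a' b b' c c'} →
        a ≡ a' → b ≡ b' → c ≡ c' → f a b c ≡ f a' b' c'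
cong₃ f refl refl refl = refl

cong₄ : ∀ {A B C D E : Set} (f : A → B → C → D → E) {a a' b b' c c' d d'} →
        a ≡ a' → b ≡ b' → c ≡ c' → d ≡ d' → f a b c d ≡ f a' b' c' d'
cong₄ f refl refl refl refl = refl

bool-iff : ∀ {a b} → (a ≡ true → b ≡ true) → (b ≡ true → a ≡ true) → a ≡ b
bool-iff {false} {false} f g = refl
bool-iff {false} {true}  f g = g refl
bool-iff {true}  {false} f g = sym (f refl)
bool-iff {true}  {true}  f g = refl

⟦⟧-cong : ∀ {a b} → (a ≡ true → b ≡ true) → (b ≡ true → a ≡ true) → ⟦ a ⟧ ≡ ⟦ b ⟧
⟦⟧-cong f g = cong ⟦_⟧ (bool-iff f g)

if-* : ∀ b x → (if b then x else 0ℚ) ≡ ⟦ b ⟧ ℚ.* x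
if-* true  x = sym (ℚₚ.*-identityˡ x)
if-* false x = sym (ℚₚ.*-zeroˡ x)

ℕtoℚ-suc : ∀ n → ℕtoℚ (suc n) ≡ 1ℚ ℚ.+ ℕtoℚ n
ℕtoℚ-suc n = ℚₚ.toℚᵘ-injective (begin
  ℚ.toℚᵘ (ℕtoℚ (suc n))               ≈⟨ ℚₚ.toℚᵘ-fromℚᵘ (mkℚᵘ (+ suc n) 0) ⟩
  mkℚᵘ (+ suc n) 0                    ≈⟨ *≡* (cong (λ k → (+ 1 ℤ.+ k) ℤ.* + 1) (sym (ℤₚ.*-identityʳ (+ n)))) ⟩
  mkℚᵘ (+ 1) 0 ℚᵘ.+ mkℚᵘ (+ n) 0      ≈⟨ ℚᵘₚ.+-congʳ (mkℚᵘ (+ 1) 0) (ℚₚ.toℚᵘ-fromℚᵘ (mkℚᵘ (+ n) 0)) ⟨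
  ℚ.toℚᵘ 1ℚ ℚᵘ.+ ℚ.toℚᵘ (ℕtoℚ n)      ≈⟨ ℚₚ.toℚᵘ-homo-+ 1ℚ (ℕtoℚ n) ⟨
  ℚ.toℚᵘ (1ℚ ℚ.+ ℕtoℚ n)              ∎)
  where open ℚᵘₚ.≃-Reasoning

suc*recip-* : ∀ n k .{{_ : ℕ.NonZero k}} .{{_ : ℕ.NonZero (suc n ℕ.* k)}} →
              ℕtoℚ (suc n) ℚ.* (+ 1 ℚ./ (suc n ℕ.* k)) ≡ + 1 ℚ./ k
suc*recip-* n k@(suc k-1) = ℚₚ.toℚᵘ-injective (begin
  ℚ.toℚᵘ (ℕtoℚ (suc n) ℚ.* (+ 1 ℚ./ (suc n ℕ.* k)))
    ≈⟨ ℚₚ.toℚᵘ-homo-* (ℕtoℚ (suc n)) (+ 1 ℚ./ (suc n ℕ.* k)) ⟩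
  ℚ.toℚᵘ (ℕtoℚ (suc n)) ℚᵘ.* ℚ.toℚᵘ (+ 1 ℚ./ (suc n ℕ.* k))
    ≈⟨ ℚᵘₚ.*-cong (ℚₚ.toℚᵘ-fromℚᵘ (mkℚᵘ (+ suc n) 0)) (ℚₚ.toℚᵘ-fromℚᵘ (mkℚᵘ (+ 1) (k-1 ℕ.+ n ℕ.* k))) ⟩
  mkℚᵘ (+ suc n) 0 ℚᵘ.* mkℚᵘ (+ 1) (k-1 ℕ.+ n ℕ.* k)
    ≈⟨ *≡* (cong +_ lem) ⟩
  mkℚᵘ (+ 1) k-1
    ≈⟨ ℚₚ.toℚᵘ-fromℚᵘ (mkℚᵘ (+ 1) k-1) ⟨
  ℚ.toℚᵘ (+ 1 ℚ./ k) ∎)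
  where
  open ℚᵘₚ.≃-Reasoning
  lem : suc n ℕ.* 1 ℕ.* k ≡ 1 ℕ.* (1 ℕ.* (suc n ℕ.* k))
  lem = trans (cong (ℕ._* k) (ℕₚ.*-identityʳ (suc n)))
              (sym (trans (ℕₚ.*-identityˡ _) (ℕₚ.*-identityˡ (suc n ℕ.* k))))

suc*inv! : ∀ n → ℕtoℚ (suc n) ℚ.* inv! (suc n) ≡ inv! n
suc*inv! n = suc*recip-* n (n !) {{n ℕₚ.!≢0}} {{suc n ℕₚ.!≢0}}

ℕtoℚ-*-cancelˡ : ∀ n {p q} → ℕtoℚ (suc n) ℚ.* p ≡ ℕtoℚ (suc n) ℚ.* q → p ≡ q
ℕtoℚ-*-cancelˡ n {p} {q} eq = trans (sym (undo p)) (trans (cong (r ℚ.*_) eq) (undo q))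
  where
  r : ℚ
  r = + 1 ℚ./ (suc n ℕ.* 1)
  undo : ∀ p → r ℚ.* (ℕtoℚ (suc n) ℚ.* p) ≡ p
  undo p = trans (sym (ℚₚ.*-assoc r (ℕtoℚ (suc n)) p))
    (trans (cong (ℚ._* p) (trans (ℚₚ.*-comm r (ℕtoℚ (suc n))) (suc*recip-* n 1))) (ℚₚ.*-identityˡ p))

-- Finite sums

+-interchange : ∀ a b c d → (a ℚ.+ b) ℚ.+ (c ℚ.+ d) ≡ (a ℚ.+ c) ℚ.+ (b ℚ.+ d)
+-interchange a b c d = trans (ℚₚ.+-assoc a b _) (trans (cong (a ℚ.+_)
  (trans (sym (ℚₚ.+-assoc b c d)) (trans (cong (ℚ._+ d) (ℚₚ.+-comm b c)) (ℚₚ.+-assoc c b d))))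
  (sym (ℚₚ.+-assoc a c _)))

*-swap : ∀ a b c → a ℚ.* (b ℚ.* c) ≡ b ℚ.* (a ℚ.* c)
*-swap a b c = trans (sym (ℚₚ.*-assoc a b c)) (trans (cong (ℚ._* c) (ℚₚ.*-comm a b)) (ℚₚ.*-assoc b a c))

∑ : ∀ {A : Set} → List A → (A → ℚ) → ℚ
∑ xs f = sumℚ (map f xs)

module _ {A : Set} where
  ∑-cong∈ : ∀ (xs : List A) {f g} → (∀ x → x ∈ xs → f x ≡ g x) → ∑ xs f ≡ ∑ xs g
  ∑-cong∈ []       eq = refl
  ∑-cong∈ (x ∷ xs) eq = cong₂ ℚ._+_ (eq x (here refl)) (∑-cong∈ xs λ y → eq y ∘ there)

  ∑-cong : ∀ (xs : List A) {f g} → (∀ x → f x ≡ g x) → ∑ xs f ≡ ∑ xs g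
  ∑-cong xs eq = ∑-cong∈ xs λ x _ → eq x

  ∑-++ : ∀ (xs ys : List A) f → ∑ (xs ++ ys) f ≡ ∑ xs f ℚ.+ ∑ ys f
  ∑-++ []       ys f = sym (ℚₚ.+-identityˡ _)
  ∑-++ (x ∷ xs) ys f = trans (cong (f x ℚ.+_) (∑-++ xs ys f)) (sym (ℚₚ.+-assoc (f x) _ _))

  ∑-0 : ∀ (xs : List A) {f} → (∀ x → x ∈ xs → f x ≡ 0ℚ) → ∑ xs f ≡ 0ℚ
  ∑-0 []       eq = refl
  ∑-0 (x ∷ xs) eq = cong₂ ℚ._+_ (eq x (here refl)) (∑-0 xs λ y → eq y ∘ there)

  ∑-+ : ∀ (xs : List A) f g → ∑ xs (λ x → f x ℚ.+ g x) ≡ ∑ xs f ℚ.+ ∑ xs g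
  ∑-+ []       f g = refl
  ∑-+ (x ∷ xs) f g = trans (cong ((f x ℚ.+ g x) ℚ.+_) (∑-+ xs f g)) (+-interchange (f x) (g x) _ _)

  ∑-*ˡ : ∀ c (xs : List A) f → ∑ xs (λ x → c ℚ.* f x) ≡ c ℚ.* ∑ xs f
  ∑-*ˡ c []       f = sym (ℚₚ.*-zeroʳ c)
  ∑-*ˡ c (x ∷ xs) f = trans (cong (c ℚ.* f x ℚ.+_) (∑-*ˡ c xs f)) (sym (ℚₚ.*-distribˡ-+ c (f x) _))

  ∑-*ʳ : ∀ c (xs : List A) f → ∑ xs (λ x → f x ℚ.* c) ≡ ∑ xs f ℚ.* c
  ∑-*ʳ c xs f = trans (∑-cong xs λ x → ℚₚ.*-comm (f x) c) (trans (∑-*ˡ c xs f) (ℚₚ.*-comm c _))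

  ∑-↭ : ∀ {xs ys : List A} f → xs ↭ ys → ∑ xs f ≡ ∑ ys f
  ∑-↭ f Perm.refl = refl
  ∑-↭ f (Perm.prep x p) = cong (f x ℚ.+_) (∑-↭ f p)
  ∑-↭ f (Perm.swap {xs} {ys} x y p) =
    trans (sym (ℚₚ.+-assoc (f x) (f y) _))
      (trans (cong₂ ℚ._+_ (ℚₚ.+-comm (f x) (f y)) (∑-↭ f p)) (ℚₚ.+-assoc (f y) (f x) _))
  ∑-↭ f (Perm.trans p q) = trans (∑-↭ f p) (∑-↭ f q)

  ∑-filterᵇ : ∀ p (xs : List A) f → ∑ (filterᵇ p xs) f ≡ ∑ xs (λ x → if p x then f x else 0ℚ)
  ∑-filterᵇ p []       f = refl
  ∑-filterᵇ p (x ∷ xs) f with p x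
  ... | true  = cong (f x ℚ.+_) (∑-filterᵇ p xs f)
  ... | false = trans (∑-filterᵇ p xs f) (sym (ℚₚ.+-identityˡ _))

  ∑-map : ∀ {B : Set} (g : B → A) xs (f : A → ℚ) → ∑ (map g xs) f ≡ ∑ xs (f ∘ g)
  ∑-map g []       f = refl
  ∑-map g (x ∷ xs) f = cong (f (g x) ℚ.+_) (∑-map g xs f)

  ∑-concatMap : ∀ {B : Set} (g : B → List A) xs (f : A → ℚ) →
                ∑ (concatMap g xs) f ≡ ∑ xs (λ x → ∑ (g x) f)
  ∑-concatMap g []       f = refl
  ∑-concatMap g (x ∷ xs) f = trans (∑-++ (g x) (concatMap g xs) f) (cong (∑ (g x) f ℚ.+_) (∑-concatMap g xs f))

  ∑-concat : ∀ (xss : List (List A)) (f : A → ℚ) → ∑ (concat xss) f ≡ ∑ xss (λ xs → ∑ xs f)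
  ∑-concat []         f = refl
  ∑-concat (xs ∷ xss) f = trans (∑-++ xs (concat xss) f) (cong (∑ xs f ℚ.+_) (∑-concat xss f))

∑-swap : ∀ {A B : Set} (xs : List A) (ys : List B) (f : A → B → ℚ) →
         ∑ xs (λ x → ∑ ys (f x)) ≡ ∑ ys (λ y → ∑ xs (λ x → f x y))
∑-swap []       ys f = sym (∑-0 ys λ _ _ → refl)
∑-swap (x ∷ xs) ys f = trans (cong (∑ ys (f x) ℚ.+_) (∑-swap xs ys f)) (sym (∑-+ ys (f x) _))

true≢false : true ≢ false
true≢false ()

∧-true : ∀ {a b} → a ∧ b ≡ true → a ≡ true × b ≡ true
∧-true {true} {true} refl = refl , refl

∧-intro : ∀ {a b} → a ≡ true → b ≡ true → a ∧ b ≡ true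
∧-intro refl refl = refl

≡ᵇ-sound : ∀ m n → (m ≡ᵇ n) ≡ true → m ≡ n
≡ᵇ-sound m n eq = ℕₚ.≡ᵇ⇒≡ m n (Equivalence.from T-≡ eq)

≡ᵇ-complete : ∀ {m n} → m ≡ n → (m ≡ᵇ n) ≡ true
≡ᵇ-complete {m} {n} eq = Equivalence.to T-≡ (ℕₚ.≡⇒≡ᵇ m n eq)

==L-sound : ∀ a b → (a ==L b) ≡ true → a ≡ b
==L-sound ● ● _ = refl
==L-sound ○ ○ _ = refl

==L-refl : ∀ a → (a ==L a) ≡ true
==L-refl ● = refl
==L-refl ○ = refl

==W-sound : ∀ a b → (a ==W b) ≡ true → a ≡ b
==W-sound []       []       _  = refl
==W-sound (a ∷ as) (b ∷ bs) eq with ∧-true {a ==L b} eq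
... | p , q = cong₂ _∷_ (==L-sound a b p) (==W-sound as bs q)

==W-refl : ∀ a → (a ==W a) ≡ true
==W-refl []       = refl
==W-refl (a ∷ as) = ∧-intro (==L-refl a) (==W-refl as)

==Ws-sound : ∀ a b → (a ==Ws b) ≡ true → a ≡ b
==Ws-sound []       []       _  = refl
==Ws-sound (a ∷ as) (b ∷ bs) eq with ∧-true {a ==W b} eq
... | p , q = cong₂ _∷_ (==W-sound a b p) (==Ws-sound as bs q)

==Ws-refl : ∀ a → (a ==Ws a) ≡ true
==Ws-refl []       = refl
==Ws-refl (a ∷ as) = ∧-intro (==W-refl a) (==Ws-refl as)

==M-sound : ∀ d M → (d ==M M) ≡ true → d ≡ M
==M-sound (mono a b c d e g f) (mono a' b' c' d' e' g' f') eq
  with p₁ , eq ← ∧-true {a ≡ᵇ a'} eq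
  with p₂ , eq ← ∧-true {b ≡ᵇ b'} eq
  with p₃ , eq ← ∧-true {c ≡ᵇ c'} eq
  with p₄ , eq ← ∧-true {d ≡ᵇ d'} eq
  with p₅ , eq ← ∧-true {e ≡ᵇ e'} eq
  with p₆ , p₇ ← ∧-true {g ==Ws g'} eq
  with refl ← ≡ᵇ-sound a a' p₁ | refl ← ≡ᵇ-sound b b' p₂ | refl ← ≡ᵇ-sound c c' p₃
     | refl ← ≡ᵇ-sound d d' p₄ | refl ← ≡ᵇ-sound e e' p₅
     | refl ← ==Ws-sound g g' p₆ | refl ← ==Ws-sound f f' p₇ = refl

==M-refl : ∀ d → (d ==M d) ≡ true
==M-refl (mono a b c d e g f) =
  ∧-intro (≡ᵇ-complete {a} refl) (∧-intro (≡ᵇ-complete {b} refl) (∧-intro (≡ᵇ-complete {c} refl)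
    (∧-intro (≡ᵇ-complete {d} refl) (∧-intro (≡ᵇ-complete {e} refl) (∧-intro (==Ws-refl g) (==Ws-refl f))))))

-- Sorted lists of words

leqW-total : ∀ a b → leqW a b ≡ false → leqW b a ≡ true
leqW-total (x ∷ a) []      _  = refl
leqW-total (● ∷ a) (● ∷ b) eq = leqW-total a b eq
leqW-total (○ ∷ a) (● ∷ b) _  = refl
leqW-total (○ ∷ a) (○ ∷ b) eq = leqW-total a b eq

leqW-antisym : ∀ a b → leqW a b ≡ true → leqW b a ≡ true → a ≡ b
leqW-antisym []      []      _ _ = refl
leqW-antisym (● ∷ a) (● ∷ b) p q = cong (● ∷_) (leqW-antisym a b p q)
leqW-antisym (● ∷ a) (○ ∷ b) p ()
leqW-antisym (○ ∷ a) (○ ∷ b) p q = cong (○ ∷_) (leqW-antisym a b p q)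

leqW-trans : ∀ a b c → leqW a b ≡ true → leqW b c ≡ true → leqW a c ≡ true
leqW-trans []      b       c       _ _ = refl
leqW-trans (● ∷ a) (● ∷ b) (● ∷ c) p q = leqW-trans a b c p q
leqW-trans (● ∷ a) (● ∷ b) (○ ∷ c) p q = refl
leqW-trans (● ∷ a) (○ ∷ b) (○ ∷ c) p q = refl
leqW-trans (○ ∷ a) (○ ∷ b) (○ ∷ c) p q = leqW-trans a b c p q

leqW-refl : ∀ a → leqW a a ≡ true
leqW-refl []      = refl
leqW-refl (● ∷ a) = leqW-refl a
leqW-refl (○ ∷ a) = leqW-refl a

ins-comm-≤ : ∀ a b l → leqW a b ≡ true → ins a (ins b l) ≡ ins b (ins a l)
ins-comm-≤ a b l ab with leqW b a in ba
... | true with refl ← leqW-antisym a b ab ba = refl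
ins-comm-≤ a b [] ab | false rewrite ab | ba = refl
ins-comm-≤ a b (v ∷ l) ab | false with leqW a v in av | leqW b v in bv
... | true  | true  rewrite ab | ba | bv = refl
... | true  | false rewrite av | ba | bv = refl
... | false | true  = ⊥-elim (true≢false (trans (sym (leqW-trans a b v ab bv)) av))
... | false | false rewrite av | bv = cong (v ∷_) (ins-comm-≤ a b l ab)

ins-comm : ∀ a b l → ins a (ins b l) ≡ ins b (ins a l)
ins-comm a b l with leqW a b in ab
... | true  = ins-comm-≤ a b l ab
... | false = sym (ins-comm-≤ b a l (leqW-total a b ab))

sortW-resp-↭ : ∀ {xs ys} → xs ↭ ys → sortW xs ≡ sortW ys
sortW-resp-↭ Perm.refl          = refl
sortW-resp-↭ (Perm.prep x p)    = cong (ins x) (sortW-resp-↭ p)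
sortW-resp-↭ (Perm.swap {xs} x y p) = trans (ins-comm x y (sortW xs)) (cong (ins y ∘ ins x) (sortW-resp-↭ p))
sortW-resp-↭ (Perm.trans p q)   = trans (sortW-resp-↭ p) (sortW-resp-↭ q)

ins-↭ : ∀ w l → ins w l ↭ w ∷ l
ins-↭ w []      = ↭-refl
ins-↭ w (v ∷ l) with leqW w v
... | true  = ↭-refl
... | false = ↭-trans (Perm.prep v (ins-↭ w l)) (Perm.swap v w ↭-refl)

sortW-↭ : ∀ l → sortW l ↭ l
sortW-↭ []      = ↭-refl
sortW-↭ (w ∷ l) = ↭-trans (ins-↭ w (sortW l)) (Perm.prep w (sortW-↭ l))

sortW-idem : ∀ l → sortW (sortW l) ≡ sortW l
sortW-idem l = sortW-resp-↭ (sortW-↭ l)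

ins-sorted : ∀ w {l} → sortW l ≡ l → sortW (ins w l) ≡ ins w l
ins-sorted w {l} eq = trans (sortW-resp-↭ (ins-↭ w l)) (cong (ins w) eq)

ins-singleton⁻ : ∀ {w l r} → r ∷ [] ≡ ins w l → w ≡ r × l ≡ []
ins-singleton⁻ {w} {l} {r} eq
  with l in eq' | Permₚ.↭-singleton-inv (↭-trans (↭-sym (ins-↭ w l)) (↭-reflexive (sym eq)))
... | [] | refl = refl , refl

del-ins : ∀ w l → del w (ins w l) ≡ just l
del-ins w [] rewrite ==W-refl w = refl
del-ins w (v ∷ l) with leqW w v in wv
... | true rewrite ==W-refl w = refl
... | false with w ==W v in eq
...   | true with refl ← ==W-sound w v eq = ⊥-elim (true≢false (trans (sym (leqW-refl w)) wv))
...   | false rewrite del-ins w l = refl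

del-↭ : ∀ w l {l'} → del w l ≡ just l' → l ↭ w ∷ l'
del-↭ w (v ∷ l) eq with w ==W v in wv
del-↭ w (v ∷ l) refl | true with refl ← ==W-sound w v wv = ↭-refl
... | false with del w l in dl
del-↭ w (v ∷ l) refl | false | just r = ↭-trans (Perm.prep v (del-↭ w l dl)) (Perm.swap v w ↭-refl)

ins-injective : ∀ w {l l'} → ins w l ≡ ins w l' → l ≡ l'
ins-injective w {l} {l'} eq = just-injective (trans (sym (del-ins w l)) (trans (cong (del w) eq) (del-ins w l')))

del-sorted : ∀ w {l l'} → sortW l ≡ l → del w l ≡ just l' → sortW l' ≡ l' × ins w l' ≡ l
del-sorted w {l} {l'} s eq = s' , trans (cong (ins w) (sym s')) e
  where
  e : ins w (sortW l') ≡ l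
  e = trans (sym (sortW-resp-↭ (del-↭ w l eq))) s
  s' : sortW l' ≡ l'
  s' = just-injective (trans (sym (del-ins w (sortW l'))) (trans (cong (del w) e) eq))

-- Cyclic shifts

rots : ∀ {A : Set} → List A → List (List A)
rots w = map (λ k → drop k w ++ take k w) (upTo (length w))

module _ {A : Set} where

  rots-∷ : ∀ (x : A) l → rots (x ∷ l) ≡
           (x ∷ l) ∷ map (λ k → drop k l ++ x ∷ take k l) (upTo (length l))
  rots-∷ x l = cong₂ _∷_ (Listₚ.++-identityʳ (x ∷ l))
    (trans (cong (map _) (sym (Listₚ.map-upTo suc (length l)))) (sym (Listₚ.map-∘ (upTo (length l)))))

  drop-take-∷ʳ : ∀ (x : A) l k → k ≤ length l →
                 drop k (l ∷ʳ x) ++ take k (l ∷ʳ x) ≡ drop k l ++ x ∷ take k l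
  drop-take-∷ʳ x l k k≤ = trans (cong₂ _++_ (d l k k≤) (t l k k≤)) (Listₚ.++-assoc (drop k l) _ _)
    where
    d : ∀ l k → k ≤ length l → drop k (l ∷ʳ x) ≡ drop k l ∷ʳ x
    d l       zero    _       = refl
    d (y ∷ l) (suc k) (s≤s p) = d l k p
    t : ∀ l k → k ≤ length l → take k (l ∷ʳ x) ≡ take k l
    t l       zero    _       = refl
    t (y ∷ l) (suc k) (s≤s p) = cong (y ∷_) (t l k p)

  rots-∷ʳ : ∀ (x : A) l → rots (l ∷ʳ x) ≡
            map (λ k → drop k l ++ x ∷ take k l) (upTo (length l)) ∷ʳ (x ∷ l)
  rots-∷ʳ x l = begin
    map (λ k → drop k (l ∷ʳ x) ++ take k (l ∷ʳ x)) (upTo (length (l ∷ʳ x)))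
      ≡⟨ cong (λ n → map (λ k → drop k (l ∷ʳ x) ++ take k (l ∷ʳ x)) (upTo n)) (trans (Listₚ.length-++ l) (ℕₚ.+-comm (length l) 1)) ⟩
    map (λ k → drop k (l ∷ʳ x) ++ take k (l ∷ʳ x)) (upTo (suc (length l)))
      ≡⟨ Listₚ.map-cong-local (All.tabulate λ {k} k∈ → drop-take-∷ʳ x l k (ℕₚ.≤-pred (∈-upTo⁻ k∈))) ⟩
    map f (upTo (suc (length l)))
      ≡⟨ cong (map f) (Listₚ.upTo-∷ʳ (length l)) ⟨
    map f (upTo (length l) ∷ʳ length l)
      ≡⟨ Listₚ.map-++ f (upTo (length l)) _ ⟩
    map f (upTo (length l)) ∷ʳ f (length l)
      ≡⟨ cong (map f (upTo (length l)) ∷ʳ_) (cong₂ (λ u v → u ++ x ∷ v)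
           (Listₚ.drop-all (length l) l ℕₚ.≤-refl) (Listₚ.take-all (length l) l ℕₚ.≤-refl)) ⟩
    map f (upTo (length l)) ∷ʳ (x ∷ l) ∎
    where
    open ≡-Reasoning
    f : ℕ → List A
    f k = drop k l ++ x ∷ take k l

  rots-++-comm : ∀ (a b : List A) → rots (a ++ b) ↭ rots (b ++ a)
  rots-++-comm []      b = ↭-reflexive (cong rots (sym (Listₚ.++-identityʳ b)))
  rots-++-comm (x ∷ a) b = begin
    rots (x ∷ a ++ b)       ≡⟨ rots-∷ x (a ++ b) ⟩
    _                       ↭⟨ Permₚ.∷↭∷ʳ (x ∷ a ++ b) _ ⟩
    _                       ≡⟨ rots-∷ʳ x (a ++ b) ⟨
    rots ((a ++ b) ∷ʳ x)    ≡⟨ cong rots (Listₚ.++-assoc a b _) ⟩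
    rots (a ++ (b ∷ʳ x))    ↭⟨ rots-++-comm a (b ∷ʳ x) ⟩
    rots ((b ∷ʳ x) ++ a)    ≡⟨ cong rots (Listₚ.++-assoc b _ a) ⟩
    rots (b ++ x ∷ a)       ∎
    where open Perm.PermutationReasoning

  ∈-rots⁻ : ∀ {l l' : List A} → l' ∈ rots l → ∃₂ λ a b → l ≡ a ++ b × l' ≡ b ++ a
  ∈-rots⁻ {l} l'∈ with k , _ , eq ← ∈-map⁻ _ l'∈ = take k l , drop k l , sym (Listₚ.take++drop≡id k l) , eq

  ∈-rots-self : ∀ (x : A) l → x ∷ l ∈ rots (x ∷ l)
  ∈-rots-self x l = subst (x ∷ l ∈_) (sym (rots-∷ x l)) (here refl)

map-rots : ∀ {A B : Set} (f : A → B) l → rots (map f l) ≡ map (map f) (rots l)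
map-rots f l = trans (cong (λ n → map (λ k → drop k (map f l) ++ take k (map f l)) (upTo n)) (Listₚ.length-map f l))
  (trans (Listₚ.map-cong (λ k → trans (cong₂ _++_ (Listₚ.drop-map k l) (Listₚ.take-map k l)) (sym (Listₚ.map-++ f (drop k l) _)))
                         (upTo (length l)))
         (Listₚ.map-∘ (upTo (length l))))

minW : Word → Word → Word
minW v m = if leqW v m then v else m

foldr-minW-∈ : ∀ e l → foldr minW e l ∈ e ∷ l
foldr-minW-∈ e []      = here refl
foldr-minW-∈ e (v ∷ l) with leqW v (foldr minW e l) | foldr-minW-∈ e l
... | true  | _       = there (here refl)
... | false | here p  = here p
... | false | there p = there (there p)

foldr-minW-≤ : ∀ e l {v} → v ∈ e ∷ l → leqW (foldr minW e l) v ≡ true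
foldr-minW-≤ e []      (here refl) = leqW-refl e
foldr-minW-≤ e (u ∷ l) {v} v∈ with leqW u (foldr minW e l) in eq
foldr-minW-≤ e (u ∷ l) (here refl)         | true = leqW-trans u _ _ eq (foldr-minW-≤ e l (here refl))
foldr-minW-≤ e (u ∷ l) (there (here refl)) | true = leqW-refl u
foldr-minW-≤ e (u ∷ l) (there (there v∈))  | true = leqW-trans u _ _ eq (foldr-minW-≤ e l (there v∈))
foldr-minW-≤ e (u ∷ l) (here refl)         | false = foldr-minW-≤ e l (here refl)
foldr-minW-≤ e (u ∷ l) (there (here refl)) | false = leqW-total u _ eq
foldr-minW-≤ e (u ∷ l) (there (there v∈))  | false = foldr-minW-≤ e l (there v∈)

cyc∈rotations : ∀ x w → cyc (x ∷ w) ∈ rotations (x ∷ w)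
cyc∈rotations x w with foldr-minW-∈ (x ∷ w) (rotations (x ∷ w))
... | here eq  = subst (_∈ rotations (x ∷ w)) (sym eq) (∈-rots-self x w)
... | there p  = p

cyc-rots : ∀ x w y w' → rotations (x ∷ w) ↭ rotations (y ∷ w') → cyc (x ∷ w) ≡ cyc (y ∷ w')
cyc-rots x w y w' p = leqW-antisym _ _
  (foldr-minW-≤ (x ∷ w) _ (there (Permₚ.∈-resp-↭ (↭-sym p) (cyc∈rotations y w'))))
  (foldr-minW-≤ (y ∷ w') _ (there (Permₚ.∈-resp-↭ p (cyc∈rotations x w))))

cyc-++-comm : ∀ a b → cyc (a ++ b) ≡ cyc (b ++ a)
cyc-++-comm []      b       = cong cyc (sym (Listₚ.++-identityʳ b))
cyc-++-comm (x ∷ a) []      = cong cyc (Listₚ.++-identityʳ (x ∷ a))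
cyc-++-comm (x ∷ a) (y ∷ b) = cyc-rots x (a ++ y ∷ b) y (b ++ x ∷ a) (rots-++-comm (x ∷ a) (y ∷ b))

cyc-split : ∀ w → ∃₂ λ a b → w ≡ a ++ b × cyc w ≡ b ++ a
cyc-split []      = [] , [] , refl , refl
cyc-split (x ∷ w) = ∈-rots⁻ (cyc∈rotations x w)

cyc-idem : ∀ w → cyc (cyc w) ≡ cyc w
cyc-idem w with a , b , refl , eq ← cyc-split w = trans (cong cyc eq) (cyc-++-comm b a)

rotations-cyc : ∀ w → rotations (cyc w) ↭ rotations w
rotations-cyc w with a , b , refl , eq ← cyc-split w = ↭-trans (↭-reflexive (cong rotations eq)) (rots-++-comm b a)

cyc-length : ∀ w → length (cyc w) ≡ length w
cyc-length w with a , b , refl , eq ← cyc-split w =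
  trans (cong length eq) (Permₚ.↭-length (Permₚ.++-comm b a))

-- Sums over all words

∑-upTo-suc : ∀ n (f : ℕ → ℚ) → ∑ (upTo (suc n)) f ≡ f 0 ℚ.+ ∑ (upTo n) (f ∘ suc)
∑-upTo-suc n f = cong (f 0 ℚ.+_) (trans (cong (λ l → ∑ l f) (sym (Listₚ.map-upTo suc n))) (∑-map suc (upTo n) f))

∑-upTo-≡ᵇ : ∀ n j c → ∑ (upTo n) (λ k → ⟦ j ≡ᵇ k ⟧ ℚ.* c) ≡ ⟦ j <ᵇ n ⟧ ℚ.* c
∑-upTo-≡ᵇ zero    j       c = sym (ℚₚ.*-zeroˡ c)
∑-upTo-≡ᵇ (suc n) zero    c = trans (∑-upTo-suc n (λ k → ⟦ 0 ≡ᵇ k ⟧ ℚ.* c))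
  (trans (cong (1ℚ ℚ.* c ℚ.+_) (∑-0 (upTo n) λ k _ → ℚₚ.*-zeroˡ c)) (ℚₚ.+-identityʳ _))
∑-upTo-≡ᵇ (suc n) (suc j) c = trans (∑-upTo-suc n (λ k → ⟦ suc j ≡ᵇ k ⟧ ℚ.* c))
  (trans (cong₂ ℚ._+_ (ℚₚ.*-zeroˡ c) (∑-upTo-≡ᵇ n j c)) (ℚₚ.+-identityˡ _))

∑-wordsOfLen : ∀ k v (f : Word → ℚ) →
               ∑ (wordsOfLen k) (λ w → ⟦ w ==W v ⟧ ℚ.* f w) ≡ ⟦ length v ≡ᵇ k ⟧ ℚ.* f v
∑-wordsOfLen zero [] f = ℚₚ.+-identityʳ _
∑-wordsOfLen zero (x ∷ v) f = trans (ℚₚ.+-identityʳ _) (trans (ℚₚ.*-zeroˡ (f [])) (sym (ℚₚ.*-zeroˡ (f (x ∷ v)))))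
∑-wordsOfLen (suc k) v f = trans (∑-concatMap _ (wordsOfLen k) _)
  (trans (∑-cong (wordsOfLen k) λ w → cong (⟦ (● ∷ w) ==W v ⟧ ℚ.* f (● ∷ w) ℚ.+_) (ℚₚ.+-identityʳ _)) (go v))
  where
  go : ∀ v → ∑ (wordsOfLen k) (λ w → ⟦ (● ∷ w) ==W v ⟧ ℚ.* f (● ∷ w) ℚ.+ ⟦ (○ ∷ w) ==W v ⟧ ℚ.* f (○ ∷ w))
             ≡ ⟦ length v ≡ᵇ suc k ⟧ ℚ.* f v
  go [] = trans (∑-0 (wordsOfLen k) λ w _ → cong₂ ℚ._+_ (ℚₚ.*-zeroˡ (f (● ∷ w))) (ℚₚ.*-zeroˡ (f (○ ∷ w))))
                (sym (ℚₚ.*-zeroˡ (f [])))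
  go (● ∷ v) = trans (∑-cong (wordsOfLen k) λ w →
      trans (cong (⟦ w ==W v ⟧ ℚ.* f (● ∷ w) ℚ.+_) (ℚₚ.*-zeroˡ (f (○ ∷ w)))) (ℚₚ.+-identityʳ _))
    (∑-wordsOfLen k v (f ∘ (● ∷_)))
  go (○ ∷ v) = trans (∑-cong (wordsOfLen k) λ w →
      trans (cong (ℚ._+ ⟦ w ==W v ⟧ ℚ.* f (○ ∷ w)) (ℚₚ.*-zeroˡ (f (● ∷ w)))) (ℚₚ.+-identityˡ _))
    (∑-wordsOfLen k v (f ∘ (○ ∷_)))

∑-neWordsUpTo : ∀ L x v (f : Word → ℚ) → (L < length (x ∷ v) → f (x ∷ v) ≡ 0ℚ) →
                ∑ (neWordsUpTo L) (λ w → ⟦ w ==W (x ∷ v) ⟧ ℚ.* f w) ≡ f (x ∷ v)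
∑-neWordsUpTo L x v f f≡0 = trans (∑-concatMap (wordsOfLen ∘ suc) (upTo L) _)
  (trans (∑-cong (upTo L) λ k → ∑-wordsOfLen (suc k) (x ∷ v) f)
  (trans (∑-upTo-≡ᵇ L (length v) (f (x ∷ v))) fin))
  where
  fin : ⟦ length v <ᵇ L ⟧ ℚ.* f (x ∷ v) ≡ f (x ∷ v)
  fin with length v <ᵇ L in eq
  ... | true  = ℚₚ.*-identityˡ _
  ... | false = trans (ℚₚ.*-zeroˡ (f (x ∷ v))) (sym (f≡0 (s≤s (ℕₚ.≮⇒≥ λ lt →
                  subst T eq (ℕₚ.<⇒<ᵇ lt)))))

cnt-∑ : ∀ w l → ℕtoℚ (cnt w l) ≡ ∑ l (λ v → ⟦ w ==W v ⟧)
cnt-∑ w []      = refl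
cnt-∑ w (v ∷ l) with w ==W v
... | true  = trans (ℕtoℚ-suc (cnt w l)) (cong (1ℚ ℚ.+_) (cnt-∑ w l))
... | false = trans (cnt-∑ w l) (sym (ℚₚ.+-identityˡ _))

-- Linear functionals on series

Slice : ℕ → ℕ → ℕ → Mono → Set
Slice a b c M = Canonical M × ex M ≡ a × ey M ≡ b × ev M ≡ c

canonical-addG : ∀ R {M} → Canonical M → Canonical (addG R M)
canonical-addG R (g , f , a) = ins-sorted R g , f , a

canonical-addF : ∀ S {M} → Canonical M → Canonical (addF S M)
canonical-addF S {M} (g , f , a) =
  g , ins-sorted (cyc S) f , Permₚ.All-resp-↭ (↭-sym (ins-↭ (cyc S) (fs M))) (cyc-idem S ∷ a)

insFs : List Word → List Word → List Word
insFs []       fs = fs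
insFs (T ∷ Ts) fs = ins (cyc T) (insFs Ts fs)

times : ℕ → ℕ → Word → List Word → Mono → Mono
times j k Q Ts M = record M
  { ew = ew M ℕ.+ j ; eu = eu M ℕ.+ k ; gs = ins Q (gs M) ; fs = insFs Ts (fs M) }

delFs-sound : ∀ Ts {l l'} → sortW l ≡ l → delFs Ts l ≡ just l' →
              sortW l' ≡ l' × insFs Ts l' ≡ l × (∀ {P : Word → Set} → All P l → All P l')
delFs-sound []       s refl = s , refl , λ a → a
delFs-sound (T ∷ Ts) {l} s eq with del (cyc T) l in d
... | just l₁ with del-sorted (cyc T) s d
...   | s₁ , e₁ with delFs-sound Ts s₁ eq
...     | s₂ , e₂ , a₂ = s₂ , trans (cong (ins (cyc T)) e₂) e₁ ,
          λ a → a₂ (All.tail (Permₚ.All-resp-↭ (del-↭ (cyc T) l d) a))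

delFs-insFs : ∀ Ts l → delFs Ts (insFs Ts l) ≡ just l
delFs-insFs []       l = refl
delFs-insFs (T ∷ Ts) l rewrite del-ins (cyc T) (insFs Ts l) = delFs-insFs Ts l

divide-sound : ∀ j k Q Ts M {M'} → Canonical M → divide j k Q Ts M ≡ just M' →
               Canonical M' × times j k Q Ts M' ≡ M
divide-sound j k Q Ts M (g , f , a) eq with j ≤ᵇ ew M in p | k ≤ᵇ eu M in q
... | true | true with del Q (gs M) in dg
...   | just gs' with delFs Ts (fs M) in df
divide-sound j k Q Ts M (g , f , a) refl | true | true | just gs' | just fs'
  with s , e ← del-sorted Q g dg | s' , e' , a' ← delFs-sound Ts f df
  = (s , s' , a' a)
  , cong₄ (λ w u g f → mono (ex M) (ey M) (ev M) w u g f)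
      (ℕₚ.m∸n+n≡m (ℕₚ.≤ᵇ⇒≤ j _ (Equivalence.from T-≡ p)))
      (ℕₚ.m∸n+n≡m (ℕₚ.≤ᵇ⇒≤ k _ (Equivalence.from T-≡ q))) e e'

divide-times : ∀ j k Q Ts M → divide j k Q Ts (times j k Q Ts M) ≡ just M
divide-times j k Q Ts M
  rewrite Equivalence.to T-≡ (ℕₚ.≤⇒≤ᵇ (ℕₚ.m≤n+m j (ew M)))
        | Equivalence.to T-≡ (ℕₚ.≤⇒≤ᵇ (ℕₚ.m≤n+m k (eu M)))
        | del-ins Q (gs M) | delFs-insFs Ts (fs M)
        | ℕₚ.m+n∸n≡m (ew M) j | ℕₚ.m+n∸n≡m (eu M) k = refl

slice-divide : ∀ {a b c} j k Q Ts M {M'} → Slice a b c M → divide j k Q Ts M ≡ just M' → Slice a b c M'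
slice-divide j k Q Ts M (can , p , q , r) eq
  with can' , refl ← divide-sound j k Q Ts M can eq = can' , p , q , r

record Linear (P : Mono → Set) (L : Series → ℚ) : Set where
  field
    local : ∀ {F G} → (∀ M → P M → F M ≡ G M) → L F ≡ L G
    add   : ∀ F G → L (λ M → F M ℚ.+ G M) ≡ L F ℚ.+ L G
    scale : ∀ c F → L (λ M → c ℚ.* F M) ≡ c ℚ.* L F
open Linear

module _ {P : Mono → Set} where

  linear-eval : ∀ {M} → P M → Linear P (λ F → F M)
  linear-eval p .local eq  = eq _ p
  linear-eval p .add F G   = refl
  linear-eval p .scale c F = refl

  linear-0 : Linear P (λ _ → 0ℚ)
  linear-0 .local eq  = refl
  linear-0 .add F G   = refl
  linear-0 .scale c F = sym (ℚₚ.*-zeroʳ c)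

  linear-+ : ∀ {L L'} → Linear P L → Linear P L' → Linear P (λ F → L F ℚ.+ L' F)
  linear-+ l l' .local eq  = cong₂ ℚ._+_ (local l eq) (local l' eq)
  linear-+ {L} {L'} l l' .add F G = trans (cong₂ ℚ._+_ (add l F G) (add l' F G))
    (+-interchange (L F) (L G) (L' F) (L' G))
  linear-+ {L} {L'} l l' .scale c F = trans (cong₂ ℚ._+_ (scale l c F) (scale l' c F))
    (sym (ℚₚ.*-distribˡ-+ c (L F) (L' F)))

  linear-∑ : ∀ {A : Set} (xs : List A) (L : A → Series → ℚ) → (∀ x → Linear P (L x)) →
             Linear P (λ F → ∑ xs (λ x → L x F))
  linear-∑ []       L l = linear-0
  linear-∑ (x ∷ xs) L l = linear-+ (l x) (linear-∑ xs L l)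

  linear-comb : ∀ {L} → Linear P L → ∀ {A : Set} (xs : List A) (c : A → ℚ) (F : A → Series) →
                L (λ M → ∑ xs (λ x → c x ℚ.* F x M)) ≡ ∑ xs (λ x → c x ℚ.* L (F x))
  linear-comb {L} l [] c F = trans (local l {G = λ M → 0ℚ ℚ.* 0ℚ} λ _ _ → refl)
    (trans (scale l 0ℚ (λ _ → 0ℚ)) (ℚₚ.*-zeroˡ (L (λ _ → 0ℚ))))
  linear-comb l (x ∷ xs) c F = trans (add l _ _) (cong₂ ℚ._+_ (scale l (c x) (F x)) (linear-comb l xs c F))

mulTerm-maybe : ∀ j k Q Ts H M → mulTerm j k Q Ts H M ≡ maybe H 0ℚ (divide j k Q Ts M)
mulTerm-maybe j k Q Ts H M with divide j k Q Ts M
... | just _  = refl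
... | nothing = refl

Cpart : Lab → Word → Word → Series → Series
Cpart R₁ []          mid H M = 0ℚ
Cpart R₁ (Ri ∷ rest) mid H M = mulTerm (δ● Ri) 0 (R₁ ∷ Ri ∷ rest) (mid ∷ []) H M

-- The signature's hole stands for a where-bound function of Defs, which has no name here;
-- the use of Cpart-≡ in Cterm-≡ determines it.
Cpart-≡ : ∀ R₁ Rs H M t → _ ≡ Cpart R₁ (drop t Rs) (take (suc t) Rs) H M

Cterm-≡ : ∀ R₁ Rs H M → Cterm (R₁ ∷ Rs) H M ≡
          ∑ (upTo (length Rs)) (λ t → Cpart R₁ (drop t Rs) (take (suc t) Rs) H M)
          ℚ.+ mulTerm 1 0 (R₁ ∷ []) (cyc (R₁ ∷ Rs) ∷ []) H M
Cterm-≡ R₁ Rs H M =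
  cong (λ l → sumℚ l ℚ.+ mulTerm 1 0 (R₁ ∷ []) (cyc (R₁ ∷ Rs) ∷ []) H M)
       (Listₚ.map-cong (Cpart-≡ R₁ Rs H M) (upTo (length Rs)))

Cpart-≡ R₁ Rs H M t with drop t Rs | take (suc t) Rs
... | []     | b = refl
... | _ ∷ _  | b = refl

Jpart : Lab → Word → Word → Series → Series
Jpart R₁ Rs []        H M = 0ℚ
Jpart R₁ Rs (S₁ ∷ St) H M = mulTerm (δ● S₁) 2 (R₁ ∷ (S₁ ∷ St) ++ S₁ ∷ Rs) [] H M

Jterm-≡ : ∀ R₁ Rs S H M → Jterm (R₁ ∷ Rs) S H M ≡ ∑ (rotations S) (λ S' → Jpart R₁ Rs S' H M)
Jterm-≡ R₁ Rs S H M = cong sumℚ (Listₚ.map-cong (λ { [] → refl ; (_ ∷ _) → refl }) (rotations S))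

module _ {a b c : ℕ} {M : Mono} (slice : Slice a b c M) where

  linear-mulTerm : ∀ j k Q Ts → Linear (Slice a b c) (λ F → mulTerm j k Q Ts F M)
  linear-mulTerm j k Q Ts with divide j k Q Ts M in eq
  ... | just M' = linear-eval (slice-divide j k Q Ts M slice eq)
  ... | nothing = linear-0

  linear-Cpart : ∀ R₁ w mid → Linear (Slice a b c) (λ F → Cpart R₁ w mid F M)
  linear-Cpart R₁ []      mid = linear-0
  linear-Cpart R₁ (x ∷ w) mid = linear-mulTerm (δ● x) 0 (R₁ ∷ x ∷ w) (mid ∷ [])

  linear-Jpart : ∀ R₁ Rs S → Linear (Slice a b c) (λ F → Jpart R₁ Rs S F M)
  linear-Jpart R₁ Rs []      = linear-0
  linear-Jpart R₁ Rs (x ∷ S) = linear-mulTerm (δ● x) 2 (R₁ ∷ (x ∷ S) ++ x ∷ Rs) []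

linear-≡ : ∀ {P} {L L' : Series → ℚ} → (∀ F → L F ≡ L' F) → Linear P L' → Linear P L
linear-≡ e l .local eq  = trans (e _) (trans (local l eq) (sym (e _)))
linear-≡ e l .add F G   = trans (e _) (trans (add l F G) (sym (cong₂ ℚ._+_ (e F) (e G))))
linear-≡ e l .scale c F = trans (e _) (trans (scale l c F) (sym (cong (c ℚ.*_) (e F))))

module _ {a b c : ℕ} where

  linear-∂g : ∀ {L} R → Linear (Slice a b c) L → Linear (Slice a b c) (λ F → L (∂g R F))
  linear-∂g R l .local eq  = local l λ M (can , s) →
    cong (ℕtoℚ (suc (cnt R (gs M))) ℚ.*_) (eq (addG R M) (canonical-addG R {M} can , s))
  linear-∂g R l .add F G   = trans (local l λ M _ → ℚₚ.*-distribˡ-+ (ℕtoℚ (suc (cnt R (gs M)))) _ _) (add l _ _)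
  linear-∂g R l .scale c F = trans (local l λ M _ → *-swap (ℕtoℚ (suc (cnt R (gs M)))) c _) (scale l c _)

  linear-∂f : ∀ {L} S → Linear (Slice a b c) L → Linear (Slice a b c) (λ F → L (∂f S F))
  linear-∂f S l .local eq  = local l λ M (can , s) →
    cong (ℕtoℚ (suc (cnt (cyc S) (fs M))) ℚ.*_) (eq (addF S M) (canonical-addF S {M} can , s))
  linear-∂f S l .add F G   = trans (local l λ M _ → ℚₚ.*-distribˡ-+ (ℕtoℚ (suc (cnt (cyc S) (fs M)))) _ _) (add l _ _)
  linear-∂f S l .scale c F = trans (local l λ M _ → *-swap (ℕtoℚ (suc (cnt (cyc S) (fs M)))) c _) (scale l c _)

module _ {a b c : ℕ} {M : Mono} (slice : Slice a b c M) where

  linear-Cterm : ∀ R → Linear (Slice a b c) (λ F → Cterm R F M)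
  linear-Cterm []       = linear-0
  linear-Cterm (x ∷ Rs) = linear-≡ (λ F → Cterm-≡ x Rs F M)
    (linear-+ (linear-∑ (upTo (length Rs)) _ (λ t → linear-Cpart slice x (drop t Rs) (take (suc t) Rs)))
              (linear-mulTerm {M = M} slice 1 0 (x ∷ []) (cyc (x ∷ Rs) ∷ [])))

  linear-Jterm : ∀ R S → Linear (Slice a b c) (λ F → Jterm R S F M)
  linear-Jterm []       S = linear-0
  linear-Jterm (x ∷ Rs) S = linear-≡ (λ F → Jterm-≡ x Rs S F M)
    (linear-∑ (rotations S) _ (λ S' → linear-Jpart slice x Rs S'))

  linear-C'' : Linear (Slice a b c) (λ F → C'' F M)
  linear-C'' = linear-∑ (neWordsUpTo (size M)) _ λ R → linear-∂g R (linear-Cterm R)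

  linear-J'' : Linear (Slice a b c) (λ F → u²J'' F M)
  linear-J'' = linear-∑ (neWordsUpTo (size M)) _ λ R →
    linear-∑ (cycStringsUpTo (size M)) _ λ S → linear-∂f S (linear-∂g R (linear-Jterm R S))

-- The operators on a single monomial

𝟙 : Mono → Series
𝟙 d M = ⟦ d ==M M ⟧

mulTerm-𝟙 : ∀ j k Q Ts d M → Canonical M → mulTerm j k Q Ts (𝟙 d) M ≡ ⟦ times j k Q Ts d ==M M ⟧
mulTerm-𝟙 j k Q Ts d M can = trans (mulTerm-maybe j k Q Ts (𝟙 d) M) go
  where
  go : maybe (𝟙 d) 0ℚ (divide j k Q Ts M) ≡ ⟦ times j k Q Ts d ==M M ⟧
  go with divide j k Q Ts M in eq
  ... | just M' = ⟦⟧-cong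
    (λ p → trans (cong (_==M M) (trans (cong (times j k Q Ts) (==M-sound d M' p))
                                       (proj₂ (divide-sound j k Q Ts M can eq)))) (==M-refl M))
    (λ p → trans (cong (d ==M_) (just-injective (trans (sym eq)
             (trans (cong (divide j k Q Ts) (sym (==M-sound (times j k Q Ts d) M p))) (divide-times j k Q Ts d))))) (==M-refl d))
  ... | nothing with times j k Q Ts d ==M M in p
  ...   | false = refl
  ...   | true with () ← trans (sym eq) (trans (cong (divide j k Q Ts) (sym (==M-sound (times j k Q Ts d) M p))) (divide-times j k Q Ts d))

totalLength : List Word → ℕ
totalLength = foldr (λ w n → length w ℕ.+ n) 0

totalLength-++ : ∀ xs ys → totalLength (xs ++ ys) ≡ totalLength xs ℕ.+ totalLength ys
totalLength-++ []       ys = refl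
totalLength-++ (x ∷ xs) ys = trans (cong (length x ℕ.+_) (totalLength-++ xs ys)) (sym (ℕₚ.+-assoc (length x) _ _))

totalLength-ins : ∀ w l → totalLength (ins w l) ≡ length w ℕ.+ totalLength l
totalLength-ins w []      = refl
totalLength-ins w (v ∷ l) with leqW w v
... | true  = refl
... | false = trans (cong (length v ℕ.+_) (totalLength-ins w l))
  (trans (sym (ℕₚ.+-assoc (length v) (length w) _)) (trans (cong (ℕ._+ totalLength l) (ℕₚ.+-comm (length v) _))
    (ℕₚ.+-assoc (length w) _ _)))

totalLength-insFs : ∀ Ts l → totalLength Ts ≤ totalLength (insFs Ts l)
totalLength-insFs []       l = z≤n
totalLength-insFs (T ∷ Ts) l = ℕₚ.≤-trans
  (ℕₚ.+-mono-≤ (ℕₚ.≤-reflexive (sym (cyc-length T))) (totalLength-insFs Ts l))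
  (ℕₚ.≤-reflexive (sym (totalLength-ins (cyc T) (insFs Ts l))))

size-times : ∀ j k Q Ts d → length Q ℕ.+ totalLength Ts ≤ size (times j k Q Ts d)
size-times j k Q Ts d = ℕₚ.≤-trans
  (ℕₚ.+-mono-≤ (ℕₚ.≤-trans (ℕₚ.m≤m+n (length Q) _) (ℕₚ.≤-reflexive (sym (totalLength-ins Q (gs d)))))
               (totalLength-insFs Ts (fs d)))
  (ℕₚ.≤-reflexive (sym (totalLength-++ (ins Q (gs d)) (insFs Ts (fs d)))))

mulTerm-𝟙-vanish : ∀ j k Q Ts d M → Canonical M → size M < length Q ℕ.+ totalLength Ts →
                   mulTerm j k Q Ts (𝟙 d) M ≡ 0ℚ
mulTerm-𝟙-vanish j k Q Ts d M can lt = trans (mulTerm-𝟙 j k Q Ts d M can) go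
  where
  go : ⟦ times j k Q Ts d ==M M ⟧ ≡ 0ℚ
  go with times j k Q Ts d ==M M in p
  ... | false = refl
  ... | true  = ⊥-elim (ℕₚ.<⇒≱ lt (subst (λ M' → length Q ℕ.+ totalLength Ts ≤ size M')
               (==M-sound (times j k Q Ts d) M p) (size-times j k Q Ts d)))

data SplitAt {A : Set} (t : ℕ) (l : List A) : Set where
  splitAt : ∀ pre z post → l ≡ pre ++ z ∷ post → drop t l ≡ z ∷ post →
            take (suc t) l ≡ pre ∷ʳ z → length pre ≡ t → SplitAt t l

split-at : ∀ {A : Set} t (l : List A) → t < length l → SplitAt t l
split-at zero    (x ∷ l) _       = splitAt [] x l refl refl refl refl
split-at (suc t) (x ∷ l) (s≤s p) with split-at t l p
... | splitAt pre z post e d k n = splitAt (x ∷ pre) z post (cong (x ∷_) e) d (cong (x ∷_) k) (cong suc n)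

Cterm-𝟙-vanish : ∀ R d M → Canonical M → size M < length R → Cterm R (𝟙 d) M ≡ 0ℚ
Cterm-𝟙-vanish []       d M can lt = refl
Cterm-𝟙-vanish (R₁ ∷ Rs) d M can lt = trans (Cterm-≡ R₁ Rs (𝟙 d) M)
  (cong₂ ℚ._+_ (∑-0 (upTo (length Rs)) λ t t∈ → part t (∈-upTo⁻ t∈))
    (mulTerm-𝟙-vanish 1 0 (R₁ ∷ []) (cyc (R₁ ∷ Rs) ∷ []) d M can
      (ℕₚ.<-≤-trans lt (ℕₚ.≤-trans (ℕₚ.≤-reflexive (sym (trans (ℕₚ.+-identityʳ _) (cyc-length (R₁ ∷ Rs)))))
        (ℕₚ.n≤1+n _)))))
  where
  part : ∀ t → t < length Rs → Cpart R₁ (drop t Rs) (take (suc t) Rs) (𝟙 d) M ≡ 0ℚ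
  part t t< with split-at t Rs t<
  ... | splitAt pre z post e dr tk _ rewrite dr | tk =
    mulTerm-𝟙-vanish (δ● z) 0 (R₁ ∷ z ∷ post) ((pre ∷ʳ z) ∷ []) d M can (ℕₚ.<-≤-trans lt (begin
      suc (length Rs)                               ≡⟨ cong (suc ∘ length) e ⟩
      suc (length (pre ++ z ∷ post))                ≡⟨ cong suc (trans (Listₚ.length-++ pre) (ℕₚ.+-comm (length pre) _)) ⟩
      suc (suc (length post) ℕ.+ length pre)        ≤⟨ s≤s (s≤s (ℕₚ.+-monoʳ-≤ (length post)
        (ℕₚ.≤-trans (ℕₚ.m≤m+n (length pre) 1) (ℕₚ.≤-reflexive (sym (trans (ℕₚ.+-identityʳ _) (Listₚ.length-++ pre))))))) ⟩
      suc (suc (length post)) ℕ.+ totalLength ((pre ∷ʳ z) ∷ []) ∎))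
    where open ℕₚ.≤-Reasoning

Jterm-𝟙-vanish : ∀ R S d M → Canonical M → (size M < length R) ⊎ (size M < length S) → Jterm R S (𝟙 d) M ≡ 0ℚ
Jterm-𝟙-vanish []        S d M can lt = refl
Jterm-𝟙-vanish (R₁ ∷ Rs) S d M can lt = trans (Jterm-≡ R₁ Rs S (𝟙 d) M) (∑-0 (rotations S) part)
  where
  open ℕₚ.≤-Reasoning
  bound : ∀ S₁ St → length (S₁ ∷ St) ≡ length S → size M < length (R₁ ∷ (S₁ ∷ St) ++ S₁ ∷ Rs) ℕ.+ 0
  bound S₁ St eq = begin
    suc (size M)                                     ≤⟨ go lt ⟩
    suc (length (S₁ ∷ St)) ℕ.+ suc (length Rs)       ≡⟨ cong suc (Listₚ.length-++ (S₁ ∷ St)) ⟨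
    length (R₁ ∷ (S₁ ∷ St) ++ S₁ ∷ Rs)               ≡⟨ ℕₚ.+-identityʳ _ ⟨
    length (R₁ ∷ (S₁ ∷ St) ++ S₁ ∷ Rs) ℕ.+ 0         ∎
    where
    go : (size M < length (R₁ ∷ Rs)) ⊎ (size M < length S) → size M < suc (length (S₁ ∷ St)) ℕ.+ suc (length Rs)
    go (inj₁ p) = ℕₚ.<-≤-trans p (ℕₚ.m≤n+m _ (suc (length (S₁ ∷ St))))
    go (inj₂ p) = ℕₚ.<-≤-trans p (ℕₚ.≤-trans (ℕₚ.≤-reflexive (sym eq)) (ℕₚ.≤-trans (ℕₚ.n≤1+n _) (ℕₚ.m≤m+n _ _)))
  part : ∀ S' → S' ∈ rotations S → Jpart R₁ Rs S' (𝟙 d) M ≡ 0ℚ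
  part []        S'∈ = refl
  part (S₁ ∷ St) S'∈ with u , v , refl , eq ← ∈-rots⁻ S'∈ =
    mulTerm-𝟙-vanish (δ● S₁) 2 (R₁ ∷ (S₁ ∷ St) ++ S₁ ∷ Rs) [] d M can
      (bound S₁ St (trans (cong length eq) (Permₚ.↭-length (Permₚ.++-comm v u))))

module OneMonomial (a b c w u : ℕ) (R₁ : Lab) (Rs : Word) (Λ : List Word)
  (Λ-sorted : sortW Λ ≡ Λ) (Λ-cyc : ∀ {T} → T ∈ Λ → cyc T ≡ T) (Λ-nonempty : ∀ {T} → T ∈ Λ → T ≢ [])
  where

  R : Word
  R = R₁ ∷ Rs

  d : List Word → List Word → Mono
  d = mono a b c w u

  ∂g-𝟙 : ∀ R' M → ∂g R' (𝟙 (d (R ∷ []) Λ)) M ≡ ⟦ R' ==W R ⟧ ℚ.* 𝟙 (d [] Λ) M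
  ∂g-𝟙 R' M@(mono _ _ _ _ _ gs' _) with d (R ∷ []) Λ ==M addG R' M in eq
  ... | true with e ← ==M-sound (d (R ∷ []) Λ) (addG R' M) eq with refl , refl ← ins-singleton⁻ {R'} {gs'} {R} (cong gs e)
             | refl ← cong ex e | refl ← cong ey e | refl ← cong ev e | refl ← cong ew e | refl ← cong eu e
             | refl ← cong fs e
             rewrite ==W-refl R | ==M-refl (d [] Λ) = refl
  ∂g-𝟙 R' M@(mono _ _ _ _ _ _ _) | false with R' ==W R in p | d [] Λ ==M M in q
  ... | false | z     = trans (ℚₚ.*-zeroʳ (ℕtoℚ (suc (cnt R' (gs M))))) (sym (ℚₚ.*-zeroˡ ⟦ z ⟧))
  ... | true  | false = trans (ℚₚ.*-zeroʳ (ℕtoℚ (suc (cnt R' (gs M))))) refl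
  ... | true  | true with refl ← ==W-sound R' R p | refl ← ==M-sound (d [] Λ) M q
                     with () ← trans (sym eq) (==M-refl (d (R ∷ []) Λ))

  -- The monomial d/(g_R f_S)
  E : Word → Series
  E S M = ⟦ d [] Λ ==M addF S M ⟧

  cnt-ins : ∀ S l → cnt S (ins S l) ≡ suc (cnt S l)
  cnt-ins S [] rewrite ==W-refl S = refl
  cnt-ins S (v ∷ l) with leqW S v in Sv
  ... | true rewrite ==W-refl S = refl
  ... | false with S ==W v in eq
  ...   | true  = cong suc (cnt-ins S l)
  ...   | false = cnt-ins S l

  ∂f-𝟙 : ∀ S M → cyc S ≡ S → ∂f S (𝟙 (d [] Λ)) M ≡ ℕtoℚ (cnt S Λ) ℚ.* E S M
  ∂f-𝟙 S M cs with d [] Λ ==M addF S M in eq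
  ... | false = trans (ℚₚ.*-zeroʳ (ℕtoℚ (suc (cnt (cyc S) (fs M))))) (sym (ℚₚ.*-zeroʳ (ℕtoℚ (cnt S Λ))))
  ... | true with e ← cong fs (==M-sound (d [] Λ) (addF S M) eq) rewrite cs =
    cong (λ n → ℕtoℚ n ℚ.* 1ℚ) (trans (sym (cnt-ins S (fs M))) (cong (cnt S) (sym e)))

  E-𝟙 : ∀ S Λ' → cyc S ≡ S → Λ ≡ ins S Λ' → ∀ M → E S M ≡ 𝟙 (d [] Λ') M
  E-𝟙 S Λ' cs refl M@(mono _ _ _ _ _ _ fs') rewrite cs = ⟦⟧-cong
    (λ p → trans (cong (d [] Λ' ==M_) (go (==M-sound (d [] Λ) (record M { fs = ins S (fs M) }) p))) (==M-refl (d [] Λ')))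
    (λ p → trans (cong (λ M' → d [] Λ ==M record M' { fs = ins S (fs M') }) (sym (==M-sound (d [] Λ') M p))) (==M-refl (d [] Λ)))
    where
    go : d [] Λ ≡ record M { fs = ins S (fs M) } → M ≡ d [] Λ'
    go e with refl ← cong ex e | refl ← cong ey e | refl ← cong ev e | refl ← cong ew e | refl ← cong eu e
         | refl ← cong gs e | refl ← ins-injective S {Λ'} {fs'} (cong fs e) = refl

  del-∈ : ∀ {T} → T ∈ Λ → ∃ λ Λ' → Λ ≡ ins T Λ'
  del-∈ {T} T∈ with xs , ys , eq ← ∈-∃++ T∈ = sortW (xs ++ ys) ,
    trans (sym Λ-sorted) (sortW-resp-↭ (↭-trans (↭-reflexive eq) (Permₚ.shift T xs ys)))

  module _ {M : Mono} (can : Canonical M) where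

    private
      slice : Slice (ex M) (ey M) (ev M) M
      slice = can , refl , refl , refl

    C''-𝟙 : C'' (𝟙 (d (R ∷ []) Λ)) M ≡ Cterm R (𝟙 (d [] Λ)) M
    C''-𝟙 = trans (∑-cong (neWordsUpTo (size M)) λ R' →
        trans (local (linear-Cterm slice R') λ M' _ → ∂g-𝟙 R' M')
              (scale (linear-Cterm slice R') ⟦ R' ==W R ⟧ (𝟙 (d [] Λ))))
      (∑-neWordsUpTo (size M) R₁ Rs (λ R' → Cterm R' (𝟙 (d [] Λ)) M) (Cterm-𝟙-vanish R (d [] Λ) M can))

    Jterm-E-vanish : ∀ R' T → T ∈ Λ → (size M < length R') ⊎ (size M < length T) → Jterm R' T (E T) M ≡ 0ℚ
    Jterm-E-vanish R' T T∈ lt with Λ' , e ← del-∈ T∈ =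
      trans (local (linear-Jterm slice R' T) λ M' _ → E-𝟙 T Λ' (Λ-cyc T∈) e M')
            (Jterm-𝟙-vanish R' T (d [] Λ') M can lt)

    J-collapse : ∀ R' → ∑ (cycStringsUpTo (size M)) (λ S → ℕtoℚ (cnt S Λ) ℚ.* Jterm R' S (E S) M)
                 ≡ ∑ Λ (λ T → Jterm R' T (E T) M)
    J-collapse R' = begin
      ∑ U (λ S → ℕtoℚ (cnt S Λ) ℚ.* X S)
        ≡⟨ ∑-cong U (λ S → trans (cong (ℚ._* X S) (cnt-∑ S Λ)) (sym (∑-*ʳ (X S) Λ _))) ⟩
      ∑ U (λ S → ∑ Λ (λ T → ⟦ S ==W T ⟧ ℚ.* X S))
        ≡⟨ ∑-swap U Λ (λ S T → ⟦ S ==W T ⟧ ℚ.* X S) ⟩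
      ∑ Λ (λ T → ∑ U (λ S → ⟦ S ==W T ⟧ ℚ.* X S))
        ≡⟨ ∑-cong∈ Λ (λ T T∈ → trans (∑-filterᵇ _ (neWordsUpTo (size M)) _)
             (trans (∑-cong (neWordsUpTo (size M)) λ S → trans (if-* (cyc S ==W S) (⟦ S ==W T ⟧ ℚ.* X S))
                      (*-swap ⟦ cyc S ==W S ⟧ ⟦ S ==W T ⟧ (X S)))
                    (pick T T∈))) ⟩
      ∑ Λ X ∎
      where
      open ≡-Reasoning
      U : List Word
      U = cycStringsUpTo (size M)
      X : Word → ℚ
      X S = Jterm R' S (E S) M
      pick : ∀ T → T ∈ Λ → ∑ (neWordsUpTo (size M)) (λ S → ⟦ S ==W T ⟧ ℚ.* (⟦ cyc S ==W S ⟧ ℚ.* X S)) ≡ X T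
      pick []      T∈ = ⊥-elim (Λ-nonempty T∈ refl)
      pick (t ∷ T) T∈ = trans
        (∑-neWordsUpTo (size M) t T (λ S → ⟦ cyc S ==W S ⟧ ℚ.* X S)
          (λ lt → trans (cong (⟦ cyc (t ∷ T) ==W (t ∷ T) ⟧ ℚ.*_) (Jterm-E-vanish R' (t ∷ T) T∈ (inj₂ lt)))
            (ℚₚ.*-zeroʳ ⟦ cyc (t ∷ T) ==W (t ∷ T) ⟧)))
        (trans (cong (λ b → ⟦ b ⟧ ℚ.* X (t ∷ T)) (trans (cong (_==W (t ∷ T)) (Λ-cyc T∈)) (==W-refl (t ∷ T)))) (ℚₚ.*-identityˡ _))

    J''-𝟙 : u²J'' (𝟙 (d (R ∷ []) Λ)) M ≡ ∑ Λ (λ T → Jterm R T (E T) M)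
    J''-𝟙 = begin
      u²J'' (𝟙 (d (R ∷ []) Λ)) M
        ≡⟨ ∑-cong W (λ R' → trans (∑-cong∈ U (λ S S∈ → term R' S (∈-U S S∈))) (∑-*ˡ ⟦ R' ==W R ⟧ U _)) ⟩
      ∑ W (λ R' → ⟦ R' ==W R ⟧ ℚ.* ∑ U (λ S → ℕtoℚ (cnt S Λ) ℚ.* Jterm R' S (E S) M))
        ≡⟨ ∑-cong W (λ R' → cong (⟦ R' ==W R ⟧ ℚ.*_) (J-collapse R')) ⟩
      ∑ W (λ R' → ⟦ R' ==W R ⟧ ℚ.* ∑ Λ (λ T → Jterm R' T (E T) M))
        ≡⟨ ∑-neWordsUpTo (size M) R₁ Rs (λ R' → ∑ Λ (λ T → Jterm R' T (E T) M))
             (λ lt → ∑-0 Λ λ T T∈ → Jterm-E-vanish R T T∈ (inj₁ lt)) ⟩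
      ∑ Λ (λ T → Jterm R T (E T) M) ∎
      where
      open ≡-Reasoning
      W U : List Word
      W = neWordsUpTo (size M)
      U = cycStringsUpTo (size M)
      ∈-U : ∀ S → S ∈ U → cyc S ≡ S
      ∈-U S S∈ = ==W-sound _ _ (Equivalence.to T-≡ (proj₂ (∈-filter⁻ (T? ∘ (λ S → cyc S ==W S)) {xs = W} S∈)))
      term : ∀ R' S → cyc S ≡ S → Jterm R' S (∂g R' (∂f S (𝟙 (d (R ∷ []) Λ)))) M ≡
             ⟦ R' ==W R ⟧ ℚ.* (ℕtoℚ (cnt S Λ) ℚ.* Jterm R' S (E S) M)
      term R' S cs = begin
        Jterm R' S (∂g R' (∂f S (𝟙 (d (R ∷ []) Λ)))) M
          ≡⟨ local lin (λ M' _ → trans (*-swap (ℕtoℚ (suc (cnt R' (gs M')))) (ℕtoℚ (suc (cnt (cyc S) (fs M')))) _)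
               (trans (cong (ℕtoℚ (suc (cnt (cyc S) (fs M'))) ℚ.*_) (∂g-𝟙 R' (addF S M')))
               (trans (*-swap (ℕtoℚ (suc (cnt (cyc S) (fs M')))) ⟦ R' ==W R ⟧ _)
                      (cong (⟦ R' ==W R ⟧ ℚ.*_) (∂f-𝟙 S M' cs))))) ⟩
        Jterm R' S (λ M' → ⟦ R' ==W R ⟧ ℚ.* (ℕtoℚ (cnt S Λ) ℚ.* E S M')) M
          ≡⟨ scale lin ⟦ R' ==W R ⟧ (λ M' → ℕtoℚ (cnt S Λ) ℚ.* E S M') ⟩
        ⟦ R' ==W R ⟧ ℚ.* Jterm R' S (λ M' → ℕtoℚ (cnt S Λ) ℚ.* E S M') M
          ≡⟨ cong (⟦ R' ==W R ⟧ ℚ.*_) (scale lin (ℕtoℚ (cnt S Λ)) (E S)) ⟩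
        ⟦ R' ==W R ⟧ ℚ.* (ℕtoℚ (cnt S Λ) ℚ.* Jterm R' S (E S) M) ∎
        where
        lin : Linear (Slice (ex M) (ey M) (ev M)) (λ F → Jterm R' S F M)
        lin = linear-Jterm slice R' S

-- Inserting an edge: edges after corner k are renumbered by skip (suc k), which misses suc k

skip : ℕ → ℕ → ℕ
skip zero    a       = suc a
skip (suc k) zero    = zero
skip (suc k) (suc a) = suc (skip k a)

skip-≡ᵇ : ∀ k a b → (skip k a ≡ᵇ skip k b) ≡ (a ≡ᵇ b)
skip-≡ᵇ zero    a       b       = refl
skip-≡ᵇ (suc k) zero    zero    = refl
skip-≡ᵇ (suc k) zero    (suc b) = refl
skip-≡ᵇ (suc k) (suc a) zero    = refl
skip-≡ᵇ (suc k) (suc a) (suc b) = skip-≡ᵇ k a b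

skip-<ᵇ : ∀ k a b → (skip k a <ᵇ skip k b) ≡ (a <ᵇ b)
skip-<ᵇ zero    a       b       = refl
skip-<ᵇ (suc k) zero    zero    = refl
skip-<ᵇ (suc k) zero    (suc b) = refl
skip-<ᵇ (suc k) (suc a) zero    = refl
skip-<ᵇ (suc k) (suc a) (suc b) = skip-<ᵇ k a b

skip-injective : ∀ k {a b} → skip k a ≡ skip k b → a ≡ b
skip-injective zero    {a}     {b}     e = ℕₚ.suc-injective e
skip-injective (suc k) {zero}  {zero}  e = refl
skip-injective (suc k) {suc a} {suc b} e = cong suc (skip-injective k (ℕₚ.suc-injective e))

skip-≢ : ∀ k a → skip k a ≢ k
skip-≢ (suc k) (suc a) e = skip-≢ k a (ℕₚ.suc-injective e)

skip-self : ∀ k → skip k k ≡ suc k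
skip-self zero    = refl
skip-self (suc k) = cong suc (skip-self k)

skip-suc-self : ∀ k → skip (suc k) k ≡ k
skip-suc-self zero    = refl
skip-suc-self (suc k) = cong suc (skip-suc-self k)

skip-≥ : ∀ {k a} → k ≤ a → skip k a ≡ suc a
skip-≥ z≤n     = refl
skip-≥ (s≤s p) = cong suc (skip-≥ p)

skip-suc : ∀ k a → a ≢ k → skip (suc k) a ≡ skip k a
skip-suc zero    zero    ne = ⊥-elim (ne refl)
skip-suc zero    (suc a) ne = refl
skip-suc (suc k) zero    ne = refl
skip-suc (suc k) (suc a) ne = cong suc (skip-suc k a (ne ∘ cong suc))

skip-0 : ∀ k → k ≢ 0 → skip k 0 ≡ 0
skip-0 zero    k≢0 = ⊥-elim (k≢0 refl)
skip-0 (suc k) _   = refl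

upTo-suc : ∀ n → upTo (suc n) ≡ 0 ∷ map suc (upTo n)
upTo-suc n = cong (0 ∷_) (sym (Listₚ.map-upTo suc n))

upTo-skip : ∀ k n → k ≤ n → upTo (suc n) ↭ k ∷ map (skip k) (upTo n)
upTo-skip zero    n       _       = ↭-reflexive (upTo-suc n)
upTo-skip (suc k) (suc n) (s≤s p) = begin
  upTo (2 ℕ.+ n)                                     ≡⟨ upTo-suc (suc n) ⟩
  0 ∷ map suc (upTo (suc n))                         ↭⟨ Perm.prep 0 (Permₚ.map⁺ suc (upTo-skip k n p)) ⟩
  0 ∷ suc k ∷ map suc (map (skip k) (upTo n))        ↭⟨ Perm.swap 0 (suc k) ↭-refl ⟩
  suc k ∷ 0 ∷ map suc (map (skip k) (upTo n))        ≡⟨ cong (λ l → suc k ∷ 0 ∷ l) (trans (sym (Listₚ.map-∘ (upTo n))) (Listₚ.map-∘ (upTo n))) ⟩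
  suc k ∷ map (skip (suc k)) (0 ∷ map suc (upTo n))  ≡⟨ cong (λ l → suc k ∷ map (skip (suc k)) l) (upTo-suc n) ⟨
  suc k ∷ map (skip (suc k)) (upTo (suc n))          ∎
  where open Perm.PermutationReasoning

oneTo-skip : ∀ k n → k < n → oneTo (suc n) ↭ suc k ∷ map (skip (suc k)) (oneTo n)
oneTo-skip k (suc n) (s≤s p) = begin
  map suc (upTo (suc n))                      ↭⟨ Permₚ.map⁺ suc (upTo-skip k n p) ⟩
  suc k ∷ map suc (map (skip k) (upTo n))     ≡⟨ cong (suc k ∷_) (trans (sym (Listₚ.map-∘ (upTo n))) (Listₚ.map-∘ (upTo n))) ⟩
  suc k ∷ map (skip (suc k)) (map suc (upTo n)) ∎
  where open Perm.PermutationReasoning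

pm : ℕ → ℕ → ℕ
pm n k = if k ≡ᵇ 0 then n ∸ 1 else k ∸ 1

pm-skip : ∀ n k b → k < n → pm (suc n) (skip (suc k) b) ≡ skip k (pm n b)
pm-skip (suc n) k zero    (s≤s p) = sym (skip-≥ p)
pm-skip n       k (suc b) p       = refl

pm-< : ∀ n b → 0 < n → b < n → pm n b < n
pm-< (suc n) zero    _ _ = ℕₚ.≤-refl
pm-< n       (suc b) _ p = ℕₚ.<-trans (ℕₚ.n<1+n b) p

indexOf-map : ∀ (f : ℕ → ℕ) → (∀ a b → (f a ≡ᵇ f b) ≡ (a ≡ᵇ b)) → ∀ e l → indexOf (f e) (map f l) ≡ indexOf e l
indexOf-map f inj e []      = refl
indexOf-map f inj e (x ∷ l) rewrite inj e x | indexOf-map f inj e l = refl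

indexOf-++ˡ : ∀ e l l' → e ∈ l → indexOf e (l ++ l') ≡ indexOf e l
indexOf-++ˡ e (x ∷ l) l' e∈ with e ≡ᵇ x in eq
indexOf-++ˡ e (x ∷ l) l' e∈ | true = refl
indexOf-++ˡ e (x ∷ l) l' (here p) | false = ⊥-elim (true≢false (trans (sym (≡ᵇ-complete p)) eq))
indexOf-++ˡ e (x ∷ l) l' (there p) | false = cong suc (indexOf-++ˡ e l l' p)

indexOf-< : ∀ e l → e ∈ l → indexOf e l < length l
indexOf-< e (x ∷ l) e∈ with e ≡ᵇ x in eq
indexOf-< e (x ∷ l) e∈ | true = s≤s z≤n
indexOf-< e (x ∷ l) (here p) | false = ⊥-elim (true≢false (trans (sym (≡ᵇ-complete p)) eq))
indexOf-< e (x ∷ l) (there p) | false = s≤s (indexOf-< e l p)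

indexOf-∷ʳ : ∀ e l → e ∉ l → indexOf e (l ∷ʳ e) ≡ length l
indexOf-∷ʳ e []      _ rewrite ≡ᵇ-complete {e} {e} refl = refl
indexOf-∷ʳ e (x ∷ l) e∉ with e ≡ᵇ x in eq
... | true  = ⊥-elim (e∉ (here (≡ᵇ-sound e x eq)))
... | false = cong suc (indexOf-∷ʳ e l (e∉ ∘ there))

nth-map : ∀ (f : ℕ → ℕ) l i → i < length l → nth (map f l) i ≡ f (nth l i)
nth-map f (x ∷ l) zero    _       = refl
nth-map f (x ∷ l) (suc i) (s≤s p) = nth-map f l i p

nth-++ˡ : ∀ l l' i → i < length l → nth (l ++ l') i ≡ nth l i
nth-++ˡ (x ∷ l) l' zero    _       = refl
nth-++ˡ (x ∷ l) l' (suc i) (s≤s p) = nth-++ˡ l l' i p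

nth-∷ʳ : ∀ l x → nth (l ∷ʳ x) (length l) ≡ x
nth-∷ʳ []      x = refl
nth-∷ʳ (_ ∷ l) x = nth-∷ʳ l x

-- φ ∘ φ on root darts
ψ : ℕ → List ℕ → ℕ → ℕ
ψ n rot e = pm n (nth rot (pm n (indexOf e rot)))

append : ℕ → List ℕ → List ℕ
append k p = map (skip (suc k)) p ∷ʳ suc k

-- Cycles of a map, as lists of consecutive images

Chain : (ℕ → ℕ) → ℕ → List ℕ → ℕ → Set
Chain f x []      y = f x ≡ y
Chain f x (z ∷ l) y = f x ≡ z × Chain f z l y

chain-++ : ∀ {f} x l z l' {y} → Chain f x l z → Chain f z l' y → Chain f x (l ++ z ∷ l') y
chain-++ x []      z l' p       q = p , q
chain-++ x (w ∷ l) z l' (e , p) q = e , chain-++ w l z l' p q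

chain-split : ∀ {f} x l z l' {y} → Chain f x (l ++ z ∷ l') y → Chain f x l z × Chain f z l' y
chain-split x []      z l' (p , q) = p , q
chain-split x (w ∷ l) z l' (e , p) with q , r ← chain-split w l z l' p = (e , q) , r

IsCycle : (ℕ → ℕ) → List ℕ → Set
IsCycle f []      = ⊥
IsCycle f (x ∷ l) = Chain f x l x

isCycle-rotate : ∀ {f} u v → IsCycle f (u ++ v) → IsCycle f (v ++ u)
isCycle-rotate {f} []      v       c = subst (IsCycle f) (sym (Listₚ.++-identityʳ v)) c
isCycle-rotate {f} (x ∷ u) []      c = subst (IsCycle f) (Listₚ.++-identityʳ (x ∷ u)) c
isCycle-rotate     (x ∷ u) (z ∷ v) c with p , q ← chain-split x u z v c = chain-++ z v x u q p

record Decomp (n : ℕ) (rot : List ℕ) (cs : List (List ℕ)) : Set where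
  field
    cover  : concat cs ↭ upTo n
    cycles : All (IsCycle (ψ n rot)) cs
open Decomp

concat-↭ : ∀ {A : Set} {xss yss : List (List A)} → xss ↭ yss → concat xss ↭ concat yss
concat-↭ Perm.refl         = ↭-refl
concat-↭ (Perm.prep x q)   = Permₚ.++⁺ˡ x (concat-↭ q)
concat-↭ (Perm.swap x y q) = ↭-trans (Permₚ.shifts x y) (Permₚ.++⁺ˡ y (Permₚ.++⁺ˡ x (concat-↭ q)))
concat-↭ (Perm.trans q q') = ↭-trans (concat-↭ q) (concat-↭ q')

unique-resp-↭ : ∀ {A : Set} {xs ys : List A} → xs ↭ ys → Unique xs → Unique ys
unique-resp-↭ p u = Permₛₚ.Unique-resp-↭ (setoid _) (Perm.↭⇒↭ₛ p) u

module Insert (n : ℕ) (p : List ℕ) (rot↭ : 0 ∷ p ↭ upTo n) (k : ℕ) (k<n : k < n) where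

  h : ℕ → ℕ
  h = skip (suc k)

  f g : ℕ → ℕ
  f = ψ n (0 ∷ p)
  g = ψ (suc n) (0 ∷ append k p)

  0<n : 0 < n
  0<n = ℕₚ.≤-<-trans z≤n k<n

  length-rot : length (0 ∷ p) ≡ n
  length-rot = trans (Permₚ.↭-length rot↭) (Listₚ.length-upTo n)

  length-map-rot : length (map h (0 ∷ p)) ≡ n
  length-map-rot = trans (Listₚ.length-map h (0 ∷ p)) length-rot

  nth-append : ∀ i → i < n → nth (0 ∷ append k p) i ≡ h (nth (0 ∷ p) i)
  nth-append i i<n = trans (nth-++ˡ (map h (0 ∷ p)) (suc k ∷ []) i (subst (i <_) (sym length-map-rot) i<n))
    (nth-map h (0 ∷ p) i (subst (i <_) (sym length-rot) i<n))

  pos-h : ∀ a → a < n → indexOf (h a) (0 ∷ append k p) ≡ indexOf a (0 ∷ p)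
  pos-h a a<n = trans (indexOf-++ˡ (h a) (map h (0 ∷ p)) (suc k ∷ [])
      (∈-map⁺ h (Permₚ.∈-resp-↭ (↭-sym rot↭) (∈-upTo⁺ a<n))))
    (indexOf-map h (skip-≡ᵇ (suc k)) a (0 ∷ p))

  pos-< : ∀ a → a < n → indexOf a (0 ∷ p) < n
  pos-< a a<n = subst (indexOf a (0 ∷ p) <_) length-rot
    (indexOf-< a (0 ∷ p) (Permₚ.∈-resp-↭ (↭-sym rot↭) (∈-upTo⁺ a<n)))

  pos-new : indexOf (suc k) (0 ∷ append k p) ≡ n
  pos-new = trans (indexOf-∷ʳ (suc k) (map h (0 ∷ p)) ∉map) length-map-rot
    where
    ∉map : suc k ∉ map h (0 ∷ p)
    ∉map k∈ with a , _ , e ← ∈-map⁻ h k∈ = skip-≢ (suc k) a (sym e)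

  g-0 : g 0 ≡ k
  g-0 = cong (pm (suc n)) (trans (cong (nth (0 ∷ append k p)) (sym length-map-rot)) (nth-∷ʳ (map h (0 ∷ p)) (suc k)))

  g-h : ∀ a → a ≢ 0 → a < n → g (h a) ≡ skip k (f a)
  g-h zero    a≢0 _   = ⊥-elim (a≢0 refl)
  g-h (suc a) _   a<n = trans (cong (λ i → pm (suc n) (nth (0 ∷ append k p) (pm (suc n) i))) (pos-h (suc a) a<n))
    (trans (cong (pm (suc n)) (nth-append (indexOf (suc a) p) (ℕₚ.<-trans (ℕₚ.n<1+n _) (pos-< (suc a) a<n))))
           (pm-skip n k (nth (0 ∷ p) (indexOf (suc a) p)) k<n))

  g-new : g (suc k) ≡ skip k (f 0)
  g-new = trans (cong (λ i → pm (suc n) (nth (0 ∷ append k p) (pm (suc n) i))) pos-new)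
    (trans (cong (λ i → pm (suc n) (nth (0 ∷ append k p) i)) (pm-n n 0<n))
    (trans (cong (pm (suc n)) (nth-append (n ∸ 1) (ℕₚ.≤-reflexive (ℕₚ.m+[n∸m]≡n 0<n)))) (pm-skip n k (nth (0 ∷ p) (n ∸ 1)) k<n)))
    where
    pm-n : ∀ n → 0 < n → pm (suc n) n ≡ n ∸ 1
    pm-n (suc n) _ = refl

  Fresh : ℕ → Set
  Fresh a = a ≢ 0 × a ≢ k × a < n

  chain-transfer : ∀ x' x l {y} → Chain f x l y → g x' ≡ skip k (f x) → (∀ {a} → a ∈ l → Fresh a) →
                   Chain g x' (map h l) (skip k y)
  chain-transfer x' x []      e       e' fresh = trans e' (cong (skip k) e)
  chain-transfer x' x (z ∷ l) (e , c) e' fresh with z≢0 , z≢k , z<n ← fresh (here refl) =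
    trans e' (trans (cong (skip k) e) (sym (skip-suc k z z≢k))) ,
    chain-transfer (h z) z l c (g-h z z≢0 z<n) (fresh ∘ there)

  cycle-transfer : ∀ c → IsCycle f c → (∀ {a} → a ∈ c → Fresh a) → IsCycle g (map h c)
  cycle-transfer (x ∷ l) c fresh with x≢0 , x≢k , x<n ← fresh (here refl) =
    subst (Chain g (h x) (map h l)) (sym (skip-suc k x x≢k))
      (chain-transfer (h x) x l c (g-h x x≢0 x<n) (fresh ∘ there))

  cycles-transfer : ∀ cs → All (IsCycle f) cs → (∀ {a} → a ∈ concat cs → Fresh a) → All (IsCycle g) (map (map h) cs)
  cycles-transfer []       []         fresh = []
  cycles-transfer (c ∷ cs) (cy ∷ cys) fresh =
    cycle-transfer c cy (fresh ∘ ∈-++⁺ˡ) ∷ cycles-transfer cs cys (fresh ∘ ∈-++⁺ʳ c)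

  <n : ∀ {l a} → l ↭ upTo n → a ∈ l → a < n
  <n l↭ a∈ = ∈-upTo⁻ (Permₚ.∈-resp-↭ l↭ a∈)

  cover-h : ∀ {l} → l ↭ upTo n → suc k ∷ map h l ↭ upTo (suc n)
  cover-h l↭ = ↭-trans (Perm.prep (suc k) (Permₚ.map⁺ h l↭)) (↭-sym (upTo-skip (suc k) n k<n))

  fresh-0k : ∀ {l} → 0 ∷ k ∷ l ↭ upTo n → ∀ {a} → a ∈ l → Fresh a
  fresh-0k l↭ a∈ with unique-resp-↭ (↭-sym l↭) (Uniqueₚ.upTo⁺ n)
  ... | (_ ∷ 0∉) ∷ k∉ ∷ _ = (λ e → All.lookup 0∉ a∈ (sym e)) , (λ e → All.lookup k∉ a∈ (sym e)) , <n l↭ (there (there a∈))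

  distinct-0k : ∀ {l} → 0 ∷ k ∷ l ↭ upTo n → k ≢ 0
  distinct-0k l↭ k≡0 with (0≢k ∷ _) ∷ _ ← unique-resp-↭ (↭-sym l↭) (Uniqueₚ.upTo⁺ n) = 0≢k (sym k≡0)

  decomp-first : ∀ {r rest} → k ≡ 0 → Decomp n (0 ∷ p) ((0 ∷ r) ∷ rest) →
                 Decomp (suc n) (0 ∷ append k p) ((0 ∷ []) ∷ (suc k ∷ map h r) ∷ map (map h) rest)
  decomp-first {r} {rest} refl D with cy ∷ cys ← cycles D = record
    { cover = begin
        0 ∷ 1 ∷ map h r ++ concat (map (map h) rest)  ≡⟨ cong (λ l → 0 ∷ 1 ∷ map h r ++ l) (Listₚ.concat-map rest) ⟩
        0 ∷ 1 ∷ map h r ++ map h (concat rest)        ≡⟨ cong (λ l → 0 ∷ 1 ∷ l) (Listₚ.map-++ h r _) ⟨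
        0 ∷ 1 ∷ map h (r ++ concat rest)              ↭⟨ Perm.swap 0 1 ↭-refl ⟩
        1 ∷ map h (0 ∷ r ++ concat rest)              ↭⟨ cover-h (cover D) ⟩
        upTo (suc n)                                  ∎
    ; cycles = g-0 ∷ chain-transfer 1 0 r cy g-new (fresh ∘ ∈-++⁺ˡ) ∷ cycles-transfer rest cys (fresh ∘ ∈-++⁺ʳ r) }
    where
    open Perm.PermutationReasoning
    fresh : ∀ {a} → a ∈ r ++ concat rest → Fresh a
    fresh a∈ with unique-resp-↭ (↭-sym (cover D)) (Uniqueₚ.upTo⁺ n)
    ... | 0∉ ∷ _ = (λ e → All.lookup 0∉ a∈ (sym e)) , (λ e → All.lookup 0∉ a∈ (sym e)) , <n (cover D) (there a∈)

  decomp-split : ∀ {r₁ r₂ rest} → Decomp n (0 ∷ p) ((0 ∷ r₁ ++ k ∷ r₂) ∷ rest) →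
                 Decomp (suc n) (0 ∷ append k p) ((0 ∷ k ∷ map h r₂) ∷ (suc k ∷ map h r₁) ∷ map (map h) rest)
  decomp-split {r₁} {r₂} {rest} D with cy ∷ cys ← cycles D | c₁ , c₂ ← chain-split 0 r₁ k r₂ (All.head (cycles D)) = record
    { cover = begin
        0 ∷ k ∷ map h r₂ ++ suc k ∷ map h r₁ ++ concat (map (map h) rest)
          ≡⟨ cong (λ l → 0 ∷ k ∷ map h r₂ ++ suc k ∷ map h r₁ ++ l) (Listₚ.concat-map rest) ⟩
        0 ∷ k ∷ map h r₂ ++ suc k ∷ map h r₁ ++ map h (concat rest)
          ↭⟨ Perm.prep 0 (Perm.prep k (Permₚ.shift (suc k) (map h r₂) _)) ⟩
        0 ∷ k ∷ suc k ∷ map h r₂ ++ map h r₁ ++ map h (concat rest)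
          ≡⟨ cong (λ l → 0 ∷ k ∷ suc k ∷ l) (trans (cong (map h r₂ ++_) (sym (Listₚ.map-++ h r₁ _))) (sym (Listₚ.map-++ h r₂ _))) ⟩
        0 ∷ k ∷ suc k ∷ map h (r₂ ++ r₁ ++ concat rest)
          ↭⟨ Permₚ.shift (suc k) (0 ∷ k ∷ []) _ ⟩
        suc k ∷ 0 ∷ k ∷ map h (r₂ ++ r₁ ++ concat rest)
          ≡⟨ cong (λ z → suc k ∷ 0 ∷ z ∷ map h (r₂ ++ r₁ ++ concat rest)) (skip-suc-self k) ⟨
        suc k ∷ map h (0 ∷ k ∷ r₂ ++ r₁ ++ concat rest)
          ↭⟨ cover-h cov ⟩
        upTo (suc n) ∎
    ; cycles = (g-0 , subst (Chain g k (map h r₂)) (skip-0 k k≢0)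
                 (chain-transfer k k r₂ c₂ (trans (cong g (sym (skip-suc-self k))) (g-h k k≢0 k<n)) (fresh ∘ ∈-++⁺ˡ)))
             ∷ subst (Chain g (suc k) (map h r₁)) (skip-self k)
                 (chain-transfer (suc k) 0 r₁ c₁ g-new (fresh ∘ ∈-++⁺ʳ r₂ ∘ ∈-++⁺ˡ))
             ∷ cycles-transfer rest cys (fresh ∘ ∈-++⁺ʳ r₂ ∘ ∈-++⁺ʳ r₁) }
    where
    open Perm.PermutationReasoning
    cov : 0 ∷ k ∷ r₂ ++ r₁ ++ concat rest ↭ upTo n
    cov = begin
      0 ∷ k ∷ r₂ ++ r₁ ++ concat rest     ↭⟨ Permₚ.++⁺ˡ (0 ∷ []) (Permₚ.shifts (k ∷ r₂) r₁) ⟩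
      0 ∷ r₁ ++ k ∷ r₂ ++ concat rest     ≡⟨ cong (0 ∷_) (Listₚ.++-assoc r₁ (k ∷ r₂) _) ⟨
      0 ∷ (r₁ ++ k ∷ r₂) ++ concat rest   ↭⟨ cover D ⟩
      upTo n ∎
    fresh : ∀ {a} → a ∈ r₂ ++ r₁ ++ concat rest → Fresh a
    fresh = fresh-0k cov
    k≢0 : k ≢ 0
    k≢0 = distinct-0k cov

  decomp-join : ∀ {r c s rest rest'} → rest ↭ c ∷ rest' → (∃₂ λ u v → c ≡ u ++ v × k ∷ s ≡ v ++ u) →
                Decomp n (0 ∷ p) ((0 ∷ r) ∷ rest) →
                Decomp (suc n) (0 ∷ append k p) ((0 ∷ k ∷ map h s ++ suc k ∷ map h r) ∷ map (map h) rest')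
  decomp-join {r} {c} {s} {rest} {rest'} rest↭ (u , v , refl , ks) D with cy ∷ cys ← cycles D = record
    { cover = begin
        0 ∷ k ∷ (map h s ++ suc k ∷ map h r) ++ concat (map (map h) rest')
          ≡⟨ cong (λ l → 0 ∷ k ∷ l) (trans (Listₚ.++-assoc (map h s) _ _) (cong (λ l → map h s ++ suc k ∷ map h r ++ l) (Listₚ.concat-map rest'))) ⟩
        0 ∷ k ∷ map h s ++ suc k ∷ map h r ++ map h (concat rest')
          ↭⟨ Perm.prep 0 (Perm.prep k (Permₚ.shift (suc k) (map h s) _)) ⟩
        0 ∷ k ∷ suc k ∷ map h s ++ map h r ++ map h (concat rest')
          ≡⟨ cong (λ l → 0 ∷ k ∷ suc k ∷ l) (trans (cong (map h s ++_) (sym (Listₚ.map-++ h r _))) (sym (Listₚ.map-++ h s _))) ⟩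
        0 ∷ k ∷ suc k ∷ map h (s ++ r ++ concat rest')
          ↭⟨ Permₚ.shift (suc k) (0 ∷ k ∷ []) _ ⟩
        suc k ∷ 0 ∷ k ∷ map h (s ++ r ++ concat rest')
          ≡⟨ cong (λ z → suc k ∷ 0 ∷ z ∷ map h (s ++ r ++ concat rest')) (skip-suc-self k) ⟨
        suc k ∷ map h (0 ∷ k ∷ s ++ r ++ concat rest')
          ↭⟨ cover-h cov ⟩
        upTo (suc n) ∎
    ; cycles = (g-0 , chain-++ k (map h s) (suc k) (map h r)
                  (subst (Chain g k (map h s)) (skip-self k)
                    (chain-transfer k k s ks-cycle (trans (cong g (sym (skip-suc-self k))) (g-h k k≢0 k<n)) (fresh ∘ ∈-++⁺ˡ)))
                  (subst (Chain g (suc k) (map h r)) (skip-0 k k≢0)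
                    (chain-transfer (suc k) 0 r cy g-new (fresh ∘ ∈-++⁺ʳ s ∘ ∈-++⁺ˡ))))
             ∷ cycles-transfer rest' (All.tail cys') (fresh ∘ ∈-++⁺ʳ s ∘ ∈-++⁺ʳ r) }
    where
    open Perm.PermutationReasoning
    cys' : All (IsCycle f) ((u ++ v) ∷ rest')
    cys' = Permₚ.All-resp-↭ rest↭ (All.tail (cycles D))
    ks-cycle : IsCycle f (k ∷ s)
    ks-cycle = subst (IsCycle f) (sym ks) (isCycle-rotate u v (All.head cys'))
    cov : 0 ∷ k ∷ s ++ r ++ concat rest' ↭ upTo n
    cov = begin
      0 ∷ (k ∷ s) ++ r ++ concat rest'      ≡⟨ cong (λ l → 0 ∷ l ++ r ++ concat rest') ks ⟩
      0 ∷ (v ++ u) ++ r ++ concat rest'     ↭⟨ Perm.prep 0 (Permₚ.shifts (v ++ u) r) ⟩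
      0 ∷ r ++ (v ++ u) ++ concat rest'     ↭⟨ Permₚ.++⁺ˡ (0 ∷ r) (Permₚ.++⁺ʳ (concat rest') (Permₚ.++-comm v u)) ⟩
      0 ∷ r ++ concat ((u ++ v) ∷ rest')    ↭⟨ Permₚ.++⁺ˡ (0 ∷ r) (concat-↭ rest↭) ⟨
      0 ∷ r ++ concat rest                  ↭⟨ cover D ⟩
      upTo n ∎
    fresh : ∀ {a} → a ∈ s ++ r ++ concat rest' → Fresh a
    fresh = fresh-0k cov
    k≢0 : k ≢ 0
    k≢0 = distinct-0k cov

-- The faces of a dipole, read off the cycles of ψ

orbitFrom : Dip → ℕ → ℕ → ℕ → List ℕ
orbitFrom D d zero    e = []
orbitFrom D d (suc k) e = if e ≡ᵇ d then [] else e ∷ orbitFrom D d k (φ D e)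

-- As for Cpart-≡, the hole is the anonymous where-bound function, here that of orbit.
orbitFrom-≡ : ∀ D d k e → _ ≡ orbitFrom D d k e

orbit-≡ : ∀ D d → orbit D d ≡ d ∷ orbitFrom D d (2 ℕ.* n D) (φ D d)
orbit-≡ D d with 2 ℕ.* n D | φ D d
... | k | e = cong (d ∷_) (orbitFrom-≡ D d k e)

orbitFrom-≡ D d zero    e = refl
orbitFrom-≡ D d (suc k) e with e ≡ᵇ d
... | true  = refl
... | false = cong (e ∷_) (orbitFrom-≡ D d k (φ D e))

lab : ℕ → ℕ → Lab
lab s d = if d <ᵇ s then ● else ○

<⇒<ᵇ-true : ∀ {a b} → a < b → (a <ᵇ b) ≡ true
<⇒<ᵇ-true p = Equivalence.to T-≡ (ℕₚ.<⇒<ᵇ p)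

≥⇒<ᵇ-false : ∀ {a b} → b ≤ a → (a <ᵇ b) ≡ false
≥⇒<ᵇ-false {a} {b} p with a <ᵇ b in eq
... | false = refl
... | true  = ⊥-elim (ℕₚ.<⇒≱ (ℕₚ.<ᵇ⇒< a b (Equivalence.from T-≡ eq)) p)

≢⇒≡ᵇ-false : ∀ {a b} → a ≢ b → (a ≡ᵇ b) ≡ false
≢⇒≡ᵇ-false {a} {b} ne with a ≡ᵇ b in eq
... | false = refl
... | true  = ⊥-elim (ne (≡ᵇ-sound a b eq))

>⇒≤ᵇ-false : ∀ {a b} → b < a → (a ≤ᵇ b) ≡ false
>⇒≤ᵇ-false {suc a} p = ≥⇒<ᵇ-false (ℕₚ.≤-pred p)

foldr-≤ᵇ-true : ∀ x l → (∀ {e} → e ∈ l → x ≤ e) → foldr (λ e b → (x ≤ᵇ e) ∧ b) true l ≡ true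
foldr-≤ᵇ-true x []      _  = refl
foldr-≤ᵇ-true x (y ∷ l) le = ∧-intro (Equivalence.to T-≡ (ℕₚ.≤⇒≤ᵇ (le (here refl)))) (foldr-≤ᵇ-true x l (le ∘ there))

foldr-≤ᵇ-false : ∀ x {e} l → e ∈ l → e < x → foldr (λ e b → (x ≤ᵇ e) ∧ b) true l ≡ false
foldr-≤ᵇ-false x (y ∷ l) (here refl) lt rewrite >⇒≤ᵇ-false lt = refl
foldr-≤ᵇ-false x (y ∷ l) (there p) lt with x ≤ᵇ y
... | true  = foldr-≤ᵇ-false x l p lt
... | false = refl

∈⇒inList : ∀ D x l → x ∈ l → inList D x l ≡ true
∈⇒inList D x (y ∷ l) (here p) rewrite ≡ᵇ-complete {x} p = refl
∈⇒inList D x (y ∷ l) (there p) with x ≡ᵇ y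
... | true  = refl
... | false = ∈⇒inList D x l p

∉⇒inList : ∀ D x l → x ∉ l → inList D x l ≡ false
∉⇒inList D x []      _ = refl
∉⇒inList D x (y ∷ l) ∉ rewrite ≢⇒≡ᵇ-false {x} {y} (∉ ∘ here) = ∉⇒inList D x l (∉ ∘ there)

upTo-+ : ∀ a b → upTo (a ℕ.+ b) ≡ upTo a ++ map (a ℕ.+_) (upTo b)
upTo-+ zero    b = sym (Listₚ.map-id (upTo b))
upTo-+ (suc a) b = trans (upTo-suc (a ℕ.+ b)) (trans (cong (λ l → 0 ∷ map suc l) (upTo-+ a b))
  (trans (cong (0 ∷_) (Listₚ.map-++ suc (upTo a) _))
  (trans (cong (λ l → 0 ∷ map suc (upTo a) ++ l) (sym (Listₚ.map-∘ (upTo b))))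
         (cong (_++ map (suc a ℕ.+_) (upTo b)) (sym (upTo-suc a))))))

filterᵇ-all-false : ∀ {A : Set} (q : A → Bool) l → (∀ {x} → x ∈ l → q x ≡ false) → filterᵇ q l ≡ []
filterᵇ-all-false q []      _ = refl
filterᵇ-all-false q (x ∷ l) f rewrite f (here refl) = filterᵇ-all-false q l (f ∘ there)

filterᵇ-concat : ∀ {A : Set} (q : A → Bool) ls → filterᵇ q (concat ls) ≡ concat (map (filterᵇ q) ls)
filterᵇ-concat q []       = refl
filterᵇ-concat q (l ∷ ls) = trans (Listₚ.filter-++ (T? ∘ q) l (concat ls)) (cong (filterᵇ q l ++_) (filterᵇ-concat q ls))

minimum-split : ∀ x l → ∃ λ u → ∃ λ z → ∃ λ v → x ∷ l ≡ u ++ z ∷ v × (∀ {e} → e ∈ x ∷ l → z ≤ e)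
minimum-split x []      = [] , x , [] , refl , λ { (here refl) → ℕₚ.≤-refl }
minimum-split x (y ∷ l) with minimum-split y l
... | u , z , v , eq , le with ℕₚ.≤-total x z
...   | inj₁ x≤z = [] , x , y ∷ l , refl , λ { (here refl) → ℕₚ.≤-refl ; (there p) → ℕₚ.≤-trans x≤z (le p) }
...   | inj₂ z≤x = x ∷ u , z , v , cong (x ∷_) eq , λ { (here refl) → z≤x ; (there p) → le p }

module Faces (n' : ℕ) (rot' : List ℕ) (s' : ℕ) (0<n : 0 < n') where

  D : Dip
  D = dip n' rot' s'

  f : ℕ → ℕ
  f = ψ n' rot'

  φ-root : ∀ {d} → d < n' → φ D d ≡ n' ℕ.+ nth rot' (pm n' (indexOf d rot'))
  φ-root {d} p rewrite <⇒<ᵇ-true p = refl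

  φ-nonroot : ∀ e → φ D (n' ℕ.+ e) ≡ pm n' e
  φ-nonroot e rewrite ≥⇒<ᵇ-false (ℕₚ.m≤m+n n' e) | ℕₚ.m+n∸m≡n n' e = refl

  φ-φ : ∀ {d} → d < n' → φ D (φ D d) ≡ f d
  φ-φ p = trans (cong (φ D) (φ-root p)) (φ-nonroot _)

  φ-≥ : ∀ {d} → d < n' → n' ≤ φ D d
  φ-≥ p = ℕₚ.≤-trans (ℕₚ.m≤m+n n' _) (ℕₚ.≤-reflexive (sym (φ-root p)))

  walk : ℕ → List ℕ → List ℕ
  walk p []       = φ D p ∷ []
  walk p (y ∷ ys) = φ D p ∷ y ∷ walk y ys

  orbitFrom-walk : ∀ x p l fuel → x < n' → p < n' → (∀ {a} → a ∈ l → a < n' × a ≢ x) → Chain f p l x →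
                   suc (length l ℕ.+ length l) ≤ fuel → orbitFrom D x fuel (φ D p) ≡ walk p l
  orbitFrom-walk x p l (suc fuel) x<n p<n l-ok ch (s≤s le)
    rewrite ≢⇒≡ᵇ-false {φ D p} {x} (λ e → ℕₚ.<⇒≱ x<n (subst (n' ≤_) e (φ-≥ p<n))) | φ-φ p<n
    with l | fuel
  ... | [] | zero = refl
  ... | [] | suc fuel' rewrite ch | ≡ᵇ-complete {x} refl = refl
  ... | y ∷ ys | suc fuel' with e , ch' ← ch rewrite e | ≢⇒≡ᵇ-false (proj₂ (l-ok (here refl))) =
    cong (λ w → φ D p ∷ y ∷ w) (orbitFrom-walk x y ys fuel' x<n (proj₁ (l-ok (here refl))) (l-ok ∘ there) ch'
      (ℕₚ.≤-trans (ℕₚ.≤-reflexive (sym (ℕₚ.+-suc (length ys) _))) (ℕₚ.≤-pred le)))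

  FaceCycle : List ℕ → Set
  FaceCycle c = IsCycle f c × ∃ λ L → c ++ L ↭ upTo n'

  face-rotate : ∀ u v → FaceCycle (u ++ v) → FaceCycle (v ++ u)
  face-rotate u v (cy , L , e) = isCycle-rotate u v cy , L , ↭-trans (Permₚ.++⁺ʳ L (Permₚ.++-comm v u)) e

  face-< : ∀ {c} → FaceCycle c → ∀ {a} → a ∈ c → a < n'
  face-< (_ , L , e) a∈ = ∈-upTo⁻ (Permₚ.∈-resp-↭ e (∈-++⁺ˡ a∈))

  face-≢ : ∀ {x l} → FaceCycle (x ∷ l) → ∀ {a} → a ∈ l → a ≢ x
  face-≢ (_ , L , e) a∈ with unique-resp-↭ (↭-sym e) (Uniqueₚ.upTo⁺ n')
  ... | x∉ ∷ _ = λ a≡x → All.lookup x∉ (∈-++⁺ˡ a∈) (sym a≡x)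

  face-length : ∀ {c} → FaceCycle c → length c ≤ n'
  face-length {c} (_ , L , e) = ℕₚ.≤-trans (ℕₚ.m≤m+n (length c) (length L))
    (ℕₚ.≤-reflexive (trans (sym (Listₚ.length-++ c)) (trans (Permₚ.↭-length e) (Listₚ.length-upTo n'))))

  orbit-face : ∀ x l → FaceCycle (x ∷ l) → orbit D x ≡ x ∷ walk x l
  orbit-face x l face = trans (orbit-≡ D x) (cong (x ∷_)
    (orbitFrom-walk x x l (2 ℕ.* n') x<n x<n (λ a∈ → face-< face (there a∈) , face-≢ face a∈) (proj₁ face)
      (ℕₚ.≤-trans (s≤s (ℕₚ.+-monoʳ-≤ (length l) (ℕₚ.n≤1+n _)))
        (ℕₚ.≤-trans (ℕₚ.+-mono-≤ (face-length face) (face-length face))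
                    (ℕₚ.≤-reflexive (cong (n' ℕ.+_) (sym (ℕₚ.+-identityʳ n'))))))))
    where
    x<n : x < n'
    x<n = face-< face (here refl)

  labels-root : ∀ {d} ds → d < n' → labels D (d ∷ ds) ≡ lab s' d ∷ labels D ds
  labels-root ds p rewrite <⇒<ᵇ-true p = refl

  labels-φ : ∀ {d} ds → d < n' → labels D (φ D d ∷ ds) ≡ labels D ds
  labels-φ ds p rewrite ≥⇒<ᵇ-false (φ-≥ p) = refl

  labels-walk : ∀ p l → p < n' → (∀ {a} → a ∈ l → a < n') → labels D (walk p l) ≡ map (lab s') l
  labels-walk p []       p<n l-ok = labels-φ [] p<n
  labels-walk p (y ∷ ys) p<n l-ok = trans (labels-φ (y ∷ walk y ys) p<n)
    (trans (labels-root (walk y ys) (l-ok (here refl))) (cong (lab s' y ∷_) (labels-walk y ys (l-ok (here refl)) (l-ok ∘ there))))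

  labels-face : ∀ x l → FaceCycle (x ∷ l) → labels D (orbit D x) ≡ map (lab s') (x ∷ l)
  labels-face x l face = trans (cong (labels D) (orbit-face x l face))
    (trans (labels-root (walk x l) (face-< face (here refl)))
           (cong (lab s' x ∷_) (labels-walk x l (face-< face (here refl)) (face-< face ∘ there))))

  ∈-walk⁺ : ∀ {a} p l → a ∈ l → a ∈ walk p l
  ∈-walk⁺ p (y ∷ ys) (here e)  = there (here e)
  ∈-walk⁺ p (y ∷ ys) (there q) = there (there (∈-walk⁺ y ys q))

  ∈-walk⁻ : ∀ {a} p l → p < n' → (∀ {b} → b ∈ l → b < n') → a ∈ walk p l → a ∈ l ⊎ n' ≤ a
  ∈-walk⁻ p []       p<n ok (here refl)         = inj₂ (φ-≥ p<n)
  ∈-walk⁻ p (y ∷ ys) p<n ok (here refl)         = inj₂ (φ-≥ p<n)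
  ∈-walk⁻ p (y ∷ ys) p<n ok (there (here e))    = inj₁ (here e)
  ∈-walk⁻ p (y ∷ ys) p<n ok (there (there q)) with ∈-walk⁻ y ys (ok (here refl)) (ok ∘ there) q
  ... | inj₁ a∈ = inj₁ (there a∈)
  ... | inj₂ le = inj₂ le

  ∈-orbit⁺ : ∀ x l → FaceCycle (x ∷ l) → ∀ {a} → a ∈ x ∷ l → a ∈ orbit D x
  ∈-orbit⁺ x l face {a} a∈ = subst (a ∈_) (sym (orbit-face x l face)) (go a∈)
    where
    go : a ∈ x ∷ l → a ∈ x ∷ walk x l
    go (here e)  = here e
    go (there p) = there (∈-walk⁺ x l p)

  ∈-orbit⁻ : ∀ x l → FaceCycle (x ∷ l) → ∀ {a} → a ∈ orbit D x → a ∈ x ∷ l ⊎ n' ≤ a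
  ∈-orbit⁻ x l face {a} a∈ with subst (a ∈_) (orbit-face x l face) a∈
  ... | here e  = inj₁ (here e)
  ... | there p with ∈-walk⁻ x l (face-< face (here refl)) (face-< face ∘ there) p
  ...   | inj₁ q = inj₁ (there q)
  ...   | inj₂ q = inj₂ q

  isRep-min : ∀ x l → FaceCycle (x ∷ l) → (∀ {e} → e ∈ x ∷ l → x ≤ e) → isRep D x ≡ true
  isRep-min x l face le = foldr-≤ᵇ-true x (orbit D x) λ e∈ → go (∈-orbit⁻ x l face e∈)
    where
    go : ∀ {e} → e ∈ x ∷ l ⊎ n' ≤ e → x ≤ e
    go (inj₁ p) = le p
    go (inj₂ p) = ℕₚ.≤-trans (ℕₚ.<⇒≤ (face-< face (here refl))) p

  ∈-face : ∀ {c y} → FaceCycle c → y ∈ c → ∃ λ l → FaceCycle (y ∷ l) × y ∷ l ↭ c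
  ∈-face face y∈ with u , v , refl ← ∈-∃++ y∈ =
    v ++ u , face-rotate u (_ ∷ v) face , Permₚ.++-comm (_ ∷ v) u

  isRep-nonmin : ∀ {c x y} → FaceCycle c → y ∈ c → x ∈ c → x < y → isRep D y ≡ false
  isRep-nonmin {y = y} face y∈ x∈ x<y with l , face' , e ← ∈-face face y∈ =
    foldr-≤ᵇ-false y (orbit D y) (∈-orbit⁺ y l face' (Permₚ.∈-resp-↭ (↭-sym e) x∈)) x<y

  isRep-nonroot : ∀ e → e < n' → isRep D (n' ℕ.+ e) ≡ false
  isRep-nonroot e e<n = foldr-≤ᵇ-false (n' ℕ.+ e) (orbit D (n' ℕ.+ e))
    (subst (pm n' e ∈_) (sym (orbit-≡ D (n' ℕ.+ e))) (there (go (2 ℕ.* n') (ℕₚ.<-≤-trans 0<n (ℕₚ.m≤m+n n' _)))))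
    pm<
    where
    pm< : pm n' e < n' ℕ.+ e
    pm< = ℕₚ.<-≤-trans (pm-< n' e 0<n e<n) (ℕₚ.m≤m+n n' e)
    go : ∀ fuel → 0 < fuel → pm n' e ∈ orbitFrom D (n' ℕ.+ e) fuel (φ D (n' ℕ.+ e))
    go (suc fuel) _ rewrite φ-nonroot e | ≢⇒≡ᵇ-false (ℕₚ.<⇒≢ pm<) = here refl

  record Rep (c : List ℕ) : Set where
    field
      rep        : ℕ
      filter-rep : filterᵇ (isRep D) c ≡ rep ∷ []
      cyc-rep    : cyc (labels D (orbit D rep)) ≡ cyc (map (lab s') c)
      0∈-rep     : inList D 0 (orbit D rep) ≡ true → 0 ∈ c
      rep-0∈     : 0 ∈ c → inList D 0 (orbit D rep) ≡ true
  open Rep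

  face-rep : ∀ {c} → FaceCycle c → Rep c
  face-rep {[]} (() , _)
  face-rep {x ∷ l} face with minimum-split x l
  ... | u , z , v , eq , le = record
    { rep = z
    ; filter-rep = trans (cong (filterᵇ (isRep D)) eq) (trans (Listₚ.filter-++ (T? ∘ isRep D) u (z ∷ v))
        (cong₂ _++_ (filterᵇ-all-false (isRep D) u (λ a∈ → nonmin (subst (_ ∈_) (sym eq) (∈-++⁺ˡ a∈)) (u-≢ a∈)))
                    (tail-filter face-z)))
    ; cyc-rep = trans (cong cyc (trans (labels-face z (v ++ u) face-z) (Listₚ.map-++ (lab s') (z ∷ v) u)))
        (trans (cyc-++-comm (map (lab s') (z ∷ v)) (map (lab s') u))
               (cong cyc (trans (sym (Listₚ.map-++ (lab s') u (z ∷ v))) (cong (map (lab s')) (sym eq)))))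
    ; 0∈-rep = 0∈
    ; rep-0∈ = λ 0∈c → ∈⇒inList D 0 (orbit D z) (∈-orbit⁺ z (v ++ u) face-z (Permₚ.∈-resp-↭ c↭ 0∈c))
    }
    where
    face-z : FaceCycle (z ∷ v ++ u)
    face-z = face-rotate u (z ∷ v) (subst FaceCycle eq face)
    c↭ : x ∷ l ↭ z ∷ v ++ u
    c↭ = ↭-trans (↭-reflexive eq) (Permₚ.++-comm u (z ∷ v))
    nonmin : ∀ {a} → a ∈ x ∷ l → a ≢ z → isRep D a ≡ false
    nonmin a∈ a≢z = isRep-nonmin face a∈ (Permₚ.∈-resp-↭ (↭-sym c↭) (here refl)) (ℕₚ.≤∧≢⇒< (le a∈) (a≢z ∘ sym))
    u-≢ : ∀ {a} → a ∈ u → a ≢ z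
    u-≢ a∈ = face-≢ face-z (∈-++⁺ʳ v a∈)
    tail-filter : FaceCycle (z ∷ v ++ u) → filterᵇ (isRep D) (z ∷ v) ≡ z ∷ []
    tail-filter g rewrite isRep-min z (v ++ u) g (λ e∈ → le (Permₚ.∈-resp-↭ (↭-sym c↭) e∈)) =
      cong (z ∷_) (filterᵇ-all-false (isRep D) v (λ a∈ → nonmin (Permₚ.∈-resp-↭ (↭-sym c↭) (there (∈-++⁺ˡ a∈))) (face-≢ g (∈-++⁺ˡ a∈))))
    0∈ : inList D 0 (orbit D z) ≡ true → 0 ∈ x ∷ l
    0∈ e with 0 ∈? (x ∷ l)
    ... | yes p = p
    ... | no ∉ = ⊥-elim (true≢false (trans (sym e) (∉⇒inList D 0 (orbit D z) λ 0∈o → bad (∈-orbit⁻ z (v ++ u) face-z 0∈o))))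
      where
      bad : 0 ∈ z ∷ v ++ u ⊎ n' ≤ 0 → ⊥
      bad (inj₁ p) = ∉ (Permₚ.∈-resp-↭ (↭-sym c↭) p)
      bad (inj₂ p) = ℕₚ.<⇒≱ 0<n p

  module _ {cs : List (List ℕ)} (dec : Decomp n' rot' cs) where

    decomp-face : ∀ {c} → c ∈ cs → FaceCycle c
    decomp-face {c} c∈ with xs , ys , eq ← ∈-∃++ c∈ = All.lookup (cycles dec) c∈ , concat (xs ++ ys) ,
      ↭-trans (concat-↭ (↭-trans (↭-sym (Permₚ.shift c xs ys)) (↭-reflexive (sym eq)))) (cover dec)

    filter-darts : ∀ (q : ℕ → Bool) → (∀ {d} → isRep D d ≡ false → q d ≡ false) →
                   filterᵇ q (allDarts D) ↭ concat (map (filterᵇ q) cs)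
    filter-darts q q-rep = begin
      filterᵇ q (upTo (n' ℕ.+ (n' ℕ.+ 0)))
        ≡⟨ cong (λ k → filterᵇ q (upTo (n' ℕ.+ k))) (ℕₚ.+-identityʳ n') ⟩
      filterᵇ q (upTo (n' ℕ.+ n'))
        ≡⟨ cong (filterᵇ q) (upTo-+ n' n') ⟩
      filterᵇ q (upTo n' ++ map (n' ℕ.+_) (upTo n'))
        ≡⟨ Listₚ.filter-++ (T? ∘ q) (upTo n') _ ⟩
      filterᵇ q (upTo n') ++ filterᵇ q (map (n' ℕ.+_) (upTo n'))
        ≡⟨ cong (filterᵇ q (upTo n') ++_) (filterᵇ-all-false q _ nonroot) ⟩
      filterᵇ q (upTo n') ++ []
        ≡⟨ Listₚ.++-identityʳ _ ⟩
      filterᵇ q (upTo n')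
        ↭⟨ Permₚ.filter-↭ (T? ∘ q) (↭-sym (cover dec)) ⟩
      filterᵇ q (concat cs)
        ≡⟨ filterᵇ-concat q cs ⟩
      concat (map (filterᵇ q) cs) ∎
      where
      open Perm.PermutationReasoning
      nonroot : ∀ {x} → x ∈ map (n' ℕ.+_) (upTo n') → q x ≡ false
      nonroot x∈ with e , e∈ , refl ← ∈-map⁻ (n' ℕ.+_) x∈ = q-rep (isRep-nonroot e (∈-upTo⁻ e∈))

    decomp-m : m D ≡ length cs
    decomp-m = trans (Permₚ.↭-length (filter-darts (isRep D) id)) (go cs decomp-face)
      where
      go : ∀ cs → (∀ {c} → c ∈ cs → FaceCycle c) → length (concat (map (filterᵇ (isRep D)) cs)) ≡ length cs
      go []       ok = refl
      go (c ∷ cs) ok rewrite filter-rep (face-rep (ok (here refl))) = cong suc (go cs (ok ∘ there))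

  decomp-Rword : ∀ {r rest} → Decomp n' rot' ((0 ∷ r) ∷ rest) → Rword D ≡ map (lab s') (0 ∷ r)
  decomp-Rword {r} dec = labels-face 0 r (decomp-face dec (here refl))

  decomp-Λ : ∀ {r rest} → Decomp n' rot' ((0 ∷ r) ∷ rest) → Λ D ↭ map (cyc ∘ map (lab s')) rest
  decomp-Λ {r} {rest} dec = ↭-trans (Permₚ.map⁺ F (filter-darts dec q q-rep))
    (↭-reflexive (cong (map F) (cong (_++ concat (map (filterᵇ q) rest)) (first (decomp-face dec (here refl))))
      ⟨ trans ⟩ go rest (λ c∈ → decomp-face dec (there c∈) , 0∉ c∈)))
    where
    F : ℕ → Word
    F d = cyc (labels D (orbit D d))
    q : ℕ → Bool
    q d = isRep D d ∧ not (inList D 0 (orbit D d))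
    q-rep : ∀ {d} → isRep D d ≡ false → q d ≡ false
    q-rep e rewrite e = refl
    filter-q : ∀ c → filterᵇ q c ≡ filterᵇ (λ d → not (inList D 0 (orbit D d))) (filterᵇ (isRep D) c)
    filter-q []      = refl
    filter-q (x ∷ c) with isRep D x
    ... | false = filter-q c
    ... | true with inList D 0 (orbit D x)
    ...   | true  = filter-q c
    ...   | false = cong (x ∷_) (filter-q c)
    first : FaceCycle (0 ∷ r) → filterᵇ q (0 ∷ r) ≡ []
    first face = trans (filter-q (0 ∷ r)) (trans (cong (filterᵇ _) (filter-rep R)) lem)
      where
      R : Rep (0 ∷ r)
      R = face-rep face
      lem : filterᵇ (λ d → not (inList D 0 (orbit D d))) (rep R ∷ []) ≡ []
      lem rewrite rep-0∈ R (here refl) = refl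
    0∉ : ∀ {c} → c ∈ rest → 0 ∉ c
    0∉ {c} c∈ 0∈c with unique-resp-↭ (↭-sym (cover dec)) (Uniqueₚ.upTo⁺ n')
    ... | 0∉ ∷ _ = All.lookup 0∉ (∈-++⁺ʳ r (∈-concat⁺′ 0∈c c∈)) refl
    go : ∀ cs → (∀ {c} → c ∈ cs → FaceCycle c × 0 ∉ c) → map F (concat (map (filterᵇ q) cs)) ≡ map (cyc ∘ map (lab s')) cs
    go []       ok = refl
    go (c ∷ cs) ok = trans (cong (λ l → map F (l ++ concat (map (filterᵇ q) cs))) lem)
      (cong₂ _∷_ (cyc-rep R) (go cs (ok ∘ there)))
      where
      R : Rep c
      R = face-rep (proj₁ (ok (here refl)))
      lem' : inList D 0 (orbit D (rep R)) ≡ false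
      lem' with inList D 0 (orbit D (rep R)) in e
      ... | false = refl
      ... | true  = ⊥-elim (proj₂ (ok (here refl)) (0∈-rep R e))
      lem : filterᵇ q c ≡ rep R ∷ []
      lem rewrite filter-q c | filter-rep R | lem' = refl

-- Permutations

insertAll⁻ : ∀ x q {p} → p ∈ insertAll x q → p ↭ x ∷ q
insertAll⁻ x []       (here refl) = ↭-refl
insertAll⁻ x (y ∷ ys) (here refl) = ↭-refl
insertAll⁻ x (y ∷ ys) (there p∈) with p' , p'∈ , refl ← ∈-map⁻ (y ∷_) p∈ =
  ↭-trans (Perm.prep y (insertAll⁻ x ys p'∈)) (Perm.swap y x ↭-refl)

insertAll⁺ : ∀ x u v → u ++ x ∷ v ∈ insertAll x (u ++ v)
insertAll⁺ x []      []      = here refl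
insertAll⁺ x []      (y ∷ v) = here refl
insertAll⁺ x (y ∷ u) v       = there (∈-map⁺ (y ∷_) (insertAll⁺ x u v))

perms⁻ : ∀ xs {p} → p ∈ perms xs → p ↭ xs
perms⁻ []       (here refl) = ↭-refl
perms⁻ (x ∷ xs) p∈ with q , q∈ , p∈' ← find (∈-concatMap⁻ (insertAll x) p∈) =
  ↭-trans (insertAll⁻ x q p∈') (Perm.prep x (perms⁻ xs q∈))

perms⁺ : ∀ xs {p} → p ↭ xs → p ∈ perms xs
perms⁺ [] p↭ with refl ← Permₚ.↭-empty-inv p↭ = here refl
perms⁺ (x ∷ xs) p↭ with u , v , refl ← ∈-∃++ (Permₚ.∈-resp-↭ (↭-sym p↭) (here refl)) =
  ∈-concatMap⁺ (insertAll x) (lose (perms⁺ xs (Permₚ.drop-mid u [] p↭)) (insertAll⁺ x u v))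

remove : ℕ → List ℕ → List ℕ
remove x = filterᵇ (λ y → not (x ≡ᵇ y))

remove-∉ : ∀ x q → x ∉ q → remove x q ≡ q
remove-∉ x []      _  = refl
remove-∉ x (y ∷ q) x∉ rewrite ≢⇒≡ᵇ-false {x} {y} (x∉ ∘ here) = cong (y ∷_) (remove-∉ x q (x∉ ∘ there))

remove-self : ∀ x q → remove x (x ∷ q) ≡ remove x q
remove-self x q rewrite ≡ᵇ-complete {x} refl = refl

remove-insertAll : ∀ x q {p} → x ∉ q → p ∈ insertAll x q → remove x p ≡ q
remove-insertAll x []       x∉ (here refl) = remove-self x []
remove-insertAll x (y ∷ ys) x∉ (here refl) = trans (remove-self x (y ∷ ys)) (remove-∉ x (y ∷ ys) x∉)
remove-insertAll x (y ∷ ys) x∉ (there p∈) with p' , p'∈ , refl ← ∈-map⁻ (y ∷_) p∈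
  rewrite ≢⇒≡ᵇ-false {x} {y} (x∉ ∘ here) = cong (y ∷_) (remove-insertAll x ys (x∉ ∘ there) p'∈)

unique-insertAll : ∀ x q → x ∉ q → Unique (insertAll x q)
unique-insertAll x []       x∉ = [] ∷ []
unique-insertAll x (y ∷ ys) x∉ = All.tabulate (λ p∈ e → head-≢ p∈ e) ∷
  Uniqueₚ.map⁺ Listₚ.∷-injectiveʳ (unique-insertAll x ys (x∉ ∘ there))
  where
  head-≢ : ∀ {p} → p ∈ map (y ∷_) (insertAll x ys) → x ∷ y ∷ ys ≢ p
  head-≢ p∈ e with p' , _ , refl ← ∈-map⁻ (y ∷_) p∈ = x∉ (here (Listₚ.∷-injectiveˡ e))

unique-concatMap-insertAll : ∀ x ps → (∀ {p} → p ∈ ps → x ∉ p) → Unique ps → Unique (concatMap (insertAll x) ps)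
unique-concatMap-insertAll x []       x∉ []        = []
unique-concatMap-insertAll x (p ∷ ps) x∉ (p∉ ∷ us) = Uniqueₚ.++⁺ (unique-insertAll x p (x∉ (here refl)))
  (unique-concatMap-insertAll x ps (x∉ ∘ there) us) disjoint
  where
  disjoint : ∀ {v} → v ∈ insertAll x p × v ∈ concatMap (insertAll x) ps → ⊥
  disjoint (v∈ , v∈') with q , q∈ , v∈q ← find (∈-concatMap⁻ (insertAll x) v∈') =
    All.lookup p∉ q∈ (trans (sym (remove-insertAll x p (x∉ (here refl)) v∈)) (remove-insertAll x q (x∉ (there q∈)) v∈q))

unique-perms : ∀ xs → Unique xs → Unique (perms xs)
unique-perms []       []        = [] ∷ []
unique-perms (x ∷ xs) (x∉ ∷ us) = unique-concatMap-insertAll x (perms xs)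
  (λ p∈ x∈p → All.lookup x∉ (Permₚ.∈-resp-↭ (perms⁻ xs p∈) x∈p) refl) (unique-perms xs us)

unique-⊆-↭ : ∀ {A : Set} (xs ys : List A) → Unique xs → Unique ys →
             (∀ {a} → a ∈ xs → a ∈ ys) → (∀ {a} → a ∈ ys → a ∈ xs) → xs ↭ ys
unique-⊆-↭ []       []       _ _ _ _ = ↭-refl
unique-⊆-↭ []       (y ∷ ys) _ _ _ ⊇ with () ← ⊇ (here refl)
unique-⊆-↭ (x ∷ xs) ys (x∉ ∷ ux) uy ⊆ ⊇ with u , v , refl ← ∈-∃++ (⊆ (here refl))
  with x∉' ∷ uv ← unique-resp-↭ (Permₚ.shift x u v) uy =
  ↭-trans (Perm.prep x (unique-⊆-↭ xs (u ++ v) ux uv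
    (λ a∈ → ∈-tail (Permₚ.∈-resp-↭ (Permₚ.shift x u v) (⊆ (there a∈))) (λ e → All.lookup x∉ a∈ (sym e)))
    (λ a∈ → ∈-tail (⊇ (Permₚ.∈-resp-↭ (↭-sym (Permₚ.shift x u v)) (there a∈))) (λ e → All.lookup x∉' a∈ (sym e)))))
    (↭-sym (Permₚ.shift x u v))
  where
  ∈-tail : ∀ {A : Set} {a b : A} {l} → a ∈ b ∷ l → a ≢ b → a ∈ l
  ∈-tail (here e)  ne = ⊥-elim (ne e)
  ∈-tail (there p) _  = p

append-↭ : ∀ {n k p} → k < n → p ↭ oneTo n → append k p ↭ oneTo (suc n)
append-↭ {n} {k} {p} k<n p↭ = ↭-trans (↭-sym (Permₚ.∷↭∷ʳ (suc k) _))
  (↭-trans (Perm.prep (suc k) (Permₚ.map⁺ _ p↭)) (↭-sym (oneTo-skip k n k<n)))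

append⁻ : ∀ {n q} → 0 < n → q ↭ oneTo (suc n) → ∃₂ λ k p → k < n × p ↭ oneTo n × q ≡ append k p
append⁻ {n} {q} 0<n q↭ with initLast q
append⁻ {suc n} _ q↭ | [] with () ← Permₚ.↭-empty-inv (↭-sym q↭)
append⁻ {n} 0<n q↭ | q' ∷ʳ′ z with k , k∈ , refl ← ∈-map⁻ suc (Permₚ.∈-resp-↭ q↭ (∈-++⁺ʳ q' (here refl)))
  with k<n ← ∈-upTo⁻ k∈
  with p , refl , p↭ ← Permₚ.↭-map-inv (skip (suc k)) (↭-sym (Permₚ.drop-∷ (↭-trans (Permₚ.∷↭∷ʳ (suc k) q') (↭-trans q↭ (oneTo-skip k n k<n)))))
  = k , p , k<n , ↭-sym p↭ , refl

append-injective : ∀ {p q k j} → append k p ≡ append j q → p ≡ q × k ≡ j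
append-injective {p} {q} {k} {j} e with Listₚ.∷ʳ-injective (map (skip (suc k)) p) (map (skip (suc j)) q) e
... | e₁ , refl = Listₚ.map-injective (skip-injective (suc k)) e₁ , refl

perms-append : ∀ n → 0 < n → perms (oneTo (suc n)) ↭ cartesianProductWith (λ p k → append k p) (perms (oneTo n)) (upTo n)
perms-append n 0<n = unique-⊆-↭ _ _ (unique-perms _ (unique-oneTo (suc n)))
  (Uniqueₚ.cartesianProductWith⁺ (λ p k → append k p) append-injective (unique-perms _ (unique-oneTo n)) (Uniqueₚ.upTo⁺ n))
  ⊆ ⊇
  where
  unique-oneTo : ∀ n → Unique (oneTo n)
  unique-oneTo n = Uniqueₚ.map⁺ ℕₚ.suc-injective (Uniqueₚ.upTo⁺ (n ∸ 1))
  ⊆ : ∀ {q} → q ∈ perms (oneTo (suc n)) → q ∈ cartesianProductWith (λ p k → append k p) (perms (oneTo n)) (upTo n)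
  ⊆ q∈ with k , p , k<n , p↭ , refl ← append⁻ 0<n (perms⁻ _ q∈) =
    ∈-cartesianProductWith⁺ (λ p k → append k p) (perms⁺ _ p↭) (∈-upTo⁺ k<n)
  ⊇ : ∀ {q} → q ∈ cartesianProductWith (λ p k → append k p) (perms (oneTo n)) (upTo n) → q ∈ perms (oneTo (suc n))
  ⊇ q∈ with p , k , p∈ , k∈ , refl ← ∈-cartesianProductWith⁻ (λ p k → append k p) (perms (oneTo n)) (upTo n) q∈ =
    perms⁺ _ (append-↭ (∈-upTo⁻ k∈) (perms⁻ _ p∈))

∑-cartesianProductWith : ∀ {A B C : Set} (g : A → B → C) xs ys (f : C → ℚ) →
                         ∑ (cartesianProductWith g xs ys) f ≡ ∑ xs (λ x → ∑ ys (λ y → f (g x y)))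
∑-cartesianProductWith g []       ys f = refl
∑-cartesianProductWith g (x ∷ xs) ys f = trans (∑-++ (map (g x) ys) _ f)
  (cong₂ ℚ._+_ (∑-map (g x) ys f) (∑-cartesianProductWith g xs ys f))

∑-dipoles : ∀ n (X : Dip → ℚ) → ∑ (dipoles n) X ≡ ∑ (perms (oneTo n)) (λ p → ∑ (oneTo n) (λ s → X (dip n (0 ∷ p) s)))
∑-dipoles n X = trans (∑-concatMap _ (perms (oneTo n)) X)
  (∑-cong (perms (oneTo n)) λ p → ∑-map (dip n (0 ∷ p)) (oneTo n) X)

insert : ℕ → Dip → Dip
insert k (dip n rot s) = dip (suc n) (map (skip (suc k)) rot ∷ʳ suc k) (skip (suc k) s)

-- If the last edge around the non-root vertex is the secondary one then γ = δ = 0,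
-- and such dipoles are the ones not obtained by an insertion.
∑-dipoles-suc : ∀ n (X : Dip → ℚ) →
  (∀ p k → p ↭ oneTo n → k < n → X (dip (suc n) (0 ∷ append k p) (suc k)) ≡ 0ℚ) →
  ∑ (dipoles (suc n)) X ≡ ∑ (dipoles n) (λ D → ∑ (upTo (Dip.n D)) (λ k → X (insert k D)))
∑-dipoles-suc zero    X _   = refl
∑-dipoles-suc n@(suc _) X X≡0 = begin
  ∑ (dipoles (suc n)) X
    ≡⟨ ∑-dipoles (suc n) X ⟩
  ∑ (perms (oneTo (suc n))) (λ q → ∑ (oneTo (suc n)) (λ s → X (dip (suc n) (0 ∷ q) s)))
    ≡⟨ ∑-↭ _ (perms-append n (s≤s z≤n)) ⟩
  ∑ (cartesianProductWith (λ p k → append k p) (perms (oneTo n)) (upTo n)) (λ q → ∑ (oneTo (suc n)) (λ s → X (dip (suc n) (0 ∷ q) s)))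
    ≡⟨ ∑-cartesianProductWith (λ p k → append k p) (perms (oneTo n)) (upTo n) _ ⟩
  ∑ (perms (oneTo n)) (λ p → ∑ (upTo n) (λ k → ∑ (oneTo (suc n)) (λ s → X (dip (suc n) (0 ∷ append k p) s))))
    ≡⟨ ∑-cong∈ (perms (oneTo n)) (λ p p∈ → ∑-cong∈ (upTo n) (λ k k∈ → step p k (perms⁻ _ p∈) (∈-upTo⁻ k∈))) ⟩
  ∑ (perms (oneTo n)) (λ p → ∑ (upTo n) (λ k → ∑ (oneTo n) (λ s → X (insert k (dip n (0 ∷ p) s)))))
    ≡⟨ ∑-cong (perms (oneTo n)) (λ p → ∑-swap (upTo n) (oneTo n) (λ k s → X (insert k (dip n (0 ∷ p) s)))) ⟩
  ∑ (perms (oneTo n)) (λ p → ∑ (oneTo n) (λ s → ∑ (upTo n) (λ k → X (insert k (dip n (0 ∷ p) s)))))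
    ≡⟨ ∑-dipoles n (λ D → ∑ (upTo (Dip.n D)) (λ k → X (insert k D))) ⟨
  ∑ (dipoles n) (λ D → ∑ (upTo (Dip.n D)) (λ k → X (insert k D))) ∎
  where
  open ≡-Reasoning
  step : ∀ p k → p ↭ oneTo n → k < n →
         ∑ (oneTo (suc n)) (λ s → X (dip (suc n) (0 ∷ append k p) s)) ≡ ∑ (oneTo n) (λ s → X (insert k (dip n (0 ∷ p) s)))
  step p k p↭ k<n = trans (∑-↭ (λ s → X (dip (suc n) (0 ∷ append k p) s)) (oneTo-skip k n k<n))
    (trans (cong₂ ℚ._+_ (X≡0 p k p↭ k<n) (∑-map (skip (suc k)) (oneTo n) (λ s → X (dip (suc n) (0 ∷ append k p) s)))) (ℚₚ.+-identityˡ _))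

0∷oneTo : ∀ {n p} → 0 < n → p ↭ oneTo n → 0 ∷ p ↭ upTo n
0∷oneTo {suc n} _ p↭ = ↭-trans (Perm.prep 0 p↭) (↭-reflexive (sym (upTo-suc n)))

decomp-exists : ∀ n p → p ↭ oneTo (suc n) → ∃₂ λ r rest → Decomp (suc n) (0 ∷ p) ((0 ∷ r) ∷ rest)
decomp-exists zero p p↭ with refl ← Permₚ.↭-empty-inv p↭ =
  [] , [] , record { cover = ↭-refl ; cycles = refl ∷ [] }
decomp-exists (suc n) q q↭ with k , p , k<n , p↭ , refl ← append⁻ (s≤s z≤n) q↭
  with r , rest , dec ← decomp-exists n p p↭
  with Permₚ.∈-resp-↭ (↭-sym (cover dec)) (∈-upTo⁺ k<n)
... | here k≡0 = _ , _ , Insert.decomp-first (suc n) p (0∷oneTo (s≤s z≤n) p↭) k k<n k≡0 dec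
... | there k∈ with ∈-++⁻ r k∈
...   | inj₁ k∈r with r₁ , r₂ , refl ← ∈-∃++ k∈r =
        _ , _ , Insert.decomp-split (suc n) p (0∷oneTo (s≤s z≤n) p↭) k k<n dec
...   | inj₂ k∈rest with c , k∈c , c∈ ← ∈-concat⁻′ rest k∈rest
        with xs , ys , refl ← ∈-∃++ c∈ | u , v , refl ← ∈-∃++ k∈c =
        _ , _ , Insert.decomp-join (suc n) p (0∷oneTo (s≤s z≤n) p↭) k k<n (Permₚ.shift (u ++ k ∷ v) xs ys) (u , k ∷ v , refl , refl) dec

-- Counting edges by region

filterᵇ-cong : ∀ {A : Set} {q q' : A → Bool} l → (∀ {e} → e ∈ l → q e ≡ q' e) → filterᵇ q l ≡ filterᵇ q' l
filterᵇ-cong [] eq = refl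
filterᵇ-cong {q = q} {q'} (x ∷ l) eq with q x | q' x | eq (here refl)
... | true  | .true  | refl = cong (x ∷_) (filterᵇ-cong l (eq ∘ there))
... | false | .false | refl = filterᵇ-cong l (eq ∘ there)

filterᵇ-map : ∀ {A B : Set} (q : B → Bool) (g : A → B) l → filterᵇ q (map g l) ≡ map g (filterᵇ (q ∘ g) l)
filterᵇ-map q g [] = refl
filterᵇ-map q g (x ∷ l) with q (g x)
... | true  = cong (g x ∷_) (filterᵇ-map q g l)
... | false = filterᵇ-map q g l

suc-<ᵇ-skip : ∀ k s → (suc k <ᵇ skip (suc k) s) ≡ (k <ᵇ s)
suc-<ᵇ-skip zero    zero    = refl
suc-<ᵇ-skip zero    (suc s) = refl
suc-<ᵇ-skip (suc k) zero    = refl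
suc-<ᵇ-skip (suc k) (suc s) = suc-<ᵇ-skip k s

module InsertCounts (n : ℕ) (p : List ℕ) (p↭ : p ↭ oneTo n) (k : ℕ) (k<n : k < n) where

  private
    rot↭ : 0 ∷ p ↭ upTo n
    rot↭ = 0∷oneTo (ℕₚ.≤-<-trans z≤n k<n) p↭
  open Insert n p rot↭ k k<n using (h; pos-h; pos-<; pos-new)

  oneTo-< : ∀ {e} → e ∈ oneTo n → e < n
  oneTo-< e∈ = ∈-upTo⁻ (Permₚ.∈-resp-↭ rot↭ (there (Permₚ.∈-resp-↭ (↭-sym p↭) e∈)))

  module _ (s : ℕ) (s∈ : s ∈ oneTo n) where

    D D' : Dip
    D  = dip n (0 ∷ p) s
    D' = insert k D

    ordinary-insert : ordinary D' ↭ suc k ∷ map h (ordinary D)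
    ordinary-insert = ↭-trans (Permₚ.filter-↭ (T? ∘ (λ e → not (e ≡ᵇ h s))) (oneTo-skip k n k<n))
      (↭-reflexive (trans (lem (≢⇒≡ᵇ-false (skip-≢ (suc k) s ∘ sym))) (cong (suc k ∷_)
        (trans (filterᵇ-map (λ e → not (e ≡ᵇ h s)) h (oneTo n))
               (cong (map h) (filterᵇ-cong (oneTo n) λ {e} _ → cong not (skip-≡ᵇ (suc k) e s)))))))
      where
      lem : ∀ {l} → (suc k ≡ᵇ h s) ≡ false → filterᵇ (λ e → not (e ≡ᵇ h s)) (suc k ∷ l) ≡ suc k ∷ filterᵇ (λ e → not (e ≡ᵇ h s)) l
      lem eq rewrite eq = refl

    countE-insert : ∀ (q' q : ℕ → Bool) → (∀ e → e < n → q' (h e) ≡ q e) →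
                    countE D' q' ≡ (if q' (suc k) then suc (countE D q) else countE D q)
    countE-insert q' q eq = trans (Permₚ.↭-length (Permₚ.filter-↭ (T? ∘ q') ordinary-insert)) (go (q' (suc k)) refl)
      where
      rest-eq : length (filterᵇ q' (map h (ordinary D))) ≡ countE D q
      rest-eq = trans (cong length (filterᵇ-map q' h (ordinary D)))
        (trans (Listₚ.length-map h (filterᵇ (q' ∘ h) (ordinary D)))
          (cong length (filterᵇ-cong (ordinary D) λ {e} e∈ → eq e (oneTo-< (proj₁ (∈-filter⁻ (T? ∘ (λ e → not (e ≡ᵇ s))) {xs = oneTo n} e∈))))))
      go : ∀ b → q' (suc k) ≡ b → length (filterᵇ q' (suc k ∷ map h (ordinary D))) ≡ (if b then suc (countE D q) else countE D q)
      go true  e rewrite e = cong suc rest-eq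
      go false e rewrite e = rest-eq

    inR3-h : ∀ e → e < n → inR3 D' (h e) ≡ inR3 D e
    inR3-h e e<n = cong₂ _<ᵇ_ (pos-h e e<n) (pos-h s (oneTo-< s∈))

    inR1-h : ∀ e → inR1 D' (h e) ≡ inR1 D e
    inR1-h e = skip-<ᵇ (suc k) e s

    inR3-new : inR3 D' (suc k) ≡ false
    inR3-new = trans (cong₂ _<ᵇ_ pos-new (pos-h s (oneTo-< s∈))) (≥⇒<ᵇ-false (ℕₚ.<⇒≤ (pos-< s (oneTo-< s∈))))

    α-insert : αD D' ≡ αD D
    α-insert = trans (countE-insert _ _ (λ e e<n → cong₂ (λ a b → not a ∧ b) (inR1-h e) (inR3-h e e<n)))
      (cong (λ b → if b then suc (αD D) else αD D) (trans (cong (not (inR1 D' (suc k)) ∧_) inR3-new) (Boolₚ.∧-zeroʳ _)))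

    β-insert : βD D' ≡ βD D
    β-insert = trans (countE-insert _ _ (λ e e<n → cong₂ _∧_ (inR1-h e) (inR3-h e e<n)))
      (cong (λ b → if b then suc (βD D) else βD D) (trans (cong (inR1 D' (suc k) ∧_) inR3-new) (Boolₚ.∧-zeroʳ _)))

    γ-insert : γD D' ≡ (if k <ᵇ s then γD D else suc (γD D))
    γ-insert = trans (countE-insert _ _ (λ e e<n → cong₂ (λ a b → not a ∧ not b) (inR1-h e) (inR3-h e e<n))) lem
      where
      lem : (if not (inR1 D' (suc k)) ∧ not (inR3 D' (suc k)) then suc (γD D) else γD D) ≡ (if k <ᵇ s then γD D else suc (γD D))
      lem rewrite inR3-new | suc-<ᵇ-skip k s with k <ᵇ s
      ... | true  = refl
      ... | false = refl

    δ-insert : δD D' ≡ δD D ℕ.+ δ● (lab s k)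
    δ-insert = trans (countE-insert _ _ (λ e e<n → cong₂ (λ a b → a ∧ not b) (inR1-h e) (inR3-h e e<n))) lem
      where
      lem : (if inR1 D' (suc k) ∧ not (inR3 D' (suc k)) then suc (δD D) else δD D) ≡ δD D ℕ.+ δ● (lab s k)
      lem rewrite inR3-new | suc-<ᵇ-skip k s with k <ᵇ s
      ... | true  = ℕₚ.+-comm 1 (δD D)
      ... | false = sym (ℕₚ.+-identityʳ (δD D))

    γδ-insert : γD D' ℕ.+ δD D' ≡ suc (γD D ℕ.+ δD D)
    γδ-insert = trans (cong₂ ℕ._+_ γ-insert δ-insert) lem
      where
      lem : (if k <ᵇ s then γD D else suc (γD D)) ℕ.+ (δD D ℕ.+ δ● (lab s k)) ≡ suc (γD D ℕ.+ δD D)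
      lem with k <ᵇ s
      ... | true  = trans (cong (γD D ℕ.+_) (ℕₚ.+-comm (δD D) 1)) (ℕₚ.+-suc (γD D) (δD D))
      ... | false = cong (λ z → suc (γD D ℕ.+ z)) (ℕₚ.+-identityʳ (δD D))

  last-secondary : let E = dip (suc n) (0 ∷ append k p) (suc k) in γD E ℕ.+ δD E ≡ 0
  last-secondary = cong₂ ℕ._+_
    (cong length (filterᵇ-all-false _ (ordinary E) λ {e} e∈ → trans (cong (λ b → not (inR1 E e) ∧ not b) (inR3-true e∈)) (Boolₚ.∧-zeroʳ _)))
    (cong length (filterᵇ-all-false _ (ordinary E) λ {e} e∈ → trans (cong (λ b → inR1 E e ∧ not b) (inR3-true e∈)) (Boolₚ.∧-zeroʳ _)))
    where
    E : Dip
    E = dip (suc n) (0 ∷ append k p) (suc k)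
    inR3-true : ∀ {e} → e ∈ ordinary E → inR3 E e ≡ true
    inR3-true {e} e∈ with e∈1 , ne ← ∈-filter⁻ (T? ∘ (λ e → not (e ≡ᵇ suc k))) {xs = oneTo (suc n)} e∈
      with Permₚ.∈-resp-↭ (oneTo-skip k n k<n) e∈1
    ... | here refl = ⊥-elim (subst (T ∘ not) (≡ᵇ-complete {suc k} refl) ne)
    ... | there e∈h with a , a∈ , refl ← ∈-map⁻ h e∈h = <⇒<ᵇ-true (subst₂ _<_ (sym (pos-h a (oneTo-< a∈))) (sym pos-new) (pos-< a (oneTo-< a∈)))

-- Inserting an edge in all possible corners is the action of the operators

monoD-decomp : ∀ {n rot s r rest} → 0 < n → Decomp n rot ((0 ∷ r) ∷ rest) → let D = dip n rot s in
  monoD D ≡ mono (suc (αD D)) (βD D) (γD D ℕ.+ δD D) (δD D) (n ∸ suc (length rest))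
                 (map (lab s) (0 ∷ r) ∷ []) (sortW (map (cyc ∘ map (lab s)) rest))
monoD-decomp {n} {rot} {s} {r} {rest} 0<n dec = cong₃ (mono (suc (αD D)) (βD D) (γD D ℕ.+ δD D) (δD D))
    (cong (n ∸_) (decomp-m dec)) (cong (_∷ []) (decomp-Rword dec)) (sortW-resp-↭ (decomp-Λ dec))
  where
  open Faces n rot s 0<n

hd : List ℕ → ℕ
hd []      = 0
hd (x ∷ _) = x

∑-rots : ∀ (c : List ℕ) (X : ℕ → ℚ) → ∑ c X ≡ ∑ (rots c) (X ∘ hd)
∑-rots c X = sym (trans (∑-map _ (upTo (length c)) (X ∘ hd)) (go c (λ k → take k c)))
  where
  go : ∀ c (t : ℕ → List ℕ) → ∑ (upTo (length c)) (λ k → X (hd (drop k c ++ t k))) ≡ ∑ c X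
  go []      t = refl
  go (x ∷ c) t = trans (∑-upTo-suc (length c) (λ k → X (hd (drop k (x ∷ c) ++ t k)))) (cong (X x ℚ.+_) (go c (t ∘ suc)))

∑-nth : ∀ (r : List ℕ) (X : ℕ → ℚ) → ∑ r X ≡ ∑ (upTo (length r)) (X ∘ nth r)
∑-nth []      X = refl
∑-nth (x ∷ r) X = sym (trans (∑-upTo-suc (length r) (X ∘ nth (x ∷ r))) (cong (X x ℚ.+_) (sym (∑-nth r X))))

module Pointwise (n₀ : ℕ) (p : List ℕ) (p↭ : p ↭ oneTo (suc n₀)) (s₀ : ℕ) (s∈ : suc s₀ ∈ oneTo (suc n₀))
  (M : Mono) (can : Canonical M) where

  n' s' : ℕ
  n' = suc n₀
  s' = suc s₀

  D : Dip
  D = dip n' (0 ∷ p) s'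

  rot↭ : 0 ∷ p ↭ upTo n'
  rot↭ = 0∷oneTo (s≤s z≤n) p↭

  M⁺ : Mono
  M⁺ = record M { ev = suc (ev M) }

  X : ℕ → ℚ
  X k = ⟦ monoD (insert k D) ==M M⁺ ⟧

  W : List ℕ → Word
  W = cyc ∘ map (lab s')

  mono-D : ℕ → ℕ → List Word → List Word → Mono
  mono-D = mono (suc (αD D)) (βD D) (γD D ℕ.+ δD D)

  lab-h : ∀ k a → lab (skip (suc k) s') (skip (suc k) a) ≡ lab s' a
  lab-h k a = cong (λ b → if b then ● else ○) (skip-<ᵇ (suc k) a s')

  lab-new : ∀ k → lab (skip (suc k) s') (suc k) ≡ lab s' k
  lab-new k = cong (λ b → if b then ● else ○) (suc-<ᵇ-skip k s')

  lab-k : ∀ k → lab (skip (suc k) s') k ≡ lab s' k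
  lab-k k = trans (cong (lab (skip (suc k) s')) (sym (skip-suc-self k))) (lab-h k k)

  map-lab-h : ∀ k l → map (lab (skip (suc k) s')) (map (skip (suc k)) l) ≡ map (lab s') l
  map-lab-h k l = trans (sym (Listₚ.map-∘ l)) (Listₚ.map-cong (lab-h k) l)

  map-W-h : ∀ k cs → map (cyc ∘ map (lab (skip (suc k) s'))) (map (map (skip (suc k))) cs) ≡ map W cs
  map-W-h k cs = trans (sym (Listₚ.map-∘ cs)) (Listₚ.map-cong (cong cyc ∘ map-lab-h k) cs)

  X-decomp : ∀ {k r rest u g fs} → k < n' → Decomp (suc n') (0 ∷ append k p) ((0 ∷ r) ∷ rest) →
    n' ∸ length rest ≡ u → map (lab (skip (suc k) s')) (0 ∷ r) ≡ g →
    sortW (map (cyc ∘ map (lab (skip (suc k) s'))) rest) ≡ fs →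
    X k ≡ ⟦ mono-D (δD D ℕ.+ δ● (lab s' k)) u (g ∷ []) fs ==M M ⟧
  X-decomp {k} {r} {rest} k<n dec refl refl refl = cong (λ m → ⟦ m ==M M⁺ ⟧)
    (trans (monoD-decomp {s = skip (suc k) s'} (s≤s z≤n) dec)
    (cong₄ (λ a b c w → mono (suc a) b c w (n' ∸ length rest) (map (lab (skip (suc k) s')) (0 ∷ r) ∷ [])
              (sortW (map (cyc ∘ map (lab (skip (suc k) s'))) rest)))
      (α-insert s' s∈) (β-insert s' s∈) (γδ-insert s' s∈) (δ-insert s' s∈)))
    where
    open InsertCounts n' p p↭ k k<n

  module _ {r : List ℕ} {rest : List (List ℕ)} (dec : Decomp n' (0 ∷ p) ((0 ∷ r) ∷ rest)) where

    Rs : Word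
    Rs = map (lab s') r

    Λs : List Word
    Λs = sortW (map W rest)

    u₀ : ℕ
    u₀ = n' ∸ suc (length rest)

    <n' : ∀ {a} → a ∈ concat ((0 ∷ r) ∷ rest) → a < n'
    <n' a∈ = ∈-upTo⁻ (Permₚ.∈-resp-↭ (cover dec) a∈)

    IsCycle-nonempty : ∀ c → IsCycle (ψ n' (0 ∷ p)) c → 0 < length c
    IsCycle-nonempty (x ∷ c) _ = s≤s z≤n

    Λs-⁻ : ∀ {T} → T ∈ Λs → ∃ λ c → c ∈ rest × T ≡ W c
    Λs-⁻ T∈ = ∈-map⁻ W (Permₚ.∈-resp-↭ (sortW-↭ (map W rest)) T∈)

    Λs-cyc : ∀ {T} → T ∈ Λs → cyc T ≡ T
    Λs-cyc T∈ with c , _ , refl ← Λs-⁻ T∈ = cyc-idem (map (lab s') c)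

    Λs-nonempty : ∀ {T} → T ∈ Λs → T ≢ []
    Λs-nonempty T∈ T≡[] with c , c∈ , refl ← Λs-⁻ T∈ = ℕₚ.<⇒≢ (IsCycle-nonempty c (All.lookup (All.tail (cycles dec)) c∈))
      (sym (trans (sym (Listₚ.length-map (lab s') c)) (trans (sym (cyc-length (map (lab s') c))) (cong length T≡[]))))

    open OneMonomial (suc (αD D)) (βD D) (γD D ℕ.+ δD D) (δD D) u₀ ● Rs Λs (sortW-idem (map W rest)) Λs-cyc Λs-nonempty

    length-cycles : ∀ {cs : List (List ℕ)} → All (IsCycle (ψ n' (0 ∷ p))) cs → length cs ≤ length (concat cs)
    length-cycles []                 = z≤n
    length-cycles {c ∷ cs} (cy ∷ cys) = ℕₚ.≤-trans (ℕₚ.+-mono-≤ (IsCycle-nonempty c cy) (length-cycles cys))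
      (ℕₚ.≤-reflexive (sym (Listₚ.length-++ c)))

    genus-≥0 : suc (length rest) ≤ n'
    genus-≥0 = ℕₚ.≤-trans (length-cycles (cycles dec))
      (ℕₚ.≤-reflexive (trans (Permₚ.↭-length (cover dec)) (Listₚ.length-upTo n')))

    X-first : X 0 ≡ mulTerm 1 0 (● ∷ []) (cyc R ∷ []) (𝟙 (d [] Λs)) M
    X-first = trans
      (X-decomp (s≤s z≤n) (Insert.decomp-first n' p rot↭ 0 (s≤s z≤n) refl dec)
        (trans (cong (λ l → n' ∸ suc l) (Listₚ.length-map (map (skip 1)) rest)) (sym (ℕₚ.+-identityʳ u₀)))
        refl
        (trans (cong (λ l → ins (cyc l) (sortW (map (cyc ∘ map (lab (skip 1 s'))) (map (map (skip 1)) rest))))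
               (cong₂ _∷_ (lab-new 0) (map-lab-h 0 r)))
          (cong₂ ins (sym (cyc-idem R)) (cong sortW (map-W-h 0 rest)))))
      (sym (mulTerm-𝟙 1 0 (● ∷ []) (cyc R ∷ []) (d [] Λs) M can))

    X-split : ∀ t → t < length r → X (nth r t) ≡ Cpart ● (drop t Rs) (take (suc t) Rs) (𝟙 (d [] Λs)) M
    X-split t t< with split-at t r t<
    ... | splitAt r₁ k r₂ eq dr tk refl = begin
      X (nth r t)
        ≡⟨ cong X (trans (cong (λ l → nth l t) eq) (nth-mid r₁)) ⟩
      X k
        ≡⟨ X-decomp k<n (Insert.decomp-split n' p rot↭ k k<n (subst (λ r → Decomp n' (0 ∷ p) ((0 ∷ r) ∷ rest)) eq dec))
             (trans (cong (λ l → n' ∸ suc l) (Listₚ.length-map (map (skip (suc k))) rest)) (sym (ℕₚ.+-identityʳ u₀)))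
             (cong (● ∷_) (cong₂ _∷_ (lab-k k) (map-lab-h k r₂)))
             (cong₂ ins cyc-eq (cong sortW (map-W-h k rest))) ⟩
      ⟦ times (δ● (lab s' k)) 0 (● ∷ lab s' k ∷ map (lab s') r₂) ((map (lab s') r₁ ∷ʳ lab s' k) ∷ []) (d [] Λs) ==M M ⟧
        ≡⟨ mulTerm-𝟙 (δ● (lab s' k)) 0 (● ∷ lab s' k ∷ map (lab s') r₂) ((map (lab s') r₁ ∷ʳ lab s' k) ∷ []) (d [] Λs) M can ⟨
      Cpart ● (lab s' k ∷ map (lab s') r₂) (map (lab s') r₁ ∷ʳ lab s' k) (𝟙 (d [] Λs)) M
        ≡⟨ cong₂ (λ x y → Cpart ● x y (𝟙 (d [] Λs)) M)
             (sym (trans (Listₚ.drop-map t r) (cong (map (lab s')) dr)))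
             (sym (trans (Listₚ.take-map (suc t) r) (trans (cong (map (lab s')) tk) (Listₚ.map-++ (lab s') r₁ (k ∷ []))))) ⟩
      Cpart ● (drop t Rs) (take (suc t) Rs) (𝟙 (d [] Λs)) M ∎
      where
      open ≡-Reasoning
      k<n : k < n'
      k<n = <n' (there (∈-++⁺ˡ (subst (k ∈_) (sym eq) (∈-++⁺ʳ r₁ (here refl)))))
      nth-mid : ∀ l → nth (l ++ k ∷ r₂) (length l) ≡ k
      nth-mid []      = refl
      nth-mid (_ ∷ l) = nth-mid l
      cyc-eq : cyc (lab (skip (suc k) s') (suc k) ∷ map (lab (skip (suc k) s')) (map (skip (suc k)) r₁)) ≡
               cyc (map (lab s') r₁ ∷ʳ lab s' k)
      cyc-eq = trans (cong cyc (cong₂ _∷_ (lab-new k) (map-lab-h k r₁))) (cyc-++-comm (lab s' k ∷ []) (map (lab s') r₁))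

    X-join : ∀ c → c ∈ rest → ∑ c X ≡ Jterm R (W c) (E (W c)) M
    X-join c c∈ with xs , ys , eq ← ∈-∃++ c∈ = begin
      ∑ c X
        ≡⟨ ∑-rots c X ⟩
      ∑ (rots c) (X ∘ hd)
        ≡⟨ ∑-cong∈ (rots c) one ⟩
      ∑ (rots c) (λ c' → Jpart ● Rs (map (lab s') c') (𝟙 (d [] Λ')) M)
        ≡⟨ ∑-map (map (lab s')) (rots c) (λ S → Jpart ● Rs S (𝟙 (d [] Λ')) M) ⟨
      ∑ (map (map (lab s')) (rots c)) (λ S → Jpart ● Rs S (𝟙 (d [] Λ')) M)
        ≡⟨ cong (λ l → ∑ l (λ S → Jpart ● Rs S (𝟙 (d [] Λ')) M)) (map-rots (lab s') c) ⟨
      ∑ (rotations (map (lab s') c)) (λ S → Jpart ● Rs S (𝟙 (d [] Λ')) M)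
        ≡⟨ ∑-↭ (λ S → Jpart ● Rs S (𝟙 (d [] Λ')) M) (rotations-cyc (map (lab s') c)) ⟨
      ∑ (rotations (W c)) (λ S → Jpart ● Rs S (𝟙 (d [] Λ')) M)
        ≡⟨ Jterm-≡ ● Rs (W c) (𝟙 (d [] Λ')) M ⟨
      Jterm R (W c) (𝟙 (d [] Λ')) M
        ≡⟨ local (linear-Jterm {ex M} {ey M} {ev M} {M} (can , refl , refl , refl) R (W c))
             (λ M' _ → E-𝟙 (W c) Λ' (cyc-idem (map (lab s') c)) Λs-ins M') ⟨
      Jterm R (W c) (E (W c)) M ∎
      where
      open ≡-Reasoning
      rest' : List (List ℕ)
      rest' = xs ++ ys
      rest↭ : rest ↭ c ∷ rest'
      rest↭ = ↭-trans (↭-reflexive eq) (Permₚ.shift c xs ys)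
      Λ' : List Word
      Λ' = sortW (map W rest')
      Λs-ins : Λs ≡ ins (W c) Λ'
      Λs-ins = sortW-resp-↭ (Permₚ.map⁺ W rest↭)
      length-rest : length rest ≡ suc (length rest')
      length-rest = Permₚ.↭-length rest↭
      genus : ∀ k → n' ∸ length (map (map (skip (suc k))) rest') ≡ u₀ ℕ.+ 2
      genus k = begin
        n' ∸ length (map (map (skip (suc k))) rest')    ≡⟨ cong (n' ∸_) (Listₚ.length-map _ rest') ⟩
        n' ∸ length rest'                               ≡⟨ cong (_∸ length rest') (ℕₚ.m∸n+n≡m le) ⟨
        (n' ∸ (2 ℕ.+ length rest')) ℕ.+ (2 ℕ.+ length rest') ∸ length rest'
          ≡⟨ cong (_∸ length rest') (ℕₚ.+-assoc (n' ∸ (2 ℕ.+ length rest')) 2 (length rest')) ⟨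
        (n' ∸ (2 ℕ.+ length rest')) ℕ.+ 2 ℕ.+ length rest' ∸ length rest' ≡⟨ ℕₚ.m+n∸n≡m _ (length rest') ⟩
        (n' ∸ (2 ℕ.+ length rest')) ℕ.+ 2                ≡⟨ cong (λ l → n' ∸ suc l ℕ.+ 2) length-rest ⟨
        u₀ ℕ.+ 2 ∎
        where
        le : 2 ℕ.+ length rest' ≤ n'
        le = subst (λ l → suc l ≤ n') length-rest genus-≥0
      one : ∀ c' → c' ∈ rots c → X (hd c') ≡ Jpart ● Rs (map (lab s') c') (𝟙 (d [] Λ')) M
      one c' c'∈ with u , v , eq-c , eq-c' ← ∈-rots⁻ c'∈ with c' in e
      ... | [] = ⊥-elim (ℕₚ.<⇒≢ (IsCycle-nonempty c (All.lookup (All.tail (cycles dec)) c∈))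
        (trans (cong length eq-c') (trans (Permₚ.↭-length (Permₚ.++-comm v u)) (cong length (sym eq-c)))))
      ... | k ∷ t = trans
        (X-decomp k<n (Insert.decomp-join n' p rot↭ k k<n rest↭ (u , v , eq-c , eq-c') dec)
          (genus k)
          (cong (● ∷_) (cong₂ _∷_ (lab-k k) (trans (Listₚ.map-++ (lab (skip (suc k) s')) (map (skip (suc k)) t) _)
            (cong₂ _++_ (map-lab-h k t) (cong₂ _∷_ (lab-new k) (map-lab-h k r))))))
          (cong sortW (map-W-h k rest')))
        (sym (mulTerm-𝟙 (δ● (lab s' k)) 2 (● ∷ (lab s' k ∷ map (lab s') t) ++ lab s' k ∷ Rs) [] (d [] Λ') M can))
        where
        k∈c : k ∈ c
        k∈c = subst (k ∈_) (sym eq-c) (Permₚ.∈-resp-↭ (Permₚ.++-comm v u) (subst (k ∈_) eq-c' (here refl)))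
        k<n : k < n'
        k<n = <n' (∈-++⁺ʳ (0 ∷ r) (∈-concat⁺′ k∈c c∈))

    pointwise-decomp : ∑ (upTo n') X ≡ C'' (𝟙 (monoD D)) M ℚ.+ u²J'' (𝟙 (monoD D)) M
    pointwise-decomp = begin
      ∑ (upTo n') X
        ≡⟨ ∑-↭ X (cover dec) ⟨
      X 0 ℚ.+ ∑ (r ++ concat rest) X
        ≡⟨ cong (X 0 ℚ.+_) (∑-++ r (concat rest) X) ⟩
      X 0 ℚ.+ (∑ r X ℚ.+ ∑ (concat rest) X)
        ≡⟨ ℚₚ.+-assoc (X 0) _ _ ⟨
      (X 0 ℚ.+ ∑ r X) ℚ.+ ∑ (concat rest) X
        ≡⟨ cong₂ ℚ._+_ (trans (ℚₚ.+-comm (X 0) _) (trans (cong₂ ℚ._+_ C-sum X-first) (sym (Cterm-≡ ● Rs (𝟙 (d [] Λs)) M)))) J-sum ⟩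
      Cterm R (𝟙 (d [] Λs)) M ℚ.+ ∑ Λs (λ T → Jterm R T (E T) M)
        ≡⟨ cong₂ ℚ._+_ (C''-𝟙 can) (J''-𝟙 can) ⟨
      C'' (𝟙 (d (R ∷ []) Λs)) M ℚ.+ u²J'' (𝟙 (d (R ∷ []) Λs)) M
        ≡⟨ cong (λ m → C'' (𝟙 m) M ℚ.+ u²J'' (𝟙 m) M) (monoD-decomp (s≤s z≤n) dec) ⟨
      C'' (𝟙 (monoD D)) M ℚ.+ u²J'' (𝟙 (monoD D)) M ∎
      where
      open ≡-Reasoning
      C-sum : ∑ r X ≡ ∑ (upTo (length Rs)) (λ t → Cpart ● (drop t Rs) (take (suc t) Rs) (𝟙 (d [] Λs)) M)
      C-sum = trans (∑-nth r X) (trans (∑-cong∈ (upTo (length r)) (λ t t∈ → X-split t (∈-upTo⁻ t∈)))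
        (cong (λ l → ∑ (upTo l) (λ t → Cpart ● (drop t Rs) (take (suc t) Rs) (𝟙 (d [] Λs)) M)) (sym (Listₚ.length-map (lab s') r))))
      J-sum : ∑ (concat rest) X ≡ ∑ Λs (λ T → Jterm R T (E T) M)
      J-sum = trans (∑-concat rest X) (trans (∑-cong∈ rest X-join)
        (trans (sym (∑-map W rest (λ T → Jterm R T (E T) M))) (∑-↭ (λ T → Jterm R T (E T) M) (↭-sym (sortW-↭ (map W rest))))))

  pointwise : ∑ (upTo n') X ≡ C'' (𝟙 (monoD D)) M ℚ.+ u²J'' (𝟙 (monoD D)) M
  pointwise with r , rest , dec ← decomp-exists n₀ p p↭ = pointwise-decomp dec

-- The differential equation

dipoles⁻ : ∀ n {D} → D ∈ dipoles n →
  ∃ λ n₀ → ∃₂ λ p s₀ → D ≡ dip (suc n₀) (0 ∷ p) (suc s₀) × p ↭ oneTo (suc n₀) × suc s₀ ∈ oneTo (suc n₀)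
dipoles⁻ zero ()
dipoles⁻ (suc n₀) D∈
  with p , p∈ , D∈' ← find (∈-concatMap⁻ (λ p → map (λ s → dip (suc n₀) (0 ∷ p) s) (oneTo (suc n₀))) {perms (oneTo (suc n₀))} D∈)
  with s , s∈ , refl ← ∈-map⁻ (λ s → dip (suc n₀) (0 ∷ p) s) D∈'
  with s₀ , _ , refl ← ∈-map⁻ suc s∈
  = n₀ , p , s₀ , refl , perms⁻ (oneTo (suc n₀)) p∈ , s∈

if-≢true : ∀ b x → b ≢ true → (if b then x else 0ℚ) ≡ 0ℚ
if-≢true false x _  = refl
if-≢true true  x ne = ⊥-elim (ne refl)

*-if : ∀ b r x y → (b ≡ true → r ℚ.* x ≡ y) → r ℚ.* (if b then x else 0ℚ) ≡ y ℚ.* ⟦ b ⟧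
*-if false r x y _  = trans (ℚₚ.*-zeroʳ r) (sym (ℚₚ.*-zeroʳ y))
*-if true  r x y eq = trans (eq refl) (sym (ℚₚ.*-identityʳ y))

∑-dipolesUpTo-suc : ∀ N (X : Dip → ℚ) →
  (∀ n p k → p ↭ oneTo n → k < n → X (dip (suc n) (0 ∷ append k p) (suc k)) ≡ 0ℚ) →
  ∑ (dipolesUpTo (suc N)) X ≡ ∑ (dipolesUpTo N) (λ D → ∑ (upTo (n D)) (λ k → X (insert k D)))
∑-dipolesUpTo-suc N X X≡0 = begin
  ∑ (dipolesUpTo (suc N)) X
    ≡⟨ ∑-concatMap dipoles (upTo (suc (suc N))) X ⟩
  ∑ (upTo (suc (suc N))) (λ n → ∑ (dipoles n) X)
    ≡⟨ ∑-upTo-suc (suc N) (λ n → ∑ (dipoles n) X) ⟩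
  0ℚ ℚ.+ ∑ (upTo (suc N)) (λ n → ∑ (dipoles (suc n)) X)
    ≡⟨ ℚₚ.+-identityˡ _ ⟩
  ∑ (upTo (suc N)) (λ n → ∑ (dipoles (suc n)) X)
    ≡⟨ ∑-cong (upTo (suc N)) (λ n → ∑-dipoles-suc n X (X≡0 n)) ⟩
  ∑ (upTo (suc N)) (λ n → ∑ (dipoles n) (λ D → ∑ (upTo (Dip.n D)) (λ k → X (insert k D))))
    ≡⟨ ∑-concatMap dipoles (upTo (suc N)) _ ⟨
  ∑ (dipolesUpTo N) (λ D → ∑ (upTo (n D)) (λ k → X (insert k D))) ∎
  where open ≡-Reasoning

coeffD-insert : ∀ {n p k s} (p↭ : p ↭ oneTo n) (k<n : k < n) → s ∈ oneTo n → let D = dip n (0 ∷ p) s in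
                ℕtoℚ (suc (γD D ℕ.+ δD D)) ℚ.* coeffD (insert k D) ≡ coeffD D
coeffD-insert {n} {p} {k} {s} p↭ k<n s∈ = begin
  ℕtoℚ (suc (γD D ℕ.+ δD D)) ℚ.* (inv! (suc (αD D')) ℚ.* inv! (βD D') ℚ.* inv! (γD D' ℕ.+ δD D'))
    ≡⟨ cong (λ a → ℕtoℚ (suc (γD D ℕ.+ δD D)) ℚ.* (inv! (suc a) ℚ.* inv! (βD D') ℚ.* inv! (γD D' ℕ.+ δD D'))) (α-insert s s∈) ⟩
  ℕtoℚ (suc (γD D ℕ.+ δD D)) ℚ.* (inv! (suc (αD D)) ℚ.* inv! (βD D') ℚ.* inv! (γD D' ℕ.+ δD D'))
    ≡⟨ cong₂ (λ b c → ℕtoℚ (suc (γD D ℕ.+ δD D)) ℚ.* (inv! (suc (αD D)) ℚ.* inv! b ℚ.* inv! c)) (β-insert s s∈) (γδ-insert s s∈) ⟩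
  ℕtoℚ (suc (γD D ℕ.+ δD D)) ℚ.* (inv! (suc (αD D)) ℚ.* inv! (βD D) ℚ.* inv! (suc (γD D ℕ.+ δD D)))
    ≡⟨ *-swap (ℕtoℚ (suc (γD D ℕ.+ δD D))) (inv! (suc (αD D)) ℚ.* inv! (βD D)) (inv! (suc (γD D ℕ.+ δD D))) ⟩
  inv! (suc (αD D)) ℚ.* inv! (βD D) ℚ.* (ℕtoℚ (suc (γD D ℕ.+ δD D)) ℚ.* inv! (suc (γD D ℕ.+ δD D)))
    ≡⟨ cong (inv! (suc (αD D)) ℚ.* inv! (βD D) ℚ.*_) (suc*inv! (γD D ℕ.+ δD D)) ⟩
  coeffD D ∎
  where
  open ≡-Reasoning
  open InsertCounts n p p↭ k k<n hiding (D; D')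
  D D' : Dip
  D  = dip n (0 ∷ p) s
  D' = insert k D

Γ-linear-comb : ∀ M → Γ M ≡ ∑ (dipolesUpTo (ex M ℕ.+ ey M ℕ.+ ev M ℕ.+ 1)) (λ D → coeffD D ℚ.* 𝟙 (monoD D) M)
Γ-linear-comb M = ∑-cong (dipolesUpTo (ex M ℕ.+ ey M ℕ.+ ev M ℕ.+ 1)) λ D →
  trans (if-* (monoD D ==M M) (coeffD D)) (ℚₚ.*-comm ⟦ monoD D ==M M ⟧ (coeffD D))

module _ (M : Mono) (can : Canonical M) where

  private
    N : ℕ
    N = ex M ℕ.+ ey M ℕ.+ ev M ℕ.+ 1

    M⁺ : Mono
    M⁺ = record M { ev = suc (ev M) }

    rhs : Series → ℚ
    rhs F = C'' F M ℚ.+ u²J'' F M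

    linear-rhs : Linear (Slice (ex M) (ey M) (ev M)) rhs
    linear-rhs = linear-+ (linear-C'' {M = M} (can , refl , refl , refl)) (linear-J'' {M = M} (can , refl , refl , refl))

    Y : Dip → ℚ
    Y D = if monoD D ==M M⁺ then coeffD D else 0ℚ

    rhs-Γ : rhs Γ ≡ ∑ (dipolesUpTo N) (λ D → coeffD D ℚ.* rhs (𝟙 (monoD D)))
    rhs-Γ = trans (local linear-rhs {F = Γ} {G = λ M' → ∑ (dipolesUpTo N) (λ D → coeffD D ℚ.* 𝟙 (monoD D) M')}
                      λ { M' (_ , refl , refl , refl) → Γ-linear-comb M' })
                  (linear-comb linear-rhs (dipolesUpTo N) coeffD (λ D → 𝟙 (monoD D)))

    Y-last-secondary : ∀ n p k → p ↭ oneTo n → k < n → Y (dip (suc n) (0 ∷ append k p) (suc k)) ≡ 0ℚ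
    Y-last-secondary n p k p↭ k<n = if-≢true (monoD D ==M M⁺) (coeffD D) λ eq →
      ℕₚ.0≢1+n (trans (sym (InsertCounts.last-secondary n p p↭ k k<n)) (cong ev (==M-sound (monoD D) M⁺ eq)))
      where
      D : Dip
      D = dip (suc n) (0 ∷ append k p) (suc k)

    Y-insert : ∀ {n p k s} → p ↭ oneTo n → k < n → s ∈ oneTo n → let D = dip n (0 ∷ p) s in
               ℕtoℚ (suc (ev M)) ℚ.* Y (insert k D) ≡ coeffD D ℚ.* ⟦ monoD (insert k D) ==M M⁺ ⟧
    Y-insert {n} {p} {k} {s} p↭ k<n s∈ =
      *-if (monoD (insert k D) ==M M⁺) (ℕtoℚ (suc (ev M))) (coeffD (insert k D)) (coeffD D) λ eq →
        trans (cong (λ c → ℕtoℚ c ℚ.* coeffD (insert k D))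
                (trans (sym (cong ev (==M-sound (monoD (insert k D)) M⁺ eq))) (InsertCounts.γδ-insert n p p↭ k k<n s s∈)))
              (coeffD-insert p↭ k<n s∈)
      where
      D : Dip
      D = dip n (0 ∷ p) s

    dipole-step : ∀ D → (∃ λ n₀ → ∃₂ λ p s₀ → D ≡ dip (suc n₀) (0 ∷ p) (suc s₀) × p ↭ oneTo (suc n₀) × suc s₀ ∈ oneTo (suc n₀)) →
      ∑ (upTo (n D)) (λ k → ℕtoℚ (suc (ev M)) ℚ.* Y (insert k D)) ≡ coeffD D ℚ.* rhs (𝟙 (monoD D))
    dipole-step D (n₀ , p , s₀ , refl , p↭ , s∈) =
      trans (∑-cong∈ (upTo (suc n₀)) (λ k k∈ → Y-insert p↭ (∈-upTo⁻ k∈) s∈))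
      (trans (∑-*ˡ (coeffD D) (upTo (suc n₀)) (λ k → ⟦ monoD (insert k D) ==M M⁺ ⟧))
        (cong (coeffD D ℚ.*_) (Pointwise.pointwise n₀ p p↭ s₀ s∈ M can)))

  Γ-pde : ∂v Γ M ≡ C'' Γ M ℚ.+ u²J'' Γ M
  Γ-pde = begin
    ℕtoℚ (suc (ev M)) ℚ.* ∑ (dipolesUpTo (ex M ℕ.+ ey M ℕ.+ suc (ev M) ℕ.+ 1)) Y
      ≡⟨ cong (λ K → ℕtoℚ (suc (ev M)) ℚ.* ∑ (dipolesUpTo (K ℕ.+ 1)) Y) (ℕₚ.+-suc (ex M ℕ.+ ey M) (ev M)) ⟩
    ℕtoℚ (suc (ev M)) ℚ.* ∑ (dipolesUpTo (suc N)) Y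
      ≡⟨ cong (ℕtoℚ (suc (ev M)) ℚ.*_) (∑-dipolesUpTo-suc N Y Y-last-secondary) ⟩
    ℕtoℚ (suc (ev M)) ℚ.* ∑ (dipolesUpTo N) (λ D → ∑ (upTo (n D)) (λ k → Y (insert k D)))
      ≡⟨ ∑-*ˡ (ℕtoℚ (suc (ev M))) (dipolesUpTo N) (λ D → ∑ (upTo (n D)) (λ k → Y (insert k D))) ⟨
    ∑ (dipolesUpTo N) (λ D → ℕtoℚ (suc (ev M)) ℚ.* ∑ (upTo (n D)) (λ k → Y (insert k D)))
      ≡⟨ ∑-cong∈ (dipolesUpTo N) (λ D D∈ → trans (sym (∑-*ˡ (ℕtoℚ (suc (ev M))) (upTo (n D)) (λ k → Y (insert k D))))
           (dipole-step D (let n , _ , D∈' = find (∈-concatMap⁻ dipoles {upTo (suc N)} D∈) in dipoles⁻ n D∈'))) ⟩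
    ∑ (dipolesUpTo N) (λ D → coeffD D ℚ.* rhs (𝟙 (monoD D)))
      ≡⟨ rhs-Γ ⟨
    rhs Γ ∎
    where open ≡-Reasoning

Γ-initial : ∀ M → atV0 Γ M ≡ B M
Γ-initial M = go (ev M ≡ᵇ 0) refl
  where
  Ds : List Dip
  Ds = dipolesUpTo (ex M ℕ.+ ey M ℕ.+ ev M ℕ.+ 1)
  ev-mono : ∀ D → (monoD D ==M M) ≡ true → (γD D ℕ.+ δD D ≡ᵇ 0) ≡ (ev M ≡ᵇ 0)
  ev-mono D e = cong (λ M' → ev M' ≡ᵇ 0) (==M-sound (monoD D) M e)
  go : ∀ b → (ev M ≡ᵇ 0) ≡ b → (if b then Γ M else 0ℚ) ≡ B M
  go true ev0 = ∑-cong Ds λ D → cong (λ b → if b then coeffD D else 0ℚ) (bool-iff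
    (λ e → ∧-intro (trans (ev-mono D e) ev0) e) (λ e → proj₂ (∧-true {γD D ℕ.+ δD D ≡ᵇ 0} e)))
  go false ev0 = sym (∑-0 Ds λ D _ → if-≢true ((γD D ℕ.+ δD D ≡ᵇ 0) ∧ (monoD D ==M M)) (coeffD D) λ e →
    let p , q = ∧-true {γD D ℕ.+ δD D ≡ᵇ 0} e in true≢false (trans (sym p) (trans (ev-mono D q) ev0)))

solution-unique : ∀ F → SolvesPDE F → InitialB F → ∀ v M → ev M ≡ v → Canonical M → F M ≡ Γ M
solution-unique F pde init zero    M@(mono _ _ _ _ _ _ _) refl can = trans (init M can) (sym (Γ-initial M))
solution-unique F pde init (suc v) M@(mono a b _ w u g f) refl can = ℕtoℚ-*-cancelˡ v (begin
  ∂v F M₀                        ≡⟨ pde M₀ can ⟩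
  C'' F M₀ ℚ.+ u²J'' F M₀        ≡⟨ cong₂ ℚ._+_ (local (linear-C'' {M = M₀} slice) IH) (local (linear-J'' {M = M₀} slice) IH) ⟩
  C'' Γ M₀ ℚ.+ u²J'' Γ M₀        ≡⟨ Γ-pde M₀ can ⟨
  ∂v Γ M₀                        ∎)
  where
  open ≡-Reasoning
  M₀ : Mono
  M₀ = mono a b v w u g f
  slice : Slice a b v M₀
  slice = can , refl , refl , refl
  IH : ∀ M' → Slice a b v M' → F M' ≡ Γ M'
  IH M' (can' , _ , _ , ev≡) = solution-unique F pde init v M' ev≡ can'

mainTheorem3 : (SolvesPDE Γ × InitialB Γ)
    × (∀ (F : Series) → SolvesPDE F → InitialB F →
    ∀ M → Canonical M → F M ≡ Γ M)
mainTheorem3 = (Γ-pde , λ M _ → Γ-initial M) , λ F pde init M can → solution-unique F pde init (ev M) M refl can
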